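{- Let $\Sigma$ be a shifted simplicial complex of dimension $d$. Then for each $0\le i\le d$, $$\mathbf S^{ud}_{i-1}(\Sigma)\ \overset{\circ}{=}\ \{\uparrow^{d-i}z(S,T)\colon (S,T)\in\mathrm{LSG}(\Sigma_i)\}$$ (as multisets), where $\Sigma_i$ is regarded as a family of $(i+1)$-element sets.
   Context: Shifted complex: a simplicial complex $\Sigma$ on vertex set an integer interval $[p,q]$ such that whenever $i<j$ are vertices, $F\in\Sigma$, $i\notin F$, $j\in F$, then $(F\setminus\{j\})\cup\{i\}\in\Sigma$. $\Sigma_i$ = set of $i$-dimensional faces. Weights: $\Bbbk$ is the field of rational functions over $\mathbb C$ in indeterminates $x_{a,j}$ ($a\ge1$, $j\in\mathbb Z$); $X_{a,j}=x_{a,j}^2$. For a finite multiset of integers $S=\{i_1\le\cdots\le i_m\}$, $x_S=x_{1,i_1}x_{2,i_2}\cdots x_{m,i_m}$, $X_S=x_S^2$, $x_\emptyset=1$. The raising operator $\uparrow$ is the substitution $x_{a,j}\mapsto x_{a+1,j}$ extended multiplicatively and additively (the paper also sets $\uparrow x_{d+1,j}=0$, which does not affect the quantities here); $\uparrow^a$ is its $a$-th iterate, applied elementwise to multisets. Algebraic fine weighting: for a complex $\Omega$ of dimension $e$ with integer vertices, $C_i(\Omega)$ is the $\Bbbk$-space with basis $[F]$, $F\in\Omega_i$ (including $[\emptyset]$ in degree $-1$). For $j\in F$, $\varepsilon(j,F)=(-1)^{k+1}$ if $j$ is the $k$-th smallest element of $F$. The boundary map $\boldsymbol\partial_{\Omega,i}:C_i\to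 C_{i-1}$ is $[F]\mapsto\sum_{j\in F}\varepsilon(j,F)\frac{\uparrow^{e-i}(x_F)}{\uparrow^{e-i+1}(x_{F\setminus j})}[F\setminus j]$, $\boldsymbol\partial^*$ its transpose, $\mathbf L^{ud}_{\Omega,i}=\boldsymbol\partial_{\Omega,i+1}\boldsymbol\partial^*_{\Omega,i+1}$, and $\mathbf S^{ud}_i(\Omega)$ is its multiset of eigenvalues (in an algebraic closure of $\Bbbk$). For multisets, $\mathbf a\overset{\circ}{=}\mathbf b$ means they agree except possibly in the multiplicity of $0$. $z$-polynomials: for finite multisets $S,T$ of integers, $z(S,T)=\frac{1}{\uparrow X_S}\sum_{j\in T}X_{S\cup j}$ (multiset union). Critical pairs: for a family $\mathcal F$ of $k$-element sets of integers, let $p_{\mathcal F}$ be the smallest integer occurring in a member. A critical pair is $(A,B)$ with $A=\{a_1<\cdots<a_k\}\in\mathcal F$, $B\notin\mathcal F$, and $B=\{a_1,\dots,a_{i-1},a_i+1,a_{i+1},\dots,a_k\}$ a $k$-set for some $i$ ($B$ need not consist of vertices). Its long signature is $\mathrm{lsg}(A,B)=(\{a_1,\dots,a_{i-1}\},\{j\in\mathbb Z: p_{\mathcal F}\le j\le a_i\})$, and $\mathrm{LSG}(\mathcal F)$ is the multiset of long signatures of all critical pairs. -}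

module Defs where

open import Data.Bool using (Bool; true; false; if_then_else_; _∧_; not)
open import Data.Nat as ℕ using (ℕ; zero; suc; _∸_)
open import Data.Integer as ℤ using (ℤ; +_; -_; _⊓_)
open import Data.Fin as Fin using (Fin; punchIn)
open import Data.List as List using (List; []; _∷_; _++_; map; foldr; concatMap; filter; length; concat; lookup)
open import Data.Bool.ListAction using (all; any)
open import Data.List.Membership.Propositional using (_∈_; _∉_)
open import Data.List.Relation.Unary.All using (All)
open import Data.List.Relation.Unary.Linked using (Linked)
open import Data.List.Relation.Unary.Unique.Propositional using (Unique)
open import Data.Product using (_×_; _,_; ∃; ∃-syntax; proj₁)
open import Data.Sum using (_⊎_)
open import Relation.Binary.PropositionalEquality using (_≡_; _≢_)
open import Relation.Nullary.Decidable using (⌊_⌋)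
open import Function.Bundles using (_⇔_)

-- A face (finite set of integers) is represented canonically as a strictly
-- increasing list of integers.  A complex is a duplicate-free list of faces.
Face : Set
Face = List ℤ

Cx : Set
Cx = List Face

StrictInc : Face → Set
StrictInc = Linked ℤ._<_

record IsSimplicialComplexOn (p q : ℤ) (K : Cx) : Set where
  field
    faces-canonical : All StrictInc K
    faces-distinct  : Unique K
    faces-in-range  : ∀ {F} → F ∈ K → All (λ v → (p ℤ.≤ v) × (v ℤ.≤ q)) F
    vertices        : ∀ v → p ℤ.≤ v → v ℤ.≤ q → (v ∷ []) ∈ K
    down-closed     : ∀ {F} → F ∈ K → ∀ G → StrictInc G →
                      (∀ v → v ∈ G → v ∈ F) → G ∈ K

-- Shifted: i < j vertices, F ∈ K, i ∉ F, j ∈ F  ⇒  (F ∖ {j}) ∪ {i} ∈ K.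
-- (F ∖ {j}) ∪ {i} is described through its canonical representative G.
IsShifted : ℤ → ℤ → Cx → Set
IsShifted p q K =
  ∀ {F} → F ∈ K → ∀ i j → p ℤ.≤ i → i ℤ.< j → j ℤ.≤ q → i ∉ F → j ∈ F →
  ∀ G → StrictInc G → (∀ v → v ∈ G ⇔ ((v ∈ F × v ≢ j) ⊎ v ≡ i)) → G ∈ K

IsShiftedComplex : ℤ → ℤ → Cx → Set
IsShiftedComplex p q K = IsSimplicialComplexOn p q K × IsShifted p q K

HasDim : ℕ → Cx → Set
HasDim d K = (∃[ F ] (F ∈ K × length F ≡ suc d)) × (∀ {F} → F ∈ K → length F ℕ.≤ suc d)

faces : ℕ → Cx → Cx
faces i K = filter (λ F → length F ℕ.≟ suc i) K

facesCard : ℕ → Cx → Cx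
facesCard k K = filter (λ F → length F ℕ.≟ k) K

-- Laurent polynomials over ℤ in the indeterminates x_{a,j} and an extra
-- indeterminate t (used for characteristic polynomials).

data Var : Set where
  tv : Var
  xv : ℕ → ℤ → Var

_==V_ : Var → Var → Bool
tv ==V tv = true
tv ==V xv _ _ = false
xv _ _ ==V tv = false
xv a j ==V xv b k = ⌊ a ℕ.≟ b ⌋ ∧ ⌊ j ℤ.≟ k ⌋

Mono : Set
Mono = List (Var × ℤ)

expOf : Var → Mono → ℤ
expOf v m = foldr (λ { (w , e) acc → if w ==V v then e ℤ.+ acc else acc }) (+ 0) m

-- equality of Laurent monomials (exponents of every variable agree;
-- only variables listed in m or m' can have nonzero exponent)
sameMono : Mono → Mono → Bool
sameMono m m' = all (λ v → ⌊ expOf v m ℤ.≟ expOf v m' ⌋) (map proj₁ (m ++ m'))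

LP : Set
LP = List (ℤ × Mono)

coeff : LP → Mono → ℤ
coeff P m = foldr (λ { (c , m') acc → if sameMono m' m then c ℤ.+ acc else acc }) (+ 0) P

_≈_ : LP → LP → Set
P ≈ Q = ∀ m → coeff P m ≡ coeff Q m
infix 4 _≈_

0L 1L : LP
0L = []
1L = (+ 1 , []) ∷ []

infixl 6 _+L_ _-L_
infixl 7 _*L_

_+L_ : LP → LP → LP
P +L Q = P ++ Q

negL : LP → LP
negL P = map (λ { (c , m) → (ℤ.- c , m) }) P

_-L_ : LP → LP → LP
P -L Q = P +L negL Q

_*L_ : LP → LP → LP
P *L Q = concatMap (λ { (c , m) → map (λ { (c' , m') → (c ℤ.* c' , m ++ m') }) Q }) P

monoL : Mono → LP
monoL m = (+ 1 , m) ∷ []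

tL : LP
tL = monoL ((tv , + 1) ∷ [])

tPow : ℕ → LP
tPow zero = 1L
tPow (suc n) = tL *L tPow n

sumL : List LP → LP
sumL = foldr _+L_ 0L

prodL : List LP → LP
prodL = foldr _*L_ 1L

signL : ℕ → LP
signL zero = 1L
signL (suc k) = negL (signL k)

raiseV : Var → Var
raiseV tv = tv
raiseV (xv a j) = xv (suc a) j

raiseMono : Mono → Mono
raiseMono = map (λ { (v , e) → (raiseV v , e) })

raiseMonoN : ℕ → Mono → Mono
raiseMonoN zero m = m
raiseMonoN (suc n) m = raiseMono (raiseMonoN n m)

raiseN : ℕ → LP → LP
raiseN n = map (λ { (c , m) → (c , raiseMonoN n m) })

powMono : ℤ → Mono → Mono
powMono k = map (λ { (v , e) → (v , k ℤ.* e) })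

-- x_S = x_{1,i_1} x_{2,i_2} ... x_{m,i_m}  for S = {i_1 ≤ ... ≤ i_m} (sorted list)
xMonoFrom : ℕ → List ℤ → Mono
xMonoFrom a [] = []
xMonoFrom a (s ∷ S) = (xv a s , + 1) ∷ xMonoFrom (suc a) S

xMono : List ℤ → Mono
xMono = xMonoFrom 1

Mat : ℕ → Set
Mat n = Fin n → Fin n → LP

det : (n : ℕ) → Mat n → LP
det zero M = 1L
det (suc n) M =
  sumL (map (λ k → signL (Fin.toℕ k) *L M Fin.zero k
                    *L det n (λ r c → M (Fin.suc r) (punchIn k c)))
            (List.allFin (suc n)))

charPoly : (n : ℕ) → Mat n → LP
charPoly n M = det n (λ r c → (if ⌊ r Fin.≟ c ⌋ then tL else 0L) -L M r c)

-- The multiset of eigenvalues of M (in an algebraic closure of the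
-- coefficient field, with algebraic multiplicity) coincides, except
-- possibly for the multiplicity of 0, with the multiset λs:
-- i.e. the characteristic polynomial equals ∏_{λ∈λs}(t − λ) up to powers of t.
SpecEqUpToZero : (n : ℕ) → Mat n → List LP → Set
SpecEqUpToZero n M λs =
  ∃[ α ] ∃[ β ] (tPow α *L charPoly n M ≈ tPow β *L prodL (map (λ λ' → tL -L λ') λs))

eqFace : Face → Face → Bool
eqFace [] [] = true
eqFace [] (_ ∷ _) = false
eqFace (_ ∷ _) [] = false
eqFace (a ∷ A) (b ∷ B) = ⌊ a ℤ.≟ b ⌋ ∧ eqFace A B

deletions : Face → List Face
deletions [] = []
deletions (x ∷ xs) = xs ∷ map (x ∷_) (deletions xs)

indexed : {A : Set} → ℕ → List A → List (ℕ × A)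
indexed n [] = []
indexed n (x ∷ xs) = (n , x) ∷ indexed (suc n) xs

-- matrix entry of ∂_{Ω,i} : C_i → C_{i-1} at row G ∈ Ω_{i-1}, column F ∈ Ω_i
-- (ε(j,F) = (-1)^{k+1} for the k-th smallest, k ≥ 1, = (-1)^q for 0-based q)
bdEntry : (e i : ℕ) → Face → Face → LP
bdEntry e i G F =
  sumL (map (λ { (q , H) → if eqFace H G
                   then signL q *L monoL (raiseMonoN (e ∸ i) (xMono F)
                                          ++ powMono (ℤ.- (+ 1)) (raiseMonoN (e ∸ i ℕ.+ 1) (xMono G)))
                   else 0L })
            (indexed 0 (deletions F)))

-- L^{ud}_{K,i-1} = ∂_{K,i} ∂*_{K,i}, for a complex K of dimension e,
-- indexed by the faces of K with i elements (dimension i-1).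
Lud : (e i : ℕ) (K : Cx) → Mat (length (facesCard i K))
Lud e i K r c =
  sumL (map (λ F → bdEntry e i (lookup (facesCard i K) r) F
                   *L bdEntry e i (lookup (facesCard i K) c) F)
            (faces i K))

-- multiset union S ∪ {j} for a sorted list S
insertZ : ℤ → List ℤ → List ℤ
insertZ j [] = j ∷ []
insertZ j (s ∷ S) = if ⌊ j ℤ.≤? s ⌋ then j ∷ s ∷ S else s ∷ insertZ j S

-- z(S,T) = (1/↑X_S) Σ_{j∈T} X_{S∪j}
zPoly : List ℤ → List ℤ → LP
zPoly S T = sumL (map (λ j → monoL (powMono (+ 2) (xMono (insertZ j S))
                                    ++ powMono (ℤ.- (+ 2)) (raiseMono (xMono S)))) T)

intRange : ℤ → ℤ → List ℤ
intRange a b = if ⌊ a ℤ.≤? b ⌋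
  then map (λ n → a ℤ.+ + n) (List.upTo (suc ℤ.∣ b ℤ.- a ∣))
  else []

-- p_𝓕 : smallest integer occurring in a member of 𝓕 (arbitrary if none)
minElt : List Face → ℤ
minElt 𝓕 with concat 𝓕
... | [] = + 0
... | x ∷ xs = foldr _⊓_ x xs

isStrictInc : Face → Bool
isStrictInc [] = true
isStrictInc (a ∷ []) = true
isStrictInc (a ∷ b ∷ A) = ⌊ a ℤ.<? b ⌋ ∧ isStrictInc (b ∷ A)

bumps : Face → List (List ℤ × ℤ × Face)
bumps [] = []
bumps (a ∷ as) = ([] , a , (a ℤ.+ + 1) ∷ as)
                 ∷ map (λ { (S , v , B) → (a ∷ S , v , a ∷ B) }) (bumps as)

LSG : List Face → List (List ℤ × List ℤ)
LSG 𝓕 = concatMap (λ A →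
          concatMap (λ { (S , v , B) →
             if isStrictInc B ∧ not (any (eqFace B) 𝓕)
             then (S , intRange (minElt 𝓕) v) ∷ []
             else [] })
          (bumps A)) 𝓕

module Submission where

-- Let v be the smallest vertex, 𝓐 and 𝓑 the link and the deletion of v in the family 𝓕, and
-- y = x_{a+1,v}, w = x_{a+1,v} / x_{a+2,v}.  Ordering the sets containing v first, the weighted
-- boundary is ∂ = [ -wE , 0 ; yI , G ] with E and G the boundaries on the remaining vertices,
-- raised a+1 and a times, and EG = 0.  Hence ∂ = QH factors through the sets avoiding v, so that
-- ∂ Φ ∂ᵀ = Q (H Φ ∂ᵀ) has the nonzero spectrum of H Φ ∂ᵀ Q = y² Φ_𝓐 + U + Z, where U is the
-- Laplacian of 𝓑 and Z = w² Φ_𝓐 EᵀE has the nonzero spectrum of w² times the Laplacian of 𝓐.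
-- Shiftedness puts the boundary of 𝓑 on 𝓐, so U lives on 𝓐, and UZ = 0.  Up to zeros, the
-- spectrum of 𝓕 therefore consists of y² + w² λ for λ in that of 𝓐, y² + λ for λ in that of 𝓑, and
-- y² as often as some critical pair moves v to v + 1.  The z-polynomials obey the same recursion:
-- z(v ∪ S, v ∪ T) = y² + w² ↑z(S, T) and z(S, v ∪ T) = y² + z(S, T).

-- The coefficients are Laurent polynomials in t and the x_{a,j}, so eigenvalues are never
-- extracted. The induction runs on an identity between determinants, in which powers of the
-- spectral parameter account for zero eigenvalues and cancellation replaces division. Two
-- parameters make it close up: for an eigenvalue y² + w² λ, the factor s - c (y² + w² λ) is σ - (c
-- w²) λ with σ = s - c y². Thus s starts as t and has t-free terms subtracted from it, while c
-- starts as 1 and collects the squares w² on the way into links. Every s of the form t - e with e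
-- free of t can be cancelled, by comparing degrees in t. All matrices are indexed by the full cube
-- of 2^n subsets of the vertex interval, and a family enters only through its diagonal 0-1 matrix
-- Φ. Link and deletion then live on one common smaller cube, and the block shapes do not depend on
-- the family. The price is exact bookkeeping of the zero eigenvalues, which is why critical pairs
-- are counted alongside the determinants.

-- Determinants over a commutative ring, through alternating functions of the rows.

module Determinants where
  open import Algebra.Bundles using (CommutativeRing)
  import Algebra.Properties.Ring
  import Algebra.Properties.Semiring.Sum
  import Algebra.Properties.Semiring.Exp
  import Algebra.Properties.CommutativeSemigroup
  open import Data.Nat as ℕ using (ℕ; zero; suc)
  open import Data.Fin as Fin using (Fin; zero; suc; punchIn; toℕ; _↑ˡ_; _↑ʳ_)
  open import Data.Product using (_×_; _,_; proj₁; proj₂)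
  open import Data.Empty using (⊥-elim)
  open import Data.Unit using (⊤; tt)
  open import Data.Vec using (Vec; []; _∷_; map; tabulate; lookup)
  open import Data.Vec.Properties using (map-∘; tabulate-∘)
  open import Data.Vec.Relation.Binary.Pointwise.Inductive using (Pointwise; []; _∷_)
  open import Function using (_∘_)
  open import Level using (0ℓ)
  open import Relation.Binary.PropositionalEquality as ≡ using (_≡_; _≢_)
  import Relation.Binary.Reasoning.Setoid
  open import Relation.Nullary using (yes; no)

  module Determinant (R : CommutativeRing 0ℓ 0ℓ) where
    open CommutativeRing R hiding (zero)
    open Algebra.Properties.Ring ring
    open Algebra.Properties.Semiring.Exp semiring using (_^_)
    module Sum = Algebra.Properties.Semiring.Sum semiring
    open Algebra.Properties.CommutativeSemigroup *-commutativeSemigroup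
      using () renaming (x∙yz≈y∙xz to *-left-comm)
    open Relation.Binary.Reasoning.Setoid setoid

    Row : ℕ → Set
    Row m = Fin m → Carrier

    infix 4 _≐_
    _≐_ : ∀ {m} → Row m → Row m → Set
    u ≐ v = ∀ i → u i ≈ v i

    sgn : ℕ → Carrier
    sgn zero = 1#
    sgn (suc k) = - sgn k

    -- Opaque, so that unification can recover the summand.
    opaque
      ∑ : ∀ {n} → Row n → Carrier
      ∑ = Sum.sum

      ∑≡sum : ∀ {n} (f : Row n) → ∑ f ≡ Sum.sum f
      ∑≡sum f = ≡.refl

      ∑-empty : (f : Row 0) → ∑ f ≈ 0#
      ∑-empty f = refl

      ∑-suc : ∀ {n} (f : Row (suc n)) → ∑ f ≈ f zero + ∑ (f ∘ suc)
      ∑-suc f = refl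

      ∑-cong : ∀ {n} {f g : Row n} → f ≐ g → ∑ f ≈ ∑ g
      ∑-cong = Sum.sum-cong-≋

      ∑≈0 : ∀ {n} {f : Row n} → (∀ i → f i ≈ 0#) → ∑ f ≈ 0#
      ∑≈0 {n} f≈0 = trans (Sum.sum-cong-≋ f≈0) (Sum.sum-replicate-zero n)

      ∑-+ : ∀ {n} (f g : Row n) → ∑ (λ i → f i + g i) ≈ ∑ f + ∑ g
      ∑-+ = Sum.∑-distrib-+

      ∑-swap : ∀ {m n} (f : Fin m → Fin n → Carrier) →
               ∑ (λ i → ∑ λ j → f i j) ≈ ∑ (λ j → ∑ λ i → f i j)
      ∑-swap = Sum.∑-comm

      *-∑ : ∀ {n} a (f : Row n) → a * ∑ f ≈ ∑ (λ i → a * f i)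
      *-∑ = Sum.*-distribˡ-sum

      ∑-* : ∀ {n} a (f : Row n) → ∑ f * a ≈ ∑ (λ i → f i * a)
      ∑-* = Sum.*-distribʳ-sum

      ∑-neg : ∀ {n} (f : Row n) → ∑ (λ i → - f i) ≈ - ∑ f
      ∑-neg {zero} f = sym -0#≈0#
      ∑-neg {suc n} f = trans (+-congˡ (∑-neg (f ∘ suc))) (-‿+-comm _ _)

    δ : ∀ {n} → Fin n → Fin n → Carrier
    δ zero zero = 1#
    δ zero (suc j) = 0#
    δ (suc i) zero = 0#
    δ (suc i) (suc j) = δ i j

    ∑-δˡ : ∀ {n} (k : Fin n) (f : Row n) → ∑ (λ i → δ k i * f i) ≈ f k
    ∑-δˡ zero f =
      trans (∑-suc _) (trans (+-cong (*-identityˡ _) (∑≈0 λ i → zeroˡ _)) (+-identityʳ _))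
    ∑-δˡ (suc k) f = trans (∑-suc _)
      (trans (+-cong (zeroˡ _) (∑-δˡ k (f ∘ suc))) (+-identityˡ _))

    δ-sym : ∀ {n} (i j : Fin n) → δ i j ≡ δ j i
    δ-sym zero zero = ≡.refl
    δ-sym zero (suc j) = ≡.refl
    δ-sym (suc i) zero = ≡.refl
    δ-sym (suc i) (suc j) = δ-sym i j

    δ-refl : ∀ {n} (i : Fin n) → δ i i ≡ 1#
    δ-refl zero = ≡.refl
    δ-refl (suc i) = δ-refl i

    δ-≢ : ∀ {n} {i j : Fin n} → i ≢ j → δ i j ≡ 0#
    δ-≢ {i = zero} {zero} i≢j = ⊥-elim (i≢j ≡.refl)
    δ-≢ {i = zero} {suc j} i≢j = ≡.refl
    δ-≢ {i = suc i} {zero} i≢j = ≡.refl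
    δ-≢ {i = suc i} {suc j} i≢j = δ-≢ (i≢j ∘ ≡.cong suc)

    δ-injective : ∀ {m n} {f : Fin m → Fin n} → (∀ {i j} → f i ≡ f j → i ≡ j) → ∀ i j → δ (f i) (f j) ≡ δ i j
    δ-injective {f = f} f-injective i j with i Fin.≟ j
    ... | yes ≡.refl = ≡.trans (δ-refl (f i)) (≡.sym (δ-refl i))
    ... | no i≢j = ≡.trans (δ-≢ (i≢j ∘ f-injective)) (≡.sym (δ-≢ i≢j))

    ∑-δʳ : ∀ {n} (k : Fin n) (f : Row n) → ∑ (λ i → f i * δ i k) ≈ f k
    ∑-δʳ k f = trans (∑-cong λ i →
      trans (*-comm _ _) (*-congʳ (reflexive (δ-sym i k)))) (∑-δˡ k f)

    record IsLinear {m} (g : Row m → Carrier) : Set where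
      field
        cong  : ∀ {u v} → u ≐ v → g u ≈ g v
        add   : ∀ u v → g (λ i → u i + v i) ≈ g u + g v
        scale : ∀ a u → g (λ i → a * u i) ≈ a * g u

    AdjacentZero : ∀ {n m} → (Vec (Row m) (suc n) → Carrier) → Set
    AdjacentZero {zero} f = ⊤
    AdjacentZero {suc n} f = ∀ v vs → f (v ∷ v ∷ vs) ≈ 0#

    -- The conditions concern the leading rows only; fixing the first row and recurring carries them
    -- to every position. Vanishing on equal neighbours implies antisymmetry over every commutative
    -- ring (`alternating-swap`), whereas the converse would need 2 to be cancellable.
    IsAlternating : ∀ {n m} → (Vec (Row m) n → Carrier) → Set
    IsAlternating {zero} f = ⊤
    IsAlternating {suc n} f = (∀ vs → IsLinear (λ v → f (v ∷ vs)))
      × AdjacentZero f × (∀ v → IsAlternating (λ vs → f (v ∷ vs)))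

    linear-sum : ∀ {m N} {g : Fin N → Row m → Carrier} → (∀ k → IsLinear (g k)) →
                 IsLinear (λ v → ∑ (λ k → g k v))
    linear-sum {N = N} {g} lin = record
      { cong = λ u≐v → ∑-cong λ k → IsLinear.cong (lin k) u≐v
      ; add = λ u v → trans (∑-cong λ k → IsLinear.add (lin k) u v)
                            (∑-+ _ _)
      ; scale = λ a u → trans (∑-cong λ k → IsLinear.scale (lin k) a u)
                              (sym (*-∑ a _))
      }

    linear-scale : ∀ {m} c {g : Row m → Carrier} → IsLinear g → IsLinear (λ v → c * g v)
    linear-scale c lin = record
      { cong = λ u≐v → *-congˡ (IsLinear.cong lin u≐v)
      ; add = λ u v → trans (*-congˡ (IsLinear.add lin u v)) (distribˡ _ _ _)
      ; scale = λ a u → trans (*-congˡ (IsLinear.scale lin a u)) (*-left-comm _ _ _)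
      }

    alternating-sum : ∀ {n m N} {f : Fin N → Vec (Row m) n → Carrier} →
      (∀ k → IsAlternating (f k)) → IsAlternating (λ vs → ∑ (λ k → f k vs))
    alternating-sum {zero} alt = tt
    alternating-sum {suc zero} alt =
      (λ vs → linear-sum λ k → proj₁ (alt k) vs) , tt , λ v → tt
    alternating-sum {suc (suc n)} alt =
      (λ vs → linear-sum λ k → proj₁ (alt k) vs) ,
      (λ v vs → ∑≈0 λ k → proj₁ (proj₂ (alt k)) v vs) ,
      λ v → alternating-sum λ k → proj₂ (proj₂ (alt k)) v

    alternating-scale : ∀ {n m} c {f : Vec (Row m) n → Carrier} →
      IsAlternating f → IsAlternating (λ vs → c * f vs)
    alternating-scale {zero} c alt = tt
    alternating-scale {suc zero} c alt =
      (λ vs → linear-scale c (proj₁ alt vs)) , tt , λ v → tt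
    alternating-scale {suc (suc n)} c alt =
      (λ vs → linear-scale c (proj₁ alt vs)) ,
      (λ v vs → trans (*-congˡ (proj₁ (proj₂ alt) v vs)) (zeroʳ c)) ,
      λ v → alternating-scale c (proj₂ (proj₂ alt) v)

    IsLinearMap : ∀ {m p} → (Row m → Row p) → Set
    IsLinearMap L = ∀ i → IsLinear (λ v → L v i)

    -- Serves three substitutions: deletion of a column, insertion of a zero column, and right
    -- multiplication by a matrix.
    alternating-map : ∀ {n m p} {L : Row m → Row p} → IsLinearMap L →
      {f : Vec (Row p) n → Carrier} → IsAlternating f → IsAlternating (f ∘ map L)
    alternating-map {n} {L = L} L-lin = go
      where
      linear-map : ∀ {g} → IsLinear g → IsLinear (g ∘ L)
      linear-map lin = record
        { cong = λ u≐v → IsLinear.cong lin λ i → IsLinear.cong (L-lin i) u≐v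
        ; add = λ u v → trans (IsLinear.cong lin λ i → IsLinear.add (L-lin i) u v)
                              (IsLinear.add lin (L u) (L v))
        ; scale = λ a u → trans (IsLinear.cong lin λ i → IsLinear.scale (L-lin i) a u)
                                (IsLinear.scale lin a (L u))
        }
      go : ∀ {n} {f} → IsAlternating {n} f → IsAlternating {n} (f ∘ map L)
      go {zero} alt = tt
      go {suc zero} alt = (λ vs → linear-map (proj₁ alt (map L vs))) , tt , λ v → tt
      go {suc (suc n)} alt =
        (λ vs → linear-map (proj₁ alt (map L vs))) ,
        (λ v vs → proj₁ (proj₂ alt) (L v) (map L vs)) ,
        λ v → go (proj₂ (proj₂ alt) (L v))

    module _ {m : ℕ} where
      alternating-cong : ∀ {n} {f : Vec (Row m) n → Carrier} → IsAlternating f →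
        ∀ {vs ws} → Pointwise _≐_ vs ws → f vs ≈ f ws
      alternating-cong {zero} alt [] = refl
      alternating-cong {suc n} alt {v ∷ vs} {w ∷ ws} (v≐w ∷ vs≐ws) =
        trans (IsLinear.cong (proj₁ alt vs) v≐w)
              (alternating-cong (proj₂ (proj₂ alt) w) vs≐ws)

      alternating-swap : ∀ {n} {f : Vec (Row m) (2 ℕ.+ n) → Carrier} → IsAlternating f →
        ∀ u v vs → f (u ∷ v ∷ vs) ≈ - f (v ∷ u ∷ vs)
      alternating-swap {f = f} (lin , adj , alt) u v vs = +-inverseˡ-unique _ _ (begin
        f (u ∷ v ∷ vs) + f (v ∷ u ∷ vs)
          ≈⟨ +-cong (+-identityˡ _) (+-identityʳ _) ⟨
        (0# + f (u ∷ v ∷ vs)) + (f (v ∷ u ∷ vs) + 0#)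
          ≈⟨ +-cong (+-congʳ (adj u vs)) (+-congˡ (adj v vs)) ⟨
        (f (u ∷ u ∷ vs) + f (u ∷ v ∷ vs)) + (f (v ∷ u ∷ vs) + f (v ∷ v ∷ vs))
          ≈⟨ +-cong (IsLinear.add (proj₁ (alt u) vs) u v) (IsLinear.add (proj₁ (alt v) vs) u v) ⟨
        f (u ∷ u+v ∷ vs) + f (v ∷ u+v ∷ vs)
          ≈⟨ IsLinear.add (lin (u+v ∷ vs)) u v ⟨
        f (u+v ∷ u+v ∷ vs)
          ≈⟨ adj u+v vs ⟩
        0# ∎)
        where
        u+v : Row m
        u+v i = u i + v i

      -- Row k passes k other rows on its way to the front, each at the cost of a sign.
      alternating-move : ∀ {n} {f : Vec (Row m) (suc n) → Carrier} → IsAlternating f →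
        (u : Fin (suc n) → Row m) (k : Fin (suc n)) →
        f (u k ∷ tabulate (u ∘ punchIn k)) ≈ sgn (toℕ k) * f (tabulate u)
      alternating-move alt u zero = sym (*-identityˡ _)
      alternating-move {suc n} {f} alt u (suc k) = begin
        f (u (suc k) ∷ u zero ∷ tabulate (u ∘ suc ∘ punchIn k))
          ≈⟨ alternating-swap {f = f} alt _ _ _ ⟩
        - f (u zero ∷ u (suc k) ∷ tabulate (u ∘ suc ∘ punchIn k))
          ≈⟨ -‿cong (alternating-move (proj₂ (proj₂ alt) (u zero)) (u ∘ suc) k) ⟩
        - (sgn (toℕ k) * f (tabulate u))
          ≈⟨ -‿distribˡ-* _ _ ⟩
        - sgn (toℕ k) * f (tabulate u) ∎

      linear-zero : ∀ {g : Row m → Carrier} → IsLinear g → ∀ {v} → (∀ i → v i ≈ 0#) → g v ≈ 0#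
      linear-zero lin {v} v≈0 = begin
        _ ≈⟨ IsLinear.cong lin (λ i → trans (v≈0 i) (sym (zeroˡ (v i)))) ⟩
        _ ≈⟨ IsLinear.scale lin 0# v ⟩
        _ ≈⟨ zeroˡ _ ⟩
        0# ∎

      linear-combination : ∀ {N} {g : Row m → Carrier} → IsLinear g →
        (a : Row N) (u : Fin N → Row m) →
        g (λ j → ∑ (λ i → a i * u i j)) ≈ ∑ (λ i → a i * g (u i))
      linear-combination {zero} lin a u =
        trans (linear-zero lin (λ i → ∑-empty _)) (sym (∑-empty _))
      linear-combination {suc N} {g} lin a u = begin
        g (λ j → ∑ (λ i → a i * u i j))
          ≈⟨ IsLinear.cong lin (λ j → ∑-suc _) ⟩
        g (λ j → a zero * u zero j + ∑ (λ i → a (suc i) * u (suc i) j))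
          ≈⟨ IsLinear.add lin _ _ ⟩
        g (λ j → a zero * u zero j) + g (λ j → ∑ (λ i → a (suc i) * u (suc i) j))
          ≈⟨ +-cong (IsLinear.scale lin _ _) (linear-combination lin (a ∘ suc) (u ∘ suc)) ⟩
        a zero * g (u zero) + ∑ (λ i → a (suc i) * g (u (suc i)))
          ≈⟨ ∑-suc _ ⟨
        ∑ (λ i → a i * g (u i)) ∎

      alternating-repeat : ∀ {n} {f : Vec (Row m) (suc n) → Carrier} → IsAlternating f →
        ∀ v vs (i : Fin n) → lookup vs i ≐ v → f (v ∷ vs) ≈ 0#
      alternating-repeat {f = f} alt@(lin , adj , tail) v (w ∷ vs) zero w≐v =
        trans (IsLinear.cong (proj₁ (tail v) vs) w≐v) (adj v vs)
      alternating-repeat {f = f} alt@(lin , adj , tail) v (w ∷ vs) (suc i) p = begin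
        f (v ∷ w ∷ vs)   ≈⟨ alternating-swap {f = f} alt v w vs ⟩
        - f (w ∷ v ∷ vs) ≈⟨ -‿cong (alternating-repeat (tail w) v vs i p) ⟩
        - 0#             ≈⟨ -0#≈0# ⟩
        0# ∎

      -- Row reduction: multiples of `e` may be subtracted from every row. It is applied with
      -- `e = δ k` when `δ k` already stands in front of `vs`, which explains the vanishing
      -- hypothesis; the effect is to erase column k of the remaining rows.
      clear-rows : ∀ {n} {f : Vec (Row m) n → Carrier} → IsAlternating f →
        (e : Row m) (c : Row m → Row m) (a : Row m → Carrier) →
        (∀ v → v ≐ λ i → c v i + a v * e i) →
        (∀ vs i → lookup vs i ≐ e → f vs ≈ 0#) → ∀ vs → f vs ≈ f (map c vs)
      clear-rows alt e c a split vanish [] = refl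
      clear-rows {f = f} alt@(lin , adj , tail) e c a split vanish (v ∷ vs) = begin
        f (v ∷ vs)
          ≈⟨ IsLinear.cong (lin vs) (split v) ⟩
        f ((λ i → c v i + a v * e i) ∷ vs)
          ≈⟨ IsLinear.add (lin vs) _ _ ⟩
        f (c v ∷ vs) + f ((λ i → a v * e i) ∷ vs)
          ≈⟨ +-congˡ (IsLinear.scale (lin vs) _ _) ⟩
        f (c v ∷ vs) + a v * f (e ∷ vs)
          ≈⟨ +-congˡ (*-congˡ (vanish (e ∷ vs) zero λ i → refl)) ⟩
        f (c v ∷ vs) + a v * 0#
          ≈⟨ trans (+-congˡ (zeroʳ _)) (+-identityʳ _) ⟩
        f (c v ∷ vs)
          ≈⟨ clear-rows (tail (c v)) e c a split (λ ws i → vanish (c v ∷ ws) (suc i)) vs ⟩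
        f (c v ∷ map c vs) ∎

    -- Composed after `_∘ punchIn k` it erases entry k of a row. Pulling an alternating function of
    -- longer rows back along it gives one of shorter rows, which is how the induction of
    -- `alternating-unique` descends.
    insertZero : ∀ {m} → Fin (suc m) → Row m → Row (suc m)
    insertZero zero w zero = 0#
    insertZero zero w (suc i) = w i
    insertZero {suc m} (suc k) w zero = w zero
    insertZero {suc m} (suc k) w (suc i) = insertZero k (w ∘ suc) i

    insertZero-linear : ∀ {m} (k : Fin (suc m)) → IsLinearMap (insertZero k)
    insertZero-linear zero zero = record
      { cong = λ _ → refl ; add = λ _ _ → sym (+-identityˡ 0#) ; scale = λ a _ → sym (zeroʳ a) }
    insertZero-linear zero (suc i) = record
      { cong = λ p → p i ; add = λ _ _ → refl ; scale = λ _ _ → refl }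
    insertZero-linear {suc m} (suc k) zero = record
      { cong = λ p → p zero ; add = λ _ _ → refl ; scale = λ _ _ → refl }
    insertZero-linear {suc m} (suc k) (suc i) = record
      { cong = λ p → IsLinear.cong rec (p ∘ suc)
      ; add = λ u v → IsLinear.add rec (u ∘ suc) (v ∘ suc)
      ; scale = λ a u → IsLinear.scale rec a (u ∘ suc) }
      where rec = insertZero-linear k i

    insertZero-split : ∀ {m} (k : Fin (suc m)) (v : Row (suc m)) →
      v ≐ λ i → insertZero k (v ∘ punchIn k) i + v k * δ k i
    insertZero-split zero v zero = sym (trans (+-identityˡ _) (*-identityʳ _))
    insertZero-split zero v (suc i) = sym (trans (+-congˡ (zeroʳ _)) (+-identityʳ _))
    insertZero-split {suc m} (suc k) v zero = sym (trans (+-congˡ (zeroʳ _)) (+-identityʳ _))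
    insertZero-split {suc m} (suc k) v (suc i) = insertZero-split k (v ∘ suc) i

    insertZero-δ : ∀ {m} (k : Fin (suc m)) (i : Fin m) → insertZero k (δ i) ≐ δ (punchIn k i)
    insertZero-δ zero i zero = refl
    insertZero-δ zero i (suc j) = refl
    insertZero-δ (suc k) zero zero = refl
    insertZero-δ (suc k) zero (suc j) =
      linear-zero (insertZero-linear k j) (λ i → refl)
    insertZero-δ (suc k) (suc i) zero = refl
    insertZero-δ (suc k) (suc i) (suc j) = insertZero-δ k i j

    detRows : ∀ {n} → Vec (Row n) n → Carrier
    detRows [] = 1#
    detRows (v ∷ vs) = ∑ λ k → sgn (toℕ k) * v k * detRows (map (_∘ punchIn k) vs)

    pointwise-map : ∀ {m p n} {g h : Row m → Row p} → (∀ v → g v ≐ h v) →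
      (vs : Vec (Row m) n) → Pointwise _≐_ (map g vs) (map h vs)
    pointwise-map g≐h [] = []
    pointwise-map g≐h (v ∷ vs) = g≐h v ∷ pointwise-map g≐h vs

    pointwise-tabulate : ∀ {m n} {g h : Fin n → Row m} → (∀ i → g i ≐ h i) →
      Pointwise _≐_ (tabulate g) (tabulate h)
    pointwise-tabulate {n = zero} g≐h = []
    pointwise-tabulate {n = suc n} g≐h = g≐h zero ∷ pointwise-tabulate (g≐h ∘ suc)

    -- Expand the first row in the basis `δ`. With `δ k` in front, column k of the other rows can be
    -- cleared, and the induction hypothesis applies with that column removed. Moving `δ k` back to
    -- its place among the rows of the identity produces the Laplace sign.
    alternating-unique : ∀ {n} {f : Vec (Row n) n → Carrier} → IsAlternating f →
      ∀ vs → f vs ≈ f (tabulate δ) * detRows vs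
    alternating-unique alt [] = sym (*-identityʳ _)
    alternating-unique {suc n} {f} alt@(lin , adj , tail) (v ∷ vs) = begin
      f (v ∷ vs)
        ≈⟨ IsLinear.cong (lin vs) (λ j → ∑-δʳ j v) ⟨
      f ((λ j → ∑ λ k → v k * δ k j) ∷ vs)
        ≈⟨ linear-combination (lin vs) v δ ⟩
      ∑ (λ k → v k * f (δ k ∷ vs))
        ≈⟨ ∑-cong (λ k → trans (*-congˡ (expand k)) (regroup _ _ _ _)) ⟩
      ∑ (λ k → f (tabulate δ) * (sgn (toℕ k) * v k * detRows (minor k)))
        ≈⟨ *-∑ _ _ ⟨
      f (tabulate δ) * detRows (v ∷ vs) ∎
      where
      minor : Fin (suc n) → Vec (Row n) n
      minor k = map (_∘ punchIn k) vs
      regroup : ∀ a b c d → a * (b * c * d) ≈ c * (b * a * d)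
      regroup a b c d = begin
        a * (b * c * d)   ≈⟨ *-assoc _ _ _ ⟨
        a * (b * c) * d   ≈⟨ *-congʳ (trans (sym (*-assoc _ _ _)) (*-comm _ _)) ⟩
        c * (a * b) * d   ≈⟨ *-congʳ (*-congˡ (*-comm _ _)) ⟩
        c * (b * a) * d   ≈⟨ *-assoc _ _ _ ⟩
        c * (b * a * d)   ∎
      expand : ∀ k → f (δ k ∷ vs) ≈ sgn (toℕ k) * f (tabulate δ) * detRows (minor k)
      expand k = begin
        f (δ k ∷ vs)
          ≈⟨ clear-rows (tail (δ k)) (δ k) (λ r → insertZero k (r ∘ punchIn k)) (λ r → r k)
               (insertZero-split k) (λ ws i → alternating-repeat alt (δ k) ws i) vs ⟩
        f (δ k ∷ map (λ r → insertZero k (r ∘ punchIn k)) vs)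
          ≡⟨ ≡.cong (λ ws → f (δ k ∷ ws)) (map-∘ _ _ vs) ⟩
        f (δ k ∷ map (insertZero k) (minor k))
          ≈⟨ alternating-unique (alternating-map (insertZero-linear k) (tail (δ k))) (minor k) ⟩
        f (δ k ∷ map (insertZero k) (tabulate δ)) * detRows (minor k)
          ≡⟨ ≡.cong (λ ws → f (δ k ∷ ws) * detRows (minor k)) (≡.sym (tabulate-∘ _ _)) ⟩
        f (δ k ∷ tabulate (insertZero k ∘ δ)) * detRows (minor k)
          ≈⟨ *-congʳ (alternating-cong (tail (δ k)) (pointwise-tabulate (insertZero-δ k))) ⟩
        f (δ k ∷ tabulate (δ ∘ punchIn k)) * detRows (minor k)
          ≈⟨ *-congʳ (alternating-move alt δ k) ⟩
        sgn (toℕ k) * f (tabulate δ) * detRows (minor k) ∎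

    -- The double Laplace expansion: swapping the two chosen columns flips the sign.

    Swappable : ∀ {n} → (Fin (suc n) → Fin n → Carrier) → Set
    Swappable {zero} T = ⊤
    Swappable {suc n} T = (∀ l → T zero l ≈ T (suc l) zero) × Swappable (λ k l → T (suc k) (suc l))

    swappable-sum : ∀ {n} (T : Fin (suc n) → Fin n → Carrier) → Swappable T →
      ∑ (λ k → sgn (toℕ k) * ∑ (λ l → sgn (toℕ l) * T k l)) ≈ 0#
    swappable-sum {zero} T _ = ∑≈0 λ k → trans (*-congˡ (∑-empty _)) (zeroʳ _)
    swappable-sum {suc n} T (swap₀ , swap) = begin
      ∑ (λ k → sgn (toℕ k) * ∑ (λ l → sgn (toℕ l) * T k l))
        ≈⟨ ∑-suc _ ⟩
      1# * X + ∑ (λ k → - sgn (toℕ k) * ∑ (λ l → sgn (toℕ l) * T (suc k) l))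
        ≈⟨ +-cong (*-identityˡ _) (∑-cong λ k → trans (*-congˡ (∑-suc _)) (rearrange k)) ⟩
      X + ∑ (λ k → - (sgn (toℕ k) * T zero k) + sgn (toℕ k) * ∑ (λ l → sgn (toℕ l) * T (suc k) (suc l)))
        ≈⟨ +-congˡ (∑-+ _ _) ⟩
      X + (∑ (λ k → - (sgn (toℕ k) * T zero k)) + ∑ (λ k → sgn (toℕ k) * ∑ (λ l → sgn (toℕ l) * T (suc k) (suc l))))
        ≈⟨ +-congˡ (+-cong (∑-neg _) (swappable-sum (λ k l → T (suc k) (suc l)) swap)) ⟩
      X + (- X + 0#)
        ≈⟨ trans (+-congˡ (+-identityʳ _)) (-‿inverseʳ X) ⟩
      0# ∎
      where
      X = ∑ (λ l → sgn (toℕ l) * T zero l)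
      rearrange : ∀ k →
        - sgn (toℕ k) * (1# * T (suc k) zero + ∑ (λ l → - sgn (toℕ l) * T (suc k) (suc l))) ≈
        - (sgn (toℕ k) * T zero k) + sgn (toℕ k) * ∑ (λ l → sgn (toℕ l) * T (suc k) (suc l))
      rearrange k = begin
        - s * (1# * T (suc k) zero + ∑ (λ l → - sgn (toℕ l) * T (suc k) (suc l)))
          ≈⟨ *-congˡ (+-cong (trans (*-identityˡ _) (sym (swap₀ k)))
               (trans (∑-cong λ l → sym (-‿distribˡ-* _ _)) (∑-neg _))) ⟩
        - s * (T zero k + - Y)
          ≈⟨ distribˡ _ _ _ ⟩
        - s * T zero k + - s * - Y
          ≈⟨ +-cong (sym (-‿distribˡ-* _ _)) (trans (sym (-‿distribˡ-* _ _))
               (trans (-‿cong (sym (-‿distribʳ-* _ _))) (-‿involutive _))) ⟩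
        - (s * T zero k) + s * Y ∎
        where
        s = sgn (toℕ k)
        Y = ∑ (λ l → sgn (toℕ l) * T (suc k) (suc l))

    -- A doubly punctured selection of columns is the same whichever of the two columns is removed
    -- first. `E` takes the whole selection as its argument so that the induction can force column 0
    -- to be kept, through `lift`; `E-cong` stands in for function extensionality.
    minors-swappable : ∀ {m} (a : Row (2 ℕ.+ m)) (E : (Fin m → Fin (2 ℕ.+ m)) → Carrier) →
      (∀ {g h} → (∀ c → g c ≡ h c) → E g ≈ E h) →
      (T : Fin (2 ℕ.+ m) → Fin (suc m) → Carrier) →
      (∀ k l → T k l ≈ a k * a (punchIn k l) * E (punchIn k ∘ punchIn l)) → Swappable T
    minors-swappable {zero} a E E-cong T eq =
      (λ l → trans (eq zero l) (trans (*-cong (*-comm _ _) (E-cong λ ())) (sym (eq (suc l) zero)))) , tt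
    minors-swappable {suc m} a E E-cong T eq =
      (λ l → trans (eq zero l) (trans (*-cong (*-comm _ _) (E-cong λ c → ≡.refl)) (sym (eq (suc l) zero)))) ,
      minors-swappable (a ∘ suc) (λ g → E (lift g)) (λ p → E-cong (lift-cong p)) _
        (λ k l → trans (eq (suc k) (suc l)) (*-congˡ (E-cong (lift-punchIn k l))))
      where
      lift : (Fin m → Fin (2 ℕ.+ m)) → Fin (suc m) → Fin (3 ℕ.+ m)
      lift g zero = zero
      lift g (suc c) = suc (g c)
      lift-cong : ∀ {g h} → (∀ c → g c ≡ h c) → ∀ c → lift g c ≡ lift h c
      lift-cong p zero = ≡.refl
      lift-cong p (suc c) = ≡.cong suc (p c)
      lift-punchIn : ∀ k l c → punchIn (suc k) (punchIn (suc l) c) ≡ lift (punchIn k ∘ punchIn l) c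
      lift-punchIn k l zero = ≡.refl
      lift-punchIn k l (suc c) = ≡.refl

    reindex-linear : ∀ {m p} (ρ : Fin p → Fin m) → IsLinearMap (λ (v : Row m) → v ∘ ρ)
    reindex-linear ρ i = record
      { cong = λ p → p (ρ i) ; add = λ _ _ → refl ; scale = λ _ _ → refl }

    detRows-alternating : ∀ {n} → IsAlternating (detRows {n})
    detRows-alternating {zero} = tt
    detRows-alternating {suc n} = linear , adjacent n ,
      λ v → alternating-sum λ k → alternating-scale (sgn (toℕ k) * v k)
        (alternating-map (reindex-linear (punchIn k)) (detRows-alternating {n}))
      where
      linear : ∀ vs → IsLinear (λ v → detRows (v ∷ vs))
      linear vs = linear-sum λ k → record
        { cong = λ p → *-congʳ (*-congˡ (p k))
        ; add = λ u v → trans (*-congʳ (distribˡ _ _ _)) (distribʳ _ _ _)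
        ; scale = λ a u → trans (*-congʳ (*-left-comm _ _ _)) (*-assoc _ _ _) }
      adjacent : ∀ n → AdjacentZero {n} (detRows {suc n})
      adjacent zero = tt
      adjacent (suc n) v vs = begin
        ∑ (λ k → sgn (toℕ k) * v k * ∑ (λ l → sgn (toℕ l) * v (punchIn k l) * E k l))
          ≈⟨ ∑-cong (λ k → trans (*-assoc _ _ _) (*-congˡ (trans (*-∑ _ _)
               (∑-cong λ l → trans (*-congˡ (*-assoc _ _ _)) (*-left-comm _ _ _))))) ⟩
        ∑ (λ k → sgn (toℕ k) * ∑ (λ l → sgn (toℕ l) * T k l))
          ≈⟨ swappable-sum T (minors-swappable v (λ g → detRows (map (_∘ g) vs))
               (λ {g} {h} p → alternating-cong detRows-alternating
                 (pointwise-map (λ r c → reflexive (≡.cong r (p c))) vs))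
               T (λ k l → trans (sym (*-assoc (v k) _ _)) (*-congˡ (reflexive
                 (≡.cong detRows (≡.sym (map-∘ (_∘ punchIn l) (_∘ punchIn k) vs))))))) ⟩
        0# ∎
        where
        E : Fin (2 ℕ.+ n) → Fin (suc n) → Carrier
        E k l = detRows (map (_∘ punchIn l) (map (_∘ punchIn k) vs))
        T : Fin (2 ℕ.+ n) → Fin (suc n) → Carrier
        T k l = v k * (v (punchIn k l) * E k l)

    -- Matrices: multiplicativity, block determinants and Sylvester's identity.

    Mat : ℕ → ℕ → Set
    Mat n m = Fin n → Row m

    infix 4 _≋_
    _≋_ : ∀ {n m} → Mat n m → Mat n m → Set
    M ≋ N = ∀ i j → M i j ≈ N i j

    infixl 7 _⊗_
    _⊗_ : ∀ {n m p} → Mat n m → Mat m p → Mat n p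
    (M ⊗ N) i j = ∑ λ k → M i k * N k j

    det : ∀ {n} → Mat n n → Carrier
    det M = detRows (tabulate M)

    det-cong : ∀ {n} {M N : Mat n n} → M ≋ N → det M ≈ det N
    det-cong M≋N = alternating-cong detRows-alternating (pointwise-tabulate M≋N)

    minor : ∀ {n} → Mat (suc n) (suc n) → Fin (suc n) → Mat n n
    minor M k r c = M (suc r) (punchIn k c)

    det-laplace : ∀ {n} (M : Mat (suc n) (suc n)) →
      det M ≈ ∑ λ k → sgn (toℕ k) * M zero k * det (minor M k)
    det-laplace M = ∑-cong λ k → *-congˡ (reflexive
      (≡.cong detRows (≡.sym (tabulate-∘ (_∘ punchIn k) (M ∘ suc)))))

    -- As a function of the rows of `M` the left side is alternating and takes the value `det N` at
    -- the identity, so `alternating-unique` determines it.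
    det-⊗ : ∀ {n} (M N : Mat n n) → det (M ⊗ N) ≈ det M * det N
    det-⊗ {n} M N = begin
      det (M ⊗ N)
        ≡⟨ ≡.cong detRows (tabulate-∘ times-N M) ⟩
      detRows (map times-N (tabulate M))
        ≈⟨ alternating-unique (alternating-map times-N-linear detRows-alternating) (tabulate M) ⟩
      detRows (map times-N (tabulate δ)) * det M
        ≡⟨ ≡.cong (λ vs → detRows vs * det M) (≡.sym (tabulate-∘ times-N δ)) ⟩
      det (λ i → times-N (δ i)) * det M
        ≈⟨ *-congʳ (det-cong λ i j → ∑-δˡ i (λ k → N k j)) ⟩
      det N * det M
        ≈⟨ *-comm _ _ ⟩
      det M * det N ∎
      where
      times-N : Row n → Row n
      times-N v j = ∑ λ k → v k * N k j
      times-N-linear : IsLinearMap times-N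
      times-N-linear j = linear-sum λ k → record
        { cong = λ p → *-congʳ (p k)
        ; add = λ u v → distribʳ _ _ _
        ; scale = λ a u → *-assoc _ _ _ }

    det-zero-column : ∀ {n} (M : Mat (suc n) (suc n)) → (∀ i → M i zero ≈ 0#) → det M ≈ 0#
    det-zero-column M M≈0 = trans (det-laplace M) (∑≈0 λ k → term {M = M} k M≈0)
      where
      term : ∀ {n} {M : Mat (suc n) (suc n)} k → (∀ i → M i zero ≈ 0#) →
             sgn (toℕ k) * M zero k * det (minor M k) ≈ 0#
      term zero M≈0 = trans (*-congʳ (trans (*-congˡ (M≈0 zero)) (zeroʳ _))) (zeroˡ _)
      term {suc n} {M} (suc k) M≈0 =
        trans (*-congˡ (det-zero-column (minor M (suc k)) (M≈0 ∘ suc))) (zeroʳ _)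

    det-pivot : ∀ {n} (M : Mat (suc n) (suc n)) → (∀ i → M (suc i) zero ≈ 0#) →
      det M ≈ M zero zero * det (minor M zero)
    det-pivot {n} M M≈0 = begin
      det M
        ≈⟨ trans (det-laplace M) (∑-suc _) ⟩
      1# * M zero zero * det (minor M zero) + ∑ (λ k → - sgn (toℕ k) * M zero (suc k) * det (minor M (suc k)))
        ≈⟨ +-cong (*-congʳ (*-identityˡ _)) (∑≈0 λ k → trans (*-congˡ (vanish M M≈0 k)) (zeroʳ _)) ⟩
      M zero zero * det (minor M zero) + 0#
        ≈⟨ +-identityʳ _ ⟩
      M zero zero * det (minor M zero) ∎
      where
      vanish : ∀ {n} (M : Mat (suc n) (suc n)) → (∀ i → M (suc i) zero ≈ 0#) →
               ∀ k → det (minor M (suc k)) ≈ 0#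
      vanish {suc n} M M≈0 k = det-zero-column (minor M (suc k)) M≈0

    ∏ : ∀ {n} → Row n → Carrier
    ∏ {zero} d = 1#
    ∏ {suc n} d = d zero * ∏ (d ∘ suc)

    diag : ∀ {n} → Row n → Mat n n
    diag d i j = δ i j * d i

    scalar : ∀ {n} → Carrier → Mat n n
    scalar s = diag (λ _ → s)

    det-diag : ∀ {n} (d : Row n) → det (diag d) ≈ ∏ d
    det-diag {zero} d = refl
    det-diag {suc n} d = trans (det-pivot (diag d) (λ i → zeroˡ _))
      (*-cong (*-identityˡ _) (det-diag (d ∘ suc)))

    ∏-const : ∀ n s → ∏ {n} (λ _ → s) ≈ s ^ n
    ∏-const zero s = refl
    ∏-const (suc n) s = *-congˡ (∏-const n s)

    det-scalar : ∀ n s → det {n} (scalar s) ≈ s ^ n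
    det-scalar n s = trans (det-diag {n} (λ _ → s)) (∏-const n s)

    infixr 5 _⧺_
    _⧺_ : ∀ {p q} {A : Set} → (Fin p → A) → (Fin q → A) → Fin (p ℕ.+ q) → A
    _⧺_ {zero} u v = v
    _⧺_ {suc p} u v zero = u zero
    _⧺_ {suc p} u v (suc j) = ((u ∘ suc) ⧺ v) j

    ⧺-left : ∀ {p q} {A : Set} (u : Fin p → A) (v : Fin q → A) i → (u ⧺ v) (i ↑ˡ q) ≡ u i
    ⧺-left u v zero = ≡.refl
    ⧺-left u v (suc i) = ⧺-left (u ∘ suc) v i

    ⧺-right : ∀ {p q} {A : Set} (u : Fin p → A) (v : Fin q → A) j → (u ⧺ v) (p ↑ʳ j) ≡ v j
    ⧺-right {zero} u v j = ≡.refl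
    ⧺-right {suc p} u v j = ⧺-right (u ∘ suc) v j

    join-elim : ∀ p {q} {P : Fin (p ℕ.+ q) → Set} →
      (∀ i → P (i ↑ˡ q)) → (∀ j → P (p ↑ʳ j)) → ∀ k → P k
    join-elim zero l r k = r k
    join-elim (suc p) l r zero = l zero
    join-elim (suc p) l r (suc k) = join-elim p (l ∘ suc) r k

    ∑-join : ∀ p {q} (f : Row (p ℕ.+ q)) → ∑ f ≈ ∑ (λ i → f (i ↑ˡ q)) + ∑ (λ j → f (p ↑ʳ j))
    ∑-join zero f = sym (trans (+-congʳ (∑-empty _)) (+-identityˡ _))
    ∑-join (suc p) f = trans (∑-suc f) (trans (+-congˡ (∑-join p (f ∘ suc)))
      (trans (sym (+-assoc _ _ _)) (+-congʳ (sym (∑-suc _)))))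

    opaque
      blk : ∀ {n m p q} → Mat n p → Mat n q → Mat m p → Mat m q → Mat (n ℕ.+ m) (p ℕ.+ q)
      blk A B C D = (λ i → A i ⧺ B i) ⧺ (λ i → C i ⧺ D i)

    module _ {n m p q : ℕ} (A : Mat n p) (B : Mat n q) (C : Mat m p) (D : Mat m q) where
      opaque
        unfolding blk
        blk₁₁ : ∀ i j → blk A B C D (i ↑ˡ m) (j ↑ˡ q) ≡ A i j
        blk₁₁ i j rewrite ⧺-left (λ i → A i ⧺ B i) (λ i → C i ⧺ D i) i = ⧺-left (A i) (B i) j
        blk₁₂ : ∀ i j → blk A B C D (i ↑ˡ m) (p ↑ʳ j) ≡ B i j
        blk₁₂ i j rewrite ⧺-left (λ i → A i ⧺ B i) (λ i → C i ⧺ D i) i = ⧺-right (A i) (B i) j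
        blk₂₁ : ∀ i j → blk A B C D (n ↑ʳ i) (j ↑ˡ q) ≡ C i j
        blk₂₁ i j rewrite ⧺-right (λ i → A i ⧺ B i) (λ i → C i ⧺ D i) i = ⧺-left (C i) (D i) j
        blk₂₂ : ∀ i j → blk A B C D (n ↑ʳ i) (p ↑ʳ j) ≡ D i j
        blk₂₂ i j rewrite ⧺-right (λ i → A i ⧺ B i) (λ i → C i ⧺ D i) i = ⧺-right (C i) (D i) j

      blk-unique : (M : Mat (n ℕ.+ m) (p ℕ.+ q)) →
        (∀ i j → M (i ↑ˡ m) (j ↑ˡ q) ≈ A i j) → (∀ i j → M (i ↑ˡ m) (p ↑ʳ j) ≈ B i j) →
        (∀ i j → M (n ↑ʳ i) (j ↑ˡ q) ≈ C i j) → (∀ i j → M (n ↑ʳ i) (p ↑ʳ j) ≈ D i j) →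
        M ≋ blk A B C D
      blk-unique M a b c d = join-elim n
        (λ i → join-elim p (λ j → trans (a i j) (sym (reflexive (blk₁₁ i j))))
                           (λ j → trans (b i j) (sym (reflexive (blk₁₂ i j)))))
        (λ i → join-elim p (λ j → trans (c i j) (sym (reflexive (blk₂₁ i j))))
                           (λ j → trans (d i j) (sym (reflexive (blk₂₂ i j)))))

    blk-⊗ : ∀ {n m p q r t}
      {A : Mat n p} {B : Mat n q} {C : Mat m p} {D : Mat m q}
      {A′ : Mat p r} {B′ : Mat p t} {C′ : Mat q r} {D′ : Mat q t} →
      blk A B C D ⊗ blk A′ B′ C′ D′ ≋
      blk (λ i j → (A ⊗ A′) i j + (B ⊗ C′) i j) (λ i j → (A ⊗ B′) i j + (B ⊗ D′) i j)
          (λ i j → (C ⊗ A′) i j + (D ⊗ C′) i j) (λ i j → (C ⊗ B′) i j + (D ⊗ D′) i j)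
    blk-⊗ {p = p} {q} {A = A} {B} {C} {D} {A′} {B′} {C′} {D′} = blk-unique _ _ _ _ (M ⊗ M′)
      (λ i j → entry {u = M (i ↑ˡ _)} {λ k → M′ k (j ↑ˡ _)} (blk₁₁ A B C D i) (blk₁₂ A B C D i)
        (λ k → blk₁₁ A′ B′ C′ D′ k j) (λ k → blk₂₁ A′ B′ C′ D′ k j))
      (λ i j → entry {u = M (i ↑ˡ _)} {λ k → M′ k (_ ↑ʳ j)} (blk₁₁ A B C D i) (blk₁₂ A B C D i)
        (λ k → blk₁₂ A′ B′ C′ D′ k j) (λ k → blk₂₂ A′ B′ C′ D′ k j))
      (λ i j → entry {u = M (_ ↑ʳ i)} {λ k → M′ k (j ↑ˡ _)} (blk₂₁ A B C D i) (blk₂₂ A B C D i)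
        (λ k → blk₁₁ A′ B′ C′ D′ k j) (λ k → blk₂₁ A′ B′ C′ D′ k j))
      (λ i j → entry {u = M (_ ↑ʳ i)} {λ k → M′ k (_ ↑ʳ j)} (blk₂₁ A B C D i) (blk₂₂ A B C D i)
        (λ k → blk₁₂ A′ B′ C′ D′ k j) (λ k → blk₂₂ A′ B′ C′ D′ k j))
      where
      M = blk A B C D
      M′ = blk A′ B′ C′ D′
      entry : ∀ {u v : Row (p ℕ.+ q)} {a c : Row p} {b d : Row q} →
        (∀ k → u (k ↑ˡ q) ≡ a k) → (∀ k → u (p ↑ʳ k) ≡ b k) →
        (∀ k → v (k ↑ˡ q) ≡ c k) → (∀ k → v (p ↑ʳ k) ≡ d k) →
        ∑ (λ k → u k * v k) ≈ ∑ (λ k → a k * c k) + ∑ (λ k → b k * d k)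
      entry {u} {v} ua ub vc vd = trans (∑-join p (λ k → u k * v k)) (+-cong
        (∑-cong λ k → *-cong (reflexive (ua k)) (reflexive (vc k)))
        (∑-cong λ k → *-cong (reflexive (ub k)) (reflexive (vd k))))

    O : ∀ {n m} → Mat n m
    O i j = 0#

    det-blk-lower : ∀ {n m} (A : Mat n n) (C : Mat m n) (D : Mat m m) →
      det (blk A O C D) ≈ det A * det D
    det-blk-lower {zero} A C D =
      trans (det-cong λ i j → reflexive (blk₂₂ A O C D i j)) (sym (*-identityˡ _))
    det-blk-lower {suc n} {m} A C D = begin
      det M
        ≈⟨ trans (det-laplace M) (∑-join (suc n) _) ⟩
      ∑ (λ k → sgn (toℕ (k ↑ˡ m)) * M zero (k ↑ˡ m) * det (minor M (k ↑ˡ m))) +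
      ∑ (λ k → sgn (toℕ (suc n ↑ʳ k)) * M zero (suc n ↑ʳ k) * det (minor M (suc n ↑ʳ k)))
        ≈⟨ +-cong (∑-cong left) (∑≈0 right) ⟩
      ∑ (λ k → sgn (toℕ k) * A zero k * det (minor A k) * det D) + 0#
        ≈⟨ trans (+-identityʳ _) (sym (∑-* _ _)) ⟩
      ∑ (λ k → sgn (toℕ k) * A zero k * det (minor A k)) * det D
        ≈⟨ *-congʳ (det-laplace A) ⟨
      det A * det D ∎
      where
      M = blk A O C D
      punchIn-left : ∀ {n} (k : Fin (suc n)) c → punchIn (k ↑ˡ m) (c ↑ˡ m) ≡ punchIn k c ↑ˡ m
      punchIn-left zero c = ≡.refl
      punchIn-left (suc k) zero = ≡.refl
      punchIn-left (suc k) (suc c) = ≡.cong suc (punchIn-left k c)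
      punchIn-right : ∀ {n} (k : Fin (suc n)) c → punchIn (k ↑ˡ m) (n ↑ʳ c) ≡ suc n ↑ʳ c
      punchIn-right zero c = ≡.refl
      punchIn-right {suc n} (suc k) c = ≡.cong suc (punchIn-right k c)
      toℕ-left : ∀ {n} (k : Fin n) → toℕ (k ↑ˡ m) ≡ toℕ k
      toℕ-left zero = ≡.refl
      toℕ-left (suc k) = ≡.cong suc (toℕ-left k)
      minor-blk : ∀ k → minor M (k ↑ˡ m) ≋ blk (minor A k) O (λ r c → C r (punchIn k c)) D
      minor-blk k = blk-unique _ _ _ _ _
        (λ i j → reflexive (≡.trans (≡.cong (M (suc i ↑ˡ m)) (punchIn-left k j)) (blk₁₁ A O C D (suc i) (punchIn k j))))
        (λ i j → reflexive (≡.trans (≡.cong (M (suc i ↑ˡ m)) (punchIn-right k j)) (blk₁₂ A O C D (suc i) j)))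
        (λ i j → reflexive (≡.trans (≡.cong (M (suc n ↑ʳ i)) (punchIn-left k j)) (blk₂₁ A O C D i (punchIn k j))))
        (λ i j → reflexive (≡.trans (≡.cong (M (suc n ↑ʳ i)) (punchIn-right k j)) (blk₂₂ A O C D i j)))
      left : ∀ k → sgn (toℕ (k ↑ˡ m)) * M zero (k ↑ˡ m) * det (minor M (k ↑ˡ m)) ≈
                   sgn (toℕ k) * A zero k * det (minor A k) * det D
      left k = trans (*-cong
        (*-cong (reflexive (≡.cong sgn (toℕ-left k))) (reflexive (blk₁₁ A O C D zero k)))
        (trans (det-cong (minor-blk k)) (det-blk-lower (minor A k) _ D))) (sym (*-assoc _ _ _))
      right : ∀ k → sgn (toℕ (suc n ↑ʳ k)) * M zero (suc n ↑ʳ k) * det (minor M (suc n ↑ʳ k)) ≈ 0#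
      right k = trans (*-congʳ (trans (*-congˡ (reflexive (blk₁₂ A O C D zero k))) (zeroʳ _))) (zeroˡ _)

    -- The corner is scalar, so each of its columns has a single nonzero entry and n pivots suffice.
    det-blk-upper : ∀ {n m} s (B : Mat n m) (D : Mat m m) →
      det (blk (scalar s) B O D) ≈ s ^ n * det D
    det-blk-upper {zero} s B D =
      trans (det-cong λ i j → reflexive (blk₂₂ (scalar s) B O D i j)) (sym (*-identityˡ _))
    det-blk-upper {suc n} {m} s B D = begin
      det M
        ≈⟨ det-pivot M (join-elim n
             (λ i → trans (reflexive (blk₁₁ S B O D (suc i) zero)) (zeroˡ s))
             (λ i → reflexive (blk₂₁ S B O D i zero))) ⟩
      M zero zero * det (minor M zero)
        ≈⟨ *-cong (trans (reflexive (blk₁₁ S B O D zero zero)) (*-identityˡ s)) (trans (det-cong minor-blk) (det-blk-upper s (B ∘ suc) D)) ⟩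
      s * (s ^ n * det D)
        ≈⟨ *-assoc _ _ _ ⟨
      s ^ suc n * det D ∎
      where
      S : Mat (suc n) (suc n)
      S = scalar s
      M = blk S B O D
      minor-blk : minor M zero ≋ blk (scalar s) (B ∘ suc) O D
      minor-blk = blk-unique _ _ _ _ _
        (λ i j → reflexive (blk₁₁ S B O D (suc i) (suc j)))
        (λ i j → reflexive (blk₁₂ S B O D (suc i) j))
        (λ i j → reflexive (blk₂₁ S B O D i (suc j)))
        (λ i j → reflexive (blk₂₂ S B O D i j))

    blk-cong : ∀ {n m p q} {A A′ : Mat n p} {B B′ : Mat n q} {C C′ : Mat m p} {D D′ : Mat m q} →
      A ≋ A′ → B ≋ B′ → C ≋ C′ → D ≋ D′ → blk A B C D ≋ blk A′ B′ C′ D′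
    blk-cong {A = A} {A′} {B} {B′} {C} {C′} {D} {D′} a b c d = blk-unique A′ B′ C′ D′ (blk A B C D)
      (λ i j → trans (reflexive (blk₁₁ A B C D i j)) (a i j))
      (λ i j → trans (reflexive (blk₁₂ A B C D i j)) (b i j))
      (λ i j → trans (reflexive (blk₂₁ A B C D i j)) (c i j))
      (λ i j → trans (reflexive (blk₂₂ A B C D i j)) (d i j))

    diag-⊗ : ∀ {n m} (d : Row n) (M : Mat n m) → diag d ⊗ M ≋ λ i j → d i * M i j
    diag-⊗ d M i j = trans (∑-cong λ k → *-assoc _ _ _) (∑-δˡ i (λ k → d i * M k j))

    ⊗-diag : ∀ {n m} (M : Mat n m) (d : Row m) → M ⊗ diag d ≋ λ i j → M i j * d j
    ⊗-diag M d i j = trans (∑-cong λ k → *-left-comm _ _ _)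
      (trans (∑-cong λ k → *-congʳ (reflexive (δ-sym k j))) (∑-δˡ j (λ k → M i k * d k)))

    characteristic : ∀ {n} → Carrier → Mat n n → Mat n n
    characteristic s M i j = δ i j * s - M i j

    1^n≈1 : ∀ n → 1# ^ n ≈ 1#
    1^n≈1 zero = refl
    1^n≈1 (suc n) = trans (*-identityˡ _) (1^n≈1 n)

    -- Both sides are s^m det K for the block matrix K = [sI, X; Y, I]. Multiplying K on the left by
    -- [I, -X; 0, I] shows det K = det (s - XY). Multiplying by [I, 0; -Y, sI], whose determinant is
    -- s^m, clears the lower left block and leaves sI and s - YX on the diagonal.
    sylvester : ∀ {n m} s (X : Mat n m) (Y : Mat m n) →
      s ^ m * det (characteristic s (X ⊗ Y)) ≈ s ^ n * det (characteristic s (Y ⊗ X))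
    sylvester {n} {m} s X Y = begin
      s ^ m * det (characteristic s (X ⊗ Y))
        ≈⟨ *-congˡ det-K₁ ⟨
      s ^ m * det K
        ≈⟨ *-congʳ det-clear₂ ⟨
      det (blk I O -Y (scalar s)) * det K
        ≈⟨ det-⊗ _ K ⟨
      det (blk I O -Y (scalar s) ⊗ K)
        ≈⟨ det-cong (λ i j → trans (blk-⊗ i j) (blk-cong e₁₁ e₁₂ e₂₁ e₂₂ i j)) ⟩
      det (blk (scalar s) X O (characteristic s (Y ⊗ X)))
        ≈⟨ det-blk-upper s X _ ⟩
      s ^ n * det (characteristic s (Y ⊗ X)) ∎
      where
      I : ∀ {n} → Mat n n
      I = scalar 1#
      K = blk (scalar s) X Y I
      -X : Mat n m
      -X i j = - X i j
      -Y : Mat m n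
      -Y i j = - Y i j
      O-⊗ : ∀ {n m p} (M : Mat m p) → O {n} ⊗ M ≋ O
      O-⊗ M i j = ∑≈0 λ k → zeroˡ _
      I-⊗ : ∀ {n m} (M : Mat n m) → I ⊗ M ≋ M
      I-⊗ M i j = trans (diag-⊗ (λ _ → 1#) M i j) (*-identityˡ _)
      ⊗-I : ∀ {n m} (M : Mat n m) → M ⊗ I ≋ M
      ⊗-I M i j = trans (⊗-diag M (λ _ → 1#) i j) (*-identityʳ _)
      neg-⊗ : ∀ {n m p} (M : Mat n m) (N : Mat m p) → (λ i j → - M i j) ⊗ N ≋ λ i j → - (M ⊗ N) i j
      neg-⊗ M N i j = trans (∑-cong λ k → sym (-‿distribˡ-* _ _)) (∑-neg _)
      det-I : ∀ n → det {n} I ≈ 1#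
      det-I n = trans (det-scalar n 1#) (1^n≈1 n)
      cancel : ∀ {x y} → x ≈ y → - x + y ≈ 0#
      cancel p = trans (+-congʳ (-‿cong p)) (-‿inverseˡ _)

      e₁₁ : (λ i j → (I ⊗ scalar s) i j + (O ⊗ Y) i j) ≋ scalar s
      e₁₁ i j = trans (+-cong (I-⊗ (scalar s) i j) (O-⊗ Y i j)) (+-identityʳ _)
      e₁₂ : (λ i j → (I ⊗ X) i j + (O ⊗ I {m}) i j) ≋ X
      e₁₂ i j = trans (+-cong (I-⊗ X i j) (O-⊗ I i j)) (+-identityʳ _)
      e₂₁ : (λ i j → (-Y ⊗ scalar s) i j + (scalar s ⊗ Y) i j) ≋ O
      e₂₁ i j = trans (+-cong (neg-⊗ Y (scalar s) i j) (diag-⊗ (λ _ → s) Y i j))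
        (cancel (trans (⊗-diag Y (λ _ → s) i j) (*-comm _ _)))
      e₂₂ : (λ i j → (-Y ⊗ X) i j + (scalar s ⊗ I) i j) ≋ characteristic s (Y ⊗ X)
      e₂₂ i j = trans (+-cong (neg-⊗ Y X i j) (⊗-I (scalar s) i j)) (+-comm _ _)

      det-clear₂ : det (blk I O -Y (scalar s)) ≈ s ^ m
      det-clear₂ = trans (det-blk-lower I -Y (scalar s))
        (trans (*-cong (det-I n) (det-scalar m s)) (*-identityˡ _))
      det-K₁ : det K ≈ det (characteristic s (X ⊗ Y))
      det-K₁ = begin
        det K
          ≈⟨ trans (*-congʳ (trans (det-blk-upper 1# -X I)
               (trans (*-cong (1^n≈1 n) (det-I m)) (*-identityˡ _)))) (*-identityˡ _) ⟨
        det (blk I -X O I) * det K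
          ≈⟨ det-⊗ _ K ⟨
        det (blk I -X O I ⊗ K)
          ≈⟨ det-cong (λ i j → trans (blk-⊗ i j) (blk-cong f₁₁ f₁₂ f₂₁ f₂₂ i j)) ⟩
        det (blk (characteristic s (X ⊗ Y)) O Y I)
          ≈⟨ trans (det-blk-lower _ Y I) (trans (*-congˡ (det-I m)) (*-identityʳ _)) ⟩
        det (characteristic s (X ⊗ Y)) ∎
        where
        f₁₁ : (λ i j → (I ⊗ scalar s) i j + (-X ⊗ Y) i j) ≋ characteristic s (X ⊗ Y)
        f₁₁ i j = +-cong (I-⊗ (scalar s) i j) (neg-⊗ X Y i j)
        f₁₂ : (λ i j → (I ⊗ X) i j + (-X ⊗ I) i j) ≋ O
        f₁₂ i j = trans (+-cong (I-⊗ X i j) (⊗-I -X i j)) (-‿inverseʳ _)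
        f₂₁ : (λ i j → (O ⊗ scalar s) i j + (I ⊗ Y) i j) ≋ Y
        f₂₁ i j = trans (+-cong (O-⊗ (scalar s) i j) (I-⊗ Y i j)) (+-identityˡ _)
        f₂₂ : (λ i j → (O ⊗ X) i j + (I ⊗ I) i j) ≋ I
        f₂₂ i j = trans (+-cong (O-⊗ X i j) (I-⊗ I i j)) (+-identityˡ _)

-- Compressed families, their weighted Laplacians and the determinant recursion.

module Laplacians where
  open import Algebra.Bundles using (CommutativeRing)
  import Algebra.Properties.Ring
  import Algebra.Properties.Semiring.Exp
  import Algebra.Properties.CommutativeSemigroup
  import Algebra.Solver.Ring.NaturalCoefficients.Default
  open import Data.Bool using (Bool; true; false; not; _∧_; if_then_else_)
  open import Data.Nat as ℕ using (ℕ; zero; suc)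
  import Data.Nat.Properties as ℕ
  open import Data.Integer as ℤ using (ℤ; +_)
  open import Data.Fin as Fin using (Fin; zero; suc; _↑ˡ_; _↑ʳ_)
  open import Data.Product using (_×_; _,_; ∃-syntax)
  open import Data.Sum using (_⊎_; inj₁; inj₂)
  open import Relation.Nullary using (yes; no)
  open import Data.Vec using (Vec; []; _∷_; lookup; _[_]≔_)
  open import Function using (_∘_)
  open import Level using (0ℓ)
  open import Relation.Binary.PropositionalEquality as ≡ using (_≡_)
  import Relation.Binary.Reasoning.Setoid
  open Determinants

  Family : ℕ → Set
  Family n = Vec Bool n → Bool

  Compressed : ∀ {n} → Family n → Set
  Compressed {n} 𝓕 = ∀ F (i j : Fin n) → i Fin.< j → lookup F i ≡ false → lookup F j ≡ true →
    𝓕 F ≡ true → 𝓕 ((F [ j ]≔ false) [ i ]≔ true) ≡ true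

  compressed-∷ : ∀ {n} {𝓕 : Family (suc n)} b → Compressed 𝓕 → Compressed (𝓕 ∘ (b ∷_))
  compressed-∷ b sh F i j i<j = sh (b ∷ F) (suc i) (suc j) (ℕ.s≤s i<j)

  compressed-shadow : ∀ {n} {𝓕 : Family (suc n)} → Compressed 𝓕 → ∀ F j → lookup F j ≡ true →
    𝓕 (false ∷ F) ≡ true → 𝓕 (true ∷ (F [ j ]≔ false)) ≡ true
  compressed-shadow sh F j = sh (false ∷ F) zero (suc j) (ℕ.s≤s ℕ.z≤n) ≡.refl

  card : ∀ {n} → Family n → ℕ
  card {zero} 𝓕 = if 𝓕 [] then 1 else 0
  card {suc n} 𝓕 = card (𝓕 ∘ (true ∷_)) ℕ.+ card (𝓕 ∘ (false ∷_))

  -- The number of critical pairs of 𝓕, which is also the rank of its Laplacian.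
  rank : ∀ {n} → Family n → ℕ
  rank {zero} 𝓕 = 0
  rank {suc n} 𝓕 = card (𝓕 ∘ (true ∷_))

  -- The number of critical pairs that move the base vertex v itself to v + 1, in terms of the
  -- link 𝓐 and the deletion 𝓑 of v.
  baseMoves : ∀ {n} → Family n → Family n → ℕ
  baseMoves {zero} 𝓐 𝓑 = card 𝓐
  baseMoves {suc n} 𝓐 𝓑 = card (λ F → 𝓐 (false ∷ F) ∧ not (𝓑 (true ∷ F)))

  card-split : ∀ {n} (𝓐 𝓑 : Family n) → (∀ F → 𝓑 F ≡ true → 𝓐 F ≡ true) →
    card 𝓐 ≡ card 𝓑 ℕ.+ card (λ F → 𝓐 F ∧ not (𝓑 F))
  card-split {zero} 𝓐 𝓑 𝓑⊆𝓐 with 𝓐 [] | 𝓑 [] | 𝓑⊆𝓐 []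
  ... | true  | true  | _ = ≡.refl
  ... | true  | false | _ = ≡.refl
  ... | false | false | _ = ≡.refl
  ... | false | true  | p with () ← p ≡.refl
  card-split {suc n} 𝓐 𝓑 𝓑⊆𝓐 = ≡.trans
    (≡.cong₂ ℕ._+_ (card-split (𝓐 ∘ (true ∷_)) (𝓑 ∘ (true ∷_)) (𝓑⊆𝓐 ∘ (true ∷_)))
                   (card-split (𝓐 ∘ (false ∷_)) (𝓑 ∘ (false ∷_)) (𝓑⊆𝓐 ∘ (false ∷_))))
    (interchange (card (𝓑 ∘ (true ∷_))) _ _ _)
    where open Algebra.Properties.CommutativeSemigroup ℕ.+-commutativeSemigroup

  -- This balances the exponents in `det-step`. Members of the link that contain v + 1 are counted
  -- by `rank 𝓐`. Among those that do not, the ones from which replacing v by v + 1 stays inside the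
  -- family correspond to members of the deletion containing v + 1, because compression moves v + 1
  -- back to v; the others are the base moves.
  card-link : ∀ {n} {𝓕 : Family (suc n)} → Compressed 𝓕 →
    let 𝓐 = 𝓕 ∘ (true ∷_) ; 𝓑 = 𝓕 ∘ (false ∷_) in
    card 𝓐 ≡ rank 𝓐 ℕ.+ rank 𝓑 ℕ.+ baseMoves 𝓐 𝓑
  card-link {zero} sh = ≡.refl
  card-link {suc n} {𝓕} sh = ≡.trans
    (≡.cong (card (𝓕 ∘ (true ∷_) ∘ (true ∷_)) ℕ.+_) (card-split (𝓕 ∘ (true ∷_) ∘ (false ∷_)) (𝓕 ∘ (false ∷_) ∘ (true ∷_))
      (λ F → compressed-shadow {𝓕 = 𝓕} sh (true ∷ F) zero ≡.refl)))
    (≡.sym (ℕ.+-assoc (card (𝓕 ∘ (true ∷_) ∘ (true ∷_))) _ _))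

  next : ℤ → ℤ
  next v = v ℤ.+ + 1

  -- Written as a doubling so that the index set of the cube splits definitionally into two blocks,
  -- for sets with and without the base vertex.
  pow2 : ℕ → ℕ
  pow2 zero = 1
  pow2 (suc n) = pow2 n ℕ.+ pow2 n

  card-complement : ∀ {n} (𝓕 : Family n) → card 𝓕 ℕ.+ card (not ∘ 𝓕) ≡ pow2 n
  card-complement {zero} 𝓕 with 𝓕 []
  ... | true = ≡.refl
  ... | false = ≡.refl
  card-complement {suc n} 𝓕 = ≡.trans
    (interchange (card (𝓕 ∘ (true ∷_))) _ _ _)
    (≡.cong₂ ℕ._+_ (card-complement (𝓕 ∘ (true ∷_))) (card-complement (𝓕 ∘ (false ∷_))))
    where open Algebra.Properties.CommutativeSemigroup ℕ.+-commutativeSemigroup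

  record Weighting (R : CommutativeRing 0ℓ 0ℓ) : Set where
    open CommutativeRing R
    field
      x x⁻¹ : ℕ → ℤ → Carrier
      x*x⁻¹ : ∀ a v → x a v * x⁻¹ a v ≈ 1#

  module Laplacian (R : CommutativeRing 0ℓ 0ℓ) (W : Weighting R) where
    open CommutativeRing R hiding (zero)
    open Weighting W
    open Algebra.Properties.Ring ring
    open Algebra.Properties.Semiring.Exp semiring
    open Determinant R hiding (module Sum)
    open Relation.Binary.Reasoning.Setoid setoid
    open Algebra.Solver.Ring.NaturalCoefficients.Default commutativeSemiring
      using (solve; _:*_; _:+_; _:=_)
    open Algebra.Properties.CommutativeSemigroup *-commutativeSemigroup
      using () renaming (x∙yz≈y∙xz to *-left-comm)

    decode : ∀ n → Fin (pow2 n) → Vec Bool n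
    decode zero _ = []
    decode (suc n) = (λ i → true ∷ decode n i) ⧺ (λ i → false ∷ decode n i)

    decode-left : ∀ n i → decode (suc n) (i ↑ˡ pow2 n) ≡ true ∷ decode n i
    decode-left n = ⧺-left _ _

    decode-right : ∀ n i → decode (suc n) (pow2 n ↑ʳ i) ≡ false ∷ decode n i
    decode-right n = ⧺-right {pow2 n} _ _

    ι : Bool → Carrier
    ι true = 1#
    ι false = 0#

    indicator : ∀ {n} → Family n → Row (pow2 n)
    indicator {n} 𝓕 i = ι (𝓕 (decode n i))

    -- Rows and columns are ordered with the sets containing v first.
    ∂ : ℕ → ℤ → ∀ n → Mat (pow2 n) (pow2 n)
    ∂ a v zero = O
    ∂ a v (suc n) = blk
      (λ i j → - (x⁻¹ (2 ℕ.+ a) v * x (suc a) v * ∂ (suc a) (next v) n i j)) O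
      (scalar (x (suc a) v)) (∂ a (next v) n)

    ⊗-assoc : ∀ {n m p q} (A : Mat n m) (B : Mat m p) (C : Mat p q) →
      (A ⊗ B) ⊗ C ≋ A ⊗ (B ⊗ C)
    ⊗-assoc A B C i j = begin
      ∑ (λ k → ∑ (λ l → A i l * B l k) * C k j)
        ≈⟨ ∑-cong (λ k → trans (∑-* (C k j) (λ l → A i l * B l k)) (∑-cong λ l → *-assoc _ _ _)) ⟩
      ∑ (λ k → ∑ (λ l → A i l * (B l k * C k j)))
        ≈⟨ ∑-swap _ ⟩
      ∑ (λ l → ∑ (λ k → A i l * (B l k * C k j)))
        ≈⟨ ∑-cong (λ l → sym (*-∑ _ _)) ⟩
      ∑ (λ l → A i l * ∑ (λ k → B l k * C k j)) ∎

    ⊗-cong : ∀ {n m p} {A A′ : Mat n m} {B B′ : Mat m p} → A ≋ A′ → B ≋ B′ → A ⊗ B ≋ A′ ⊗ B′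
    ⊗-cong A≋ B≋ i j = ∑-cong λ k → *-cong (A≋ i k) (B≋ k j)

    -- The left factor is raised once more, as consecutive boundary maps of a complex are. Two
    -- nonzero products meet only in the lower left block, where x_{a+2,v} w = x_{a+1,v} makes them
    -- cancel; this is what the denominator of w is for.
    ∂∂≋O : ∀ n a v → ∂ (suc a) v n ⊗ ∂ a v n ≋ O
    ∂∂≋O zero a v i j = ∑≈0 λ k → zeroˡ _
    ∂∂≋O (suc n) a v i j = trans (blk-⊗ i j) (trans (blk-cong e₁₁ e₁₂ e₂₁ e₂₂ i j) (blk-O i j))
      where
      N = pow2 n
      blk-O : blk {N} {N} {N} {N} O O O O ≋ O
      blk-O i j = sym (blk-unique O O O O O (λ _ _ → refl) (λ _ _ → refl) (λ _ _ → refl) (λ _ _ → refl) i j)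
      E′ = ∂ (suc (suc a)) (next v) n
      E = ∂ (suc a) (next v) n
      G = ∂ a (next v) n
      w′ = x⁻¹ (3 ℕ.+ a) v * x (2 ℕ.+ a) v
      w = x⁻¹ (2 ℕ.+ a) v * x (suc a) v
      scaled : Carrier → Mat N N → Mat N N
      scaled c M i j = - (c * M i j)
      e₁₁ : (λ i j → (scaled w′ E′ ⊗ scaled w E) i j + (O ⊗ scalar {N} (x (suc a) v)) i j) ≋ O
      e₁₁ i j = trans (+-cong (begin
        ∑ (λ k → - (w′ * E′ i k) * - (w * E k j))
          ≈⟨ ∑-cong (λ k → trans (sym (-‿distribˡ-* _ _)) (trans (-‿cong (sym (-‿distribʳ-* _ _)))
               (trans (-‿involutive _) (solve 4 (λ a b c d → (a :* b) :* (c :* d) := (a :* c) :* (b :* d)) refl _ _ _ _)))) ⟩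
        ∑ (λ k → w′ * w * (E′ i k * E k j))
          ≈⟨ sym (*-∑ _ _) ⟩
        w′ * w * (E′ ⊗ E) i j
          ≈⟨ trans (*-congˡ (∂∂≋O n (suc a) (next v) i j)) (zeroʳ _) ⟩
        0# ∎) (∑≈0 λ k → zeroˡ _)) (+-identityʳ _)
      e₁₂ : (λ i j → (scaled w′ E′ ⊗ O) i j + (O ⊗ G) i j) ≋ O
      e₁₂ i j = trans (+-cong (∑≈0 λ k → zeroʳ _) (∑≈0 λ k → zeroˡ _)) (+-identityʳ _)
      e₂₁ : (λ i j → (scalar (x (2 ℕ.+ a) v) ⊗ scaled w E) i j + (E ⊗ scalar (x (suc a) v)) i j) ≋ O
      e₂₁ i j = begin
        (scalar (x (2 ℕ.+ a) v) ⊗ scaled w E) i j + (E ⊗ scalar (x (suc a) v)) i j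
          ≈⟨ +-cong (diag-⊗ _ (scaled w E) i j) (⊗-diag E (λ _ → x (suc a) v) i j) ⟩
        x (2 ℕ.+ a) v * - (w * E i j) + E i j * x (suc a) v
          ≈⟨ +-cong (sym (-‿distribʳ-* _ _)) (*-comm _ _) ⟩
        - (x (2 ℕ.+ a) v * (w * E i j)) + x (suc a) v * E i j
          ≈⟨ +-congʳ (-‿cong (begin
               x (2 ℕ.+ a) v * (w * E i j)
                 ≈⟨ solve 4 (λ a b c d → a :* (b :* c :* d) := (a :* b) :* (c :* d)) refl _ _ _ _ ⟩
               x (2 ℕ.+ a) v * x⁻¹ (2 ℕ.+ a) v * (x (suc a) v * E i j)
                 ≈⟨ trans (*-congʳ (x*x⁻¹ _ _)) (*-identityˡ _) ⟩
               x (suc a) v * E i j ∎)) ⟩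
        - (x (suc a) v * E i j) + x (suc a) v * E i j
          ≈⟨ -‿inverseˡ _ ⟩
        0# ∎
      e₂₂ : (λ i j → (scalar (x (2 ℕ.+ a) v) ⊗ O) i j + (E ⊗ G) i j) ≋ O
      e₂₂ i j = trans (+-cong (∑≈0 λ k → zeroʳ _) (∂∂≋O n a (next v) i j)) (+-identityʳ _)

    IsDeletion : ∀ {n} → Vec Bool n → Vec Bool n → Set
    IsDeletion F G = ∃[ j ] (lookup G j ≡ true × F ≡ G [ j ]≔ false)

    -- A disjunction, and not an implication from nonzero entries, because equality in the ring is
    -- not assumed decidable.
    ∂-support : ∀ n a v (i k : Fin (pow2 n)) →
      ∂ a v n i k ≈ 0# ⊎ IsDeletion (decode n i) (decode n k)
    ∂-support zero a v i k = inj₁ refl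
    ∂-support (suc n) a v = join-elim N
      (λ i → join-elim N (left-left i) (λ k → inj₁ (reflexive (blk₁₂ M₁₁ O M₂₁ M₂₂ i k))))
      (λ i → join-elim N (right-left i) (right-right i))
      where
      N = pow2 n
      y = x (suc a) v
      w = x⁻¹ (2 ℕ.+ a) v * y
      E = ∂ (suc a) (next v) n
      M₁₁ M₂₁ M₂₂ : Mat N N
      M₁₁ i j = - (w * E i j)
      M₂₁ = scalar y
      M₂₂ = ∂ a (next v) n
      Claim : Fin (N ℕ.+ N) → Fin (N ℕ.+ N) → Set
      Claim i k = ∂ a v (suc n) i k ≈ 0# ⊎ IsDeletion (decode (suc n) i) (decode (suc n) k)
      left-left : ∀ i k → Claim (i ↑ˡ N) (k ↑ˡ N)
      left-left i k with ∂-support n (suc a) (next v) i k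
      ... | inj₁ E≈0 = inj₁ (trans (reflexive (blk₁₁ M₁₁ O M₂₁ M₂₂ i k))
              (trans (-‿cong (trans (*-congˡ E≈0) (zeroʳ _))) -0#≈0#))
      ... | inj₂ (j , kj , eq) rewrite decode-left n i | decode-left n k =
              inj₂ (suc j , kj , ≡.cong (true ∷_) eq)
      right-left : ∀ i k → Claim (N ↑ʳ i) (k ↑ˡ N)
      right-left i k with i Fin.≟ k
      ... | yes ≡.refl rewrite decode-left n i | decode-right n i = inj₂ (zero , ≡.refl , ≡.refl)
      ... | no i≢k = inj₁ (trans (reflexive (blk₂₁ M₁₁ O M₂₁ M₂₂ i k))
              (trans (*-congʳ (reflexive (δ-≢ i≢k))) (zeroˡ _)))
      right-right : ∀ i k → Claim (N ↑ʳ i) (N ↑ʳ k)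
      right-right i k with ∂-support n a (next v) i k
      ... | inj₁ G≈0 = inj₁ (trans (reflexive (blk₂₂ M₁₁ O M₂₁ M₂₂ i k)) G≈0)
      ... | inj₂ (j , kj , eq) rewrite decode-right n i | decode-right n k =
              inj₂ (suc j , kj , ≡.cong (false ∷_) eq)

    -- Here shiftedness enters the algebra. If row i is k with a vertex j deleted and k belongs to
    -- the deletion of v, exchanging j for v stays inside the family, so i belongs to the link and
    -- its indicator is 1. In all other cases both sides vanish.
    shadow-supported : ∀ {n} a v (𝓕 : Family (suc n)) → Compressed 𝓕 → ∀ i k →
      indicator (𝓕 ∘ (true ∷_)) i * (∂ a v n i k * indicator (𝓕 ∘ (false ∷_)) k)
        ≈ ∂ a v n i k * indicator (𝓕 ∘ (false ∷_)) k
    shadow-supported {n} a v 𝓕 sh i k with ∂-support n a v i k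
    ... | inj₁ ∂≈0 = trans (trans (*-congˡ product≈0) (zeroʳ _)) (sym product≈0)
      where product≈0 = trans (*-congʳ ∂≈0) (zeroˡ _)
    ... | inj₂ (j , kj , eq) with 𝓕 (false ∷ decode n k) in 𝓕k
    ... | false = trans (trans (*-congˡ (zeroʳ _)) (zeroʳ _)) (sym (zeroʳ _))
    ... | true rewrite eq | compressed-shadow {𝓕 = 𝓕} sh (decode n k) j kj 𝓕k = *-identityˡ _

    -- This is c ∂ Φ ∂ᵀ. The scalar c records the factors w² accumulated by passing to links, and
    -- starts at 1.
    laplacian : Carrier → ℕ → ℤ → ∀ {n} → Family n → Mat (pow2 n) (pow2 n)
    laplacian c a v {n} 𝓕 = ∂ a v n ⊗ λ k j → c * (indicator 𝓕 k * ∂ a v n j k)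

    -- The product of s - c λ over the recursively listed eigenvalues λ, one for each critical pair.
    -- A link eigenvalue y² + w² λ contributes σ - (c w²) λ, a deletion eigenvalue y² + λ
    -- contributes σ - c λ, and each base move contributes σ itself.
    eigenProduct : Carrier → Carrier → ℕ → ℤ → ∀ {n} → Family n → Carrier
    eigenProduct s c a v {zero} 𝓕 = 1#
    eigenProduct s c a v {suc n} 𝓕 =
      σ ^ baseMoves (𝓕 ∘ (true ∷_)) (𝓕 ∘ (false ∷_)) *
      (eigenProduct σ (c * (w * w)) (suc a) (next v) (𝓕 ∘ (true ∷_)) *
       eigenProduct σ c a (next v) (𝓕 ∘ (false ∷_)))
      where
      y = x (suc a) v
      w = x⁻¹ (2 ℕ.+ a) v * y
      σ = s - c * (y * y)

    infixl 6 _⊖_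
    _⊖_ : ∀ {n m} → Mat n m → Mat n m → Mat n m
    (A ⊖ B) i j = A i j - B i j

    ∑-minus : ∀ {n} (f g : Row n) → ∑ (λ i → f i - g i) ≈ ∑ f - ∑ g
    ∑-minus f g = trans (∑-+ _ _) (+-congˡ (∑-neg g))

    ⊖-⊗ : ∀ {n m p} (A B : Mat n m) (C : Mat m p) → (A ⊖ B) ⊗ C ≋ (A ⊗ C) ⊖ (B ⊗ C)
    ⊖-⊗ A B C i j = trans (∑-cong λ k → [y-z]x≈yx-zx _ _ _) (∑-minus _ _)

    ⊗-⊖ : ∀ {n m p} (A : Mat n m) (B C : Mat m p) → A ⊗ (B ⊖ C) ≋ (A ⊗ B) ⊖ (A ⊗ C)
    ⊗-⊖ A B C i j = trans (∑-cong λ k → x[y-z]≈xy-xz _ _ _) (∑-minus _ _)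

    ∏-join : ∀ p {q} (f : Row (p ℕ.+ q)) → ∏ f ≈ ∏ (λ i → f (i ↑ˡ q)) * ∏ (λ j → f (p ↑ʳ j))
    ∏-join zero f = sym (*-identityˡ _)
    ∏-join (suc p) f = trans (*-congˡ (∏-join p (f ∘ suc))) (sym (*-assoc _ _ _))

    ∏-cong : ∀ {n} {f g : Row n} → f ≐ g → ∏ f ≈ ∏ g
    ∏-cong {zero} f≐g = refl
    ∏-cong {suc n} f≐g = *-cong (f≐g zero) (∏-cong (f≐g ∘ suc))

    ∏-select : ∀ {n} (𝓕 : Family n) u v →
      ∏ (λ i → if 𝓕 (decode n i) then u else v) ≈ u ^ card 𝓕 * v ^ card (not ∘ 𝓕)
    ∏-select {zero} 𝓕 u v with 𝓕 []
    ... | true = sym (*-identityʳ _)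
    ... | false = sym (*-identityˡ _)
    ∏-select {suc n} 𝓕 u v = begin
      ∏ (λ i → if 𝓕 (decode (suc n) i) then u else v)
        ≈⟨ ∏-join (pow2 n) _ ⟩
      ∏ (λ i → if 𝓕 (decode (suc n) (i ↑ˡ pow2 n)) then u else v) *
      ∏ (λ i → if 𝓕 (decode (suc n) (pow2 n ↑ʳ i)) then u else v)
        ≈⟨ *-cong (∏-cong λ i → reflexive (≡.cong (λ F → if 𝓕 F then u else v) (decode-left n i)))
                  (∏-cong λ i → reflexive (≡.cong (λ F → if 𝓕 F then u else v) (decode-right n i))) ⟩
      ∏ (λ i → if 𝓕₁ (decode n i) then u else v) * ∏ (λ i → if 𝓕₀ (decode n i) then u else v)
        ≈⟨ *-cong (∏-select 𝓕₁ u v) (∏-select 𝓕₀ u v) ⟩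
      (u ^ card 𝓕₁ * v ^ card (not ∘ 𝓕₁)) * (u ^ card 𝓕₀ * v ^ card (not ∘ 𝓕₀))
        ≈⟨ solve 4 (λ a b c d → (a :* b) :* (c :* d) := (a :* c) :* (b :* d)) refl _ _ _ _ ⟩
      (u ^ card 𝓕₁ * u ^ card 𝓕₀) * (v ^ card (not ∘ 𝓕₁) * v ^ card (not ∘ 𝓕₀))
        ≈⟨ *-cong (^-homo-* u (card 𝓕₁) _) (^-homo-* v (card (not ∘ 𝓕₁)) _) ⟨
      u ^ card 𝓕 * v ^ card (not ∘ 𝓕) ∎
      where
      𝓕₁ = 𝓕 ∘ (true ∷_)
      𝓕₀ = 𝓕 ∘ (false ∷_)

    -- Cancellability is all the division that the argument uses: each determinant below is first
    -- known only up to powers of s and σ.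
    Regular : Carrier → Set
    Regular u = ∀ {p q} → u * p ≈ u * q → p ≈ q

    regular-1 : Regular 1#
    regular-1 p = trans (sym (*-identityˡ _)) (trans p (*-identityˡ _))

    regular-* : ∀ {u v} → Regular u → Regular v → Regular (u * v)
    regular-* ru rv p = rv (ru (trans (sym (*-assoc _ _ _)) (trans p (*-assoc _ _ _))))

    regular-^ : ∀ {u} n → Regular u → Regular (u ^ n)
    regular-^ zero ru = regular-1
    regular-^ (suc n) ru = regular-* ru (regular-^ n ru)

    -- One inductive step: from link and deletion to the whole family.

    module Step {n : ℕ} (a : ℕ) (v : ℤ) (𝓕 : Family (suc n)) (𝓕-compressed : Compressed 𝓕)
                (c s : Carrier) where
      N = pow2 n
      𝓐 𝓑 : Family n
      𝓐 = 𝓕 ∘ (true ∷_)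
      𝓑 = 𝓕 ∘ (false ∷_)
      α β : Row N
      α = indicator 𝓐
      β = indicator 𝓑
      y r w ζ σ c′ : Carrier
      y = x (suc a) v
      r = x⁻¹ (2 ℕ.+ a) v
      w = r * y
      ζ = c * (y * y)
      σ = s - ζ
      c′ = c * (w * w)
      E G U S T Z : Mat N N
      E = ∂ (suc a) (next v) n
      G = ∂ a (next v) n
      U = laplacian c a (next v) 𝓑
      S i k = α i * E k i
      T k j = c′ * E k j
      Z = S ⊗ T

      αG : ∀ i k → α i * (G i k * β k) ≈ G i k * β k
      αG = shadow-supported a (next v) 𝓕 𝓕-compressed

      αU : ∀ i j → α i * U i j ≈ U i j
      αU i j = trans (*-∑ _ _) (∑-cong λ k → begin
        α i * (G i k * (c * (β k * G j k)))
          ≈⟨ solve 5 (λ p g c b g′ → p :* (g :* (c :* (b :* g′))) := (p :* (g :* b)) :* (c :* g′)) refl _ _ _ _ _ ⟩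
        (α i * (G i k * β k)) * (c * G j k)
          ≈⟨ *-congʳ (αG i k) ⟩
        (G i k * β k) * (c * G j k)
          ≈⟨ solve 4 (λ g c b g′ → (g :* b) :* (c :* g′) := g :* (c :* (b :* g′))) refl _ _ _ _ ⟩
        G i k * (c * (β k * G j k)) ∎)

      Uα : ∀ i j → U i j * α j ≈ U i j
      Uα i j = trans (∑-* _ _) (∑-cong λ k → begin
        (G i k * (c * (β k * G j k))) * α j
          ≈⟨ solve 5 (λ p g c b g′ → (g :* (c :* (b :* g′))) :* p := (p :* (g′ :* b)) :* (c :* g)) refl _ _ _ _ _ ⟩
        (α j * (G j k * β k)) * (c * G i k)
          ≈⟨ *-congʳ (αG j k) ⟩
        (G j k * β k) * (c * G i k)
          ≈⟨ solve 4 (λ g c b g′ → (g′ :* b) :* (c :* g) := g :* (c :* (b :* g′))) refl _ _ _ _ ⟩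
        G i k * (c * (β k * G j k)) ∎)

      αα : ∀ i → α i * α i ≈ α i
      αα i with 𝓐 (decode n i)
      ... | true = *-identityˡ _
      ... | false = zeroˡ _

      αZ : ∀ i j → α i * Z i j ≈ Z i j
      αZ i j = trans (*-∑ _ _) (∑-cong λ k →
        trans (sym (*-assoc _ _ _)) (*-congʳ (trans (sym (*-assoc _ _ _)) (*-congʳ (αα i)))))

      -- In the middle of the product stands Φ_𝓑 Gᵀ Φ_𝓐 Eᵀ. Since the boundary of 𝓑 already lives on
      -- 𝓐, `αG` removes Φ_𝓐, and what remains contains the transpose of E G = 0.
      UZ≋O : U ⊗ Z ≋ O
      UZ≋O i j = begin
        (U ⊗ Z) i j
          ≈⟨ ⊗-assoc G G′ Z i j ⟩
        (G ⊗ (G′ ⊗ (S ⊗ T))) i j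
          ≈⟨ ⊗-cong {A = G} (λ _ _ → refl) (λ i j → sym (⊗-assoc G′ S T i j)) i j ⟩
        (G ⊗ ((G′ ⊗ S) ⊗ T)) i j
          ≈⟨ ∑≈0 (λ k → trans (*-congˡ (∑≈0 λ l → trans (*-congʳ (G′S k l)) (zeroˡ _))) (zeroʳ _)) ⟩
        0# ∎
        where
        G′ : Mat N N
        G′ k j = c * (β k * G j k)
        G′S : G′ ⊗ S ≋ O
        G′S k l = begin
          ∑ (λ j → c * (β k * G j k) * (α j * E l j))
            ≈⟨ ∑-cong (λ j → trans
                 (solve 5 (λ c b g p e → c :* (b :* g) :* (p :* e) := (p :* (g :* b)) :* (c :* e)) refl _ _ _ _ _)
                 (trans (*-congʳ (αG j k))
                 (solve 4 (λ c b g e → (g :* b) :* (c :* e) := (c :* b) :* (e :* g)) refl _ _ _ _))) ⟩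
          ∑ (λ j → (c * β k) * (E l j * G j k))
            ≈⟨ *-∑ _ _ ⟨
          (c * β k) * (E ⊗ G) l k
            ≈⟨ trans (*-congˡ (∂∂≋O n a (next v) l k)) (zeroʳ _) ⟩
          0# ∎

      -- The reason for writing Z as `S ⊗ T`: `sylvester` trades Z for this product, to which the
      -- induction hypothesis applies.
      TS≋laplacian : T ⊗ S ≋ laplacian c′ (suc a) (next v) 𝓐
      TS≋laplacian i j = ∑-cong λ k →
        solve 3 (λ c e f → c :* e :* f := e :* (c :* f)) refl _ _ _

      -- In blocks, Q = [-rE; I] and H = [yI, G], the latter being the lower half of the boundary.
      -- The upper half is -rE times the lower one: -rE y = -wE, and -rE G = 0.
      Q : Mat (N ℕ.+ N) N
      Q = (λ i j → - (r * E i j)) ⧺ δ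
      H : Mat N (N ℕ.+ N)
      H i = ∂ a v (suc n) (N ↑ʳ i)
      M₁₁ M₂₁ : Mat N N
      M₁₁ i j = - (w * E i j)
      M₂₁ = scalar y

      ∂₁₁ : ∀ i j → ∂ a v (suc n) (i ↑ˡ N) (j ↑ˡ N) ≡ - (w * E i j)
      ∂₁₁ = blk₁₁ M₁₁ O M₂₁ G
      ∂₁₂ : ∀ i j → ∂ a v (suc n) (i ↑ˡ N) (N ↑ʳ j) ≡ 0#
      ∂₁₂ = blk₁₂ M₁₁ O M₂₁ G
      H₁ : ∀ i j → H i (j ↑ˡ N) ≡ δ i j * y
      H₁ = blk₂₁ M₁₁ O M₂₁ G
      H₂ : ∀ i j → H i (N ↑ʳ j) ≡ G i j
      H₂ = blk₂₂ M₁₁ O M₂₁ G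
      Q₁ : ∀ i j → Q (i ↑ˡ N) j ≈ - (r * E i j)
      Q₁ i j = reflexive (≡.cong (λ u → u j) (⧺-left (λ i j → - (r * E i j)) δ i))
      Q₂ : ∀ i j → Q (N ↑ʳ i) j ≈ δ i j
      Q₂ i j = reflexive (≡.cong (λ u → u j) (⧺-right (λ i j → - (r * E i j)) δ i))

      ∂≋QH : ∂ a v (suc n) ≋ Q ⊗ H
      ∂≋QH = join-elim N
        (λ i → join-elim N (left-left i) (left-right i))
        (λ i j → sym (trans (∑-cong λ k → *-congʳ (Q₂ i k)) (∑-δˡ i (λ k → H k j))))
        where
        left-left : ∀ i j → ∂ a v (suc n) (i ↑ˡ N) (j ↑ˡ N) ≈ (Q ⊗ H) (i ↑ˡ N) (j ↑ˡ N)
        left-left i j = begin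
          ∂ a v (suc n) (i ↑ˡ N) (j ↑ˡ N)
            ≡⟨ ∂₁₁ i j ⟩
          - (w * E i j)
            ≈⟨ -‿cong (solve 3 (λ r y e → r :* y :* e := r :* e :* y) refl _ _ _) ⟩
          - (r * E i j * y)
            ≈⟨ -‿distribˡ-* _ _ ⟩
          - (r * E i j) * y
            ≈⟨ ⊗-diag (λ i j → - (r * E i j)) (λ _ → y) i j ⟨
          ∑ (λ k → - (r * E i k) * (δ k j * y))
            ≈⟨ ∑-cong (λ k → *-cong (Q₁ i k) (reflexive (H₁ k j))) ⟨
          (Q ⊗ H) (i ↑ˡ N) (j ↑ˡ N) ∎
        left-right : ∀ i j → ∂ a v (suc n) (i ↑ˡ N) (N ↑ʳ j) ≈ (Q ⊗ H) (i ↑ˡ N) (N ↑ʳ j)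
        left-right i j = begin
          ∂ a v (suc n) (i ↑ˡ N) (N ↑ʳ j)
            ≡⟨ ∂₁₂ i j ⟩
          0#
            ≈⟨ trans (*-congˡ (∂∂≋O n a (next v) i j)) (zeroʳ _) ⟨
          - r * (E ⊗ G) i j
            ≈⟨ *-∑ _ _ ⟩
          ∑ (λ k → - r * (E i k * G k j))
            ≈⟨ ∑-cong (λ k → trans (sym (*-assoc _ _ _)) (*-congʳ (sym (-‿distribˡ-* _ _)))) ⟩
          ∑ (λ k → - (r * E i k) * G k j)
            ≈⟨ ∑-cong (λ k → *-cong (Q₁ i k) (reflexive (H₂ k j))) ⟨
          (Q ⊗ H) (i ↑ˡ N) (N ↑ʳ j) ∎

      -- The Laplacian of 𝓕 factors as Q ⊗ (H ⊗ D); reduced is the product in the other order.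
      D : Mat (N ℕ.+ N) (N ℕ.+ N)
      D k j = c * (indicator 𝓕 k * ∂ a v (suc n) j k)

      reduced : Mat N N
      reduced i j = diag (λ i → ζ * α i) i j + (U i j + Z i j)

      D₁ : ∀ k j → D (k ↑ˡ N) j ≈ c * (α k * ∂ a v (suc n) j (k ↑ˡ N))
      D₁ k j = *-congˡ (*-congʳ (reflexive (≡.cong (ι ∘ 𝓕) (decode-left n k))))
      D₂ : ∀ k j → D (N ↑ʳ k) j ≈ c * (β k * ∂ a v (suc n) j (N ↑ʳ k))
      D₂ k j = *-congˡ (*-congʳ (reflexive (≡.cong (ι ∘ 𝓕) (decode-right n k))))

      DQ₁ : ∀ k l → (D ⊗ Q) (k ↑ˡ N) l ≈ c * α k * (w * r * ∑ (λ j → E j k * E j l) + y * δ k l)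
      DQ₁ k l = begin
        (D ⊗ Q) (k ↑ˡ N) l
          ≈⟨ trans (∑-cong λ j → trans (*-congʳ (D₁ k j))
               (solve 4 (λ c p d q → c :* (p :* d) :* q := c :* p :* (d :* q)) refl _ _ _ _)) (sym (*-∑ _ _)) ⟩
        c * α k * ∑ (λ j → ∂ a v (suc n) j (k ↑ˡ N) * Q j l)
          ≈⟨ *-congˡ (trans (∑-join N _) (+-cong
               (∑-cong λ j → *-cong (reflexive (∂₁₁ j k)) (Q₁ j l))
               (∑-cong λ j → *-cong (reflexive (H₁ j k)) (Q₂ j l)))) ⟩
        c * α k * (∑ (λ j → - (w * E j k) * - (r * E j l)) + ∑ (λ j → δ j k * y * δ j l))
          ≈⟨ *-congˡ (+-cong
               (trans (∑-cong λ j → trans (sym (-‿distribˡ-* _ _)) (trans (-‿cong (sym (-‿distribʳ-* _ _)))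
                 (trans (-‿involutive _)
                   (solve 4 (λ w e r e′ → w :* e :* (r :* e′) := w :* r :* (e :* e′)) refl _ _ _ _))))
                 (sym (*-∑ _ _)))
               (trans (∑-cong λ j → trans (*-assoc _ _ _) (*-congʳ (reflexive (δ-sym j k))))
                 (∑-δˡ k (λ j → y * δ j l)))) ⟩
        c * α k * (w * r * ∑ (λ j → E j k * E j l) + y * δ k l) ∎

      DQ₂ : ∀ k l → (D ⊗ Q) (N ↑ʳ k) l ≈ c * (β k * G l k)
      DQ₂ k l = begin
        (D ⊗ Q) (N ↑ʳ k) l
          ≈⟨ trans (∑-cong λ j → *-congʳ (D₂ k j)) (∑-join N _) ⟩
        ∑ (λ j → c * (β k * ∂ a v (suc n) (j ↑ˡ N) (N ↑ʳ k)) * Q (j ↑ˡ N) l) +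
        ∑ (λ j → c * (β k * H j (N ↑ʳ k)) * Q (N ↑ʳ j) l)
          ≈⟨ +-cong
               (∑≈0 λ j → trans (*-congʳ (trans (*-congˡ (trans (*-congˡ (reflexive (∂₁₂ j k))) (zeroʳ _))) (zeroʳ _))) (zeroˡ _))
               (∑-cong λ j → *-cong (*-congˡ (*-congˡ (reflexive (H₂ j k)))) (Q₂ j l)) ⟩
        0# + ∑ (λ j → c * (β k * G j k) * δ j l)
          ≈⟨ trans (+-identityˡ _) (∑-δʳ l (λ j → c * (β k * G j k))) ⟩
        c * (β k * G l k) ∎

      -- The block yI of H picks out the rows of `D ⊗ Q` indexed by sets containing v. Their
      -- identity part gives ζ Φ_𝓐 and their EᵀE part gives Z, because y w r = w². The block G of H
      -- gives U.
      HDQ≋reduced : (H ⊗ D) ⊗ Q ≋ reduced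
      HDQ≋reduced i l = begin
        ((H ⊗ D) ⊗ Q) i l
          ≈⟨ ⊗-assoc H D Q i l ⟩
        (H ⊗ (D ⊗ Q)) i l
          ≈⟨ trans (∑-join N _) (+-cong
               (∑-cong λ k → *-cong (reflexive (H₁ i k)) (DQ₁ k l))
               (∑-cong λ k → *-cong (reflexive (H₂ i k)) (DQ₂ k l))) ⟩
        ∑ (λ k → δ i k * y * (c * α k * (w * r * ∑ (λ j → E j k * E j l) + y * δ k l))) + U i l
          ≈⟨ +-congʳ (trans (∑-cong λ k → *-assoc _ _ _) (∑-δˡ i _)) ⟩
        y * (c * α i * (w * r * EE + y * δ i l)) + U i l
          ≈⟨ solve 8 (λ y c p r e d u w →
               y :* (c :* p :* (w :* r :* e :+ y :* d)) :+ u :=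
               d :* (c :* (y :* y) :* p) :+ (u :+ p :* (c :* (w :* (r :* y))) :* e)) refl _ _ _ _ _ _ _ _ ⟩
        diag (λ i → ζ * α i) i l + (U i l + α i * c′ * EE)
          ≈⟨ +-congˡ (+-congˡ (trans (*-∑ _ _) (∑-cong λ k →
               solve 4 (λ p c e e′ → p :* c :* (e :* e′) := p :* e :* (c :* e′)) refl _ _ _ _))) ⟩
        reduced i l ∎
        where EE = ∑ (λ j → E j i * E j l)

      det-reduced : s ^ N * det (characteristic s (laplacian c a v 𝓕)) ≈
                    s ^ (N ℕ.+ N) * det (characteristic s reduced)
      det-reduced = begin
        s ^ N * det (characteristic s (∂ a v (suc n) ⊗ D))
          ≈⟨ *-congˡ (det-cong λ i j → +-congˡ (-‿cong (trans
               (⊗-cong {B = D} ∂≋QH (λ _ _ → refl) i j) (⊗-assoc Q H D i j)))) ⟩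
        s ^ N * det (characteristic s (Q ⊗ (H ⊗ D)))
          ≈⟨ sylvester s Q (H ⊗ D) ⟩
        s ^ (N ℕ.+ N) * det (characteristic s ((H ⊗ D) ⊗ Q))
          ≈⟨ *-congˡ (det-cong λ i j → +-congˡ (-‿cong (HDQ≋reduced i j))) ⟩
        s ^ (N ℕ.+ N) * det (characteristic s reduced) ∎

      onLink : Carrier → Carrier → Row N
      onLink p q i = if 𝓐 (decode n i) then p else q

      a₁ a₀ : ℕ
      a₁ = card 𝓐
      a₀ = card (not ∘ 𝓐)

      Θ : Mat N N
      Θ = diag (onLink σ s)

      det-onLink : ∀ p q → det (diag (onLink p q)) ≈ p ^ a₁ * q ^ a₀
      det-onLink p q = trans (det-diag (onLink p q)) (∏-select 𝓐 p q)

      onLink-σs : ∀ i → s - ζ * α i ≈ onLink σ s i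
      onLink-σs i with 𝓐 (decode n i)
      ... | true = +-congˡ (-‿cong (*-identityʳ _))
      ... | false = trans (+-congˡ (trans (-‿cong (zeroʳ _)) -0#≈0#)) (+-identityʳ _)

      -- A quantity absorbed by the indicator vanishes off the link, so it never sees the value `q`.
      absorb : ∀ {p q u} i → α i * u ≈ u → onLink p q i * u ≈ p * u
      absorb i αu with 𝓐 (decode n i)
      ... | true = refl
      ... | false = trans (*-congˡ u≈0) (trans (zeroʳ _) (sym (trans (*-congˡ u≈0) (zeroʳ _))))
        where u≈0 = trans (sym αu) (zeroˡ _)

      onLink-* : ∀ i → onLink σ s i * onLink 1# σ i ≈ σ * onLink 1# s i
      onLink-* i with 𝓐 (decode n i)
      ... | true = refl
      ... | false = *-comm _ _

      characteristic-reduced : characteristic s reduced ≋ (Θ ⊖ U) ⊖ Z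
      characteristic-reduced i j = begin
        δ i j * s - (δ i j * (ζ * α i) + (U i j + Z i j))
          ≈⟨ +-congˡ (trans (sym (-‿+-comm _ _)) (+-congˡ (sym (-‿+-comm _ _)))) ⟩
        δ i j * s + (- (δ i j * (ζ * α i)) + (- U i j + - Z i j))
          ≈⟨ solve 4 (λ p q u z → p :+ (q :+ (u :+ z)) := p :+ q :+ u :+ z) refl _ _ _ _ ⟩
        δ i j * s - δ i j * (ζ * α i) - U i j - Z i j
          ≈⟨ +-congʳ (+-congʳ (trans (sym (x[y-z]≈xy-xz _ _ _)) (*-congˡ (onLink-σs i)))) ⟩
        δ i j * onLink σ s i - U i j - Z i j ∎

      -- Since U ⊗ Z vanishes and Θ acts on U as the scalar σ.
      factorisation : Θ ⊗ ((Θ ⊖ U) ⊖ Z) ≋ (Θ ⊖ U) ⊗ (Θ ⊖ Z)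
      factorisation i j = sym (begin
        ((Θ ⊖ U) ⊗ (Θ ⊖ Z)) i j
          ≈⟨ ⊖-⊗ Θ U (Θ ⊖ Z) i j ⟩
        (Θ ⊗ (Θ ⊖ Z)) i j - (U ⊗ (Θ ⊖ Z)) i j
          ≈⟨ +-cong (diag-⊗ (onLink σ s) (Θ ⊖ Z) i j) (-‿cong (begin
               (U ⊗ (Θ ⊖ Z)) i j
                 ≈⟨ ⊗-⊖ U Θ Z i j ⟩
               (U ⊗ Θ) i j - (U ⊗ Z) i j
                 ≈⟨ +-cong (⊗-diag U (onLink σ s) i j) (trans (-‿cong (UZ≋O i j)) -0#≈0#) ⟩
               U i j * onLink σ s j + 0#
                 ≈⟨ trans (+-identityʳ _) (*-comm _ _) ⟩
               onLink σ s j * U i j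
                 ≈⟨ absorb j (trans (*-comm _ _) (Uα i j)) ⟩
               σ * U i j
                 ≈⟨ absorb i (αU i j) ⟨
               θ * U i j ∎)) ⟩
        θ * (Θ i j - Z i j) - θ * U i j
          ≈⟨ x[y-z]≈xy-xz _ _ _ ⟨
        θ * (Θ i j - Z i j - U i j)
          ≈⟨ *-congˡ (solve 3 (λ p q r → p :+ q :+ r := p :+ r :+ q) refl _ _ _) ⟩
        θ * (Θ i j - U i j - Z i j)
          ≈⟨ diag-⊗ (onLink σ s) ((Θ ⊖ U) ⊖ Z) i j ⟨
        (Θ ⊗ ((Θ ⊖ U) ⊖ Z)) i j ∎)
        where θ = onLink σ s i

      δ-move : ∀ {m} (i j : Fin m) (f : Row m) → δ i j * f i ≈ δ i j * f j
      δ-move zero zero f = refl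
      δ-move zero (suc j) f = trans (zeroˡ _) (sym (zeroˡ _))
      δ-move (suc i) zero f = trans (zeroˡ _) (sym (zeroˡ _))
      δ-move (suc i) (suc j) f = δ-move i j (f ∘ suc)

      -- Θ differs from the scalar σ only off the link, where its entry is s. Scaling those columns
      -- by σ on one side and by s on the other equalises them without dividing, and U, having no
      -- columns there, does not notice.
      shift-U : (Θ ⊖ U) ⊗ diag (onLink 1# σ) ≋ characteristic σ U ⊗ diag (onLink 1# s)
      shift-U i j = begin
        ((Θ ⊖ U) ⊗ diag (onLink 1# σ)) i j
          ≈⟨ trans (⊗-diag (Θ ⊖ U) (onLink 1# σ) i j) ([y-z]x≈yx-zx _ _ _) ⟩
        δ i j * onLink σ s i * onLink 1# σ j - U i j * onLink 1# σ j
          ≈⟨ +-cong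
               (trans (*-congʳ (δ-move i j (onLink σ s))) (trans (*-assoc _ _ _)
                 (trans (*-congˡ (onLink-* j)) (sym (*-assoc _ _ _)))))
               (-‿cong (trans (*-comm _ _) (trans (absorb j αu) (trans (sym (absorb j αu)) (*-comm _ _))))) ⟩
        δ i j * σ * onLink 1# s j - U i j * onLink 1# s j
          ≈⟨ trans (⊗-diag (characteristic σ U) (onLink 1# s) i j) ([y-z]x≈yx-zx _ _ _) ⟨
        (characteristic σ U ⊗ diag (onLink 1# s)) i j ∎
        where αu = trans (*-comm _ _) (Uα i j)

      -- The scaling is now on the left, because Z is confined to the link by its rows: Z = Φ_𝓐 Eᵀ
      -- (c w² E) carries the projection on that side only.
      shift-Z : diag (onLink 1# σ) ⊗ (Θ ⊖ Z) ≋ diag (onLink 1# s) ⊗ characteristic σ Z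
      shift-Z i j = begin
        (diag (onLink 1# σ) ⊗ (Θ ⊖ Z)) i j
          ≈⟨ trans (diag-⊗ (onLink 1# σ) (Θ ⊖ Z) i j) (x[y-z]≈xy-xz _ _ _) ⟩
        onLink 1# σ i * (δ i j * onLink σ s i) - onLink 1# σ i * Z i j
          ≈⟨ +-cong
               (trans (*-left-comm _ _ _) (trans (*-congˡ (trans (*-comm _ _) (trans (onLink-* i) (*-comm _ _))))
                 (*-left-comm _ _ _)))
               (-‿cong (trans (absorb i (αZ i j)) (sym (absorb i (αZ i j))))) ⟩
        onLink 1# s i * (δ i j * σ) - onLink 1# s i * Z i j
          ≈⟨ trans (diag-⊗ (onLink 1# s) (characteristic σ Z) i j) (x[y-z]≈xy-xz _ _ _) ⟨
        (diag (onLink 1# s) ⊗ characteristic σ Z) i j ∎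

      -- The surviving power of σ is a count. The two claims bring 2N = 2 a₁ + 2 a₀ factors σ, and
      -- `factor` cancels a₂ + a₃ + 2 a₀ + a₁ of them. That leaves a₁ - a₂ - a₃ = a₄, one for each
      -- base move.
      det-step : ∀ a₂ a₃ a₄ {P₁ P₂} → Regular s → Regular σ →
        a₁ ≡ a₂ ℕ.+ a₃ ℕ.+ a₄ →
        σ ^ a₂ * det (characteristic σ (laplacian c′ (suc a) (next v) 𝓐)) ≈ σ ^ N * P₁ →
        σ ^ a₃ * det (characteristic σ U) ≈ σ ^ N * P₂ →
        s ^ a₁ * det (characteristic s (laplacian c a v 𝓕)) ≈ s ^ (N ℕ.+ N) * (σ ^ a₄ * (P₁ * P₂))
      det-step a₂ a₃ a₄ {P₁} {P₂} reg-s reg-σ a₁≡ claim-𝓐 claim-𝓑 = begin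
        s ^ a₁ * det (characteristic s (laplacian c a v 𝓕))
          ≈⟨ *-congˡ (regular-^ N reg-s (trans det-reduced (trans
               (*-congʳ (^-homo-* s N N)) (*-assoc _ _ _)))) ⟩
        s ^ a₁ * (s ^ N * d)
          ≈⟨ *-congˡ (*-congˡ d≈) ⟩
        s ^ a₁ * (s ^ N * (s ^ a₀ * (σ ^ a₄ * (P₁ * P₂))))
          ≈⟨ solve 4 (λ p q r u → p :* (q :* (r :* u)) := (p :* r) :* q :* u) refl _ _ _ _ ⟩
        (s ^ a₁ * s ^ a₀) * s ^ N * (σ ^ a₄ * (P₁ * P₂))
          ≈⟨ *-congʳ (trans (*-congʳ (sym (^-N s))) (sym (^-homo-* s N N))) ⟩
        s ^ (N ℕ.+ N) * (σ ^ a₄ * (P₁ * P₂)) ∎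
        where
        d dU dZ : Carrier
        d = det (characteristic s reduced)
        dU = det (characteristic σ U)
        dZ = det (characteristic σ Z)
        ^-N : ∀ u → u ^ N ≈ u ^ a₁ * u ^ a₀
        ^-N u = trans (reflexive (≡.cong (u ^_) (≡.sym (card-complement 𝓐)))) (^-homo-* u a₁ a₀)
        σ^a₁ : σ ^ a₁ ≈ σ ^ a₂ * σ ^ a₃ * σ ^ a₄
        σ^a₁ = trans (reflexive (≡.cong (σ ^_) a₁≡))
          (trans (^-homo-* σ (a₂ ℕ.+ a₃) a₄) (*-congʳ (^-homo-* σ a₂ a₃)))
        det-onLink-1 : ∀ q → det (diag (onLink 1# q)) ≈ q ^ a₀
        det-onLink-1 q = trans (det-onLink 1# q) (trans (*-congʳ (1^n≈1 a₁)) (*-identityˡ _))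
        split : (σ ^ a₁ * s ^ a₀) * d ≈ det (Θ ⊖ U) * det (Θ ⊖ Z)
        split = begin
          (σ ^ a₁ * s ^ a₀) * d
            ≈⟨ *-cong (sym (det-onLink σ s)) (det-cong characteristic-reduced) ⟩
          det Θ * det ((Θ ⊖ U) ⊖ Z)
            ≈⟨ det-⊗ Θ _ ⟨
          det (Θ ⊗ ((Θ ⊖ U) ⊖ Z))
            ≈⟨ trans (det-cong factorisation) (det-⊗ (Θ ⊖ U) (Θ ⊖ Z)) ⟩
          det (Θ ⊖ U) * det (Θ ⊖ Z) ∎
        split-U : det (Θ ⊖ U) * σ ^ a₀ ≈ dU * s ^ a₀
        split-U = begin
          det (Θ ⊖ U) * σ ^ a₀
            ≈⟨ *-congˡ (det-onLink-1 σ) ⟨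
          det (Θ ⊖ U) * det (diag (onLink 1# σ))
            ≈⟨ trans (sym (det-⊗ (Θ ⊖ U) _)) (trans (det-cong shift-U) (det-⊗ (characteristic σ U) _)) ⟩
          dU * det (diag (onLink 1# s))
            ≈⟨ *-congˡ (det-onLink-1 s) ⟩
          dU * s ^ a₀ ∎
        split-Z : σ ^ a₀ * det (Θ ⊖ Z) ≈ s ^ a₀ * dZ
        split-Z = begin
          σ ^ a₀ * det (Θ ⊖ Z)
            ≈⟨ *-congʳ (det-onLink-1 σ) ⟨
          det (diag (onLink 1# σ)) * det (Θ ⊖ Z)
            ≈⟨ trans (sym (det-⊗ _ (Θ ⊖ Z))) (trans (det-cong shift-Z) (det-⊗ _ (characteristic σ Z))) ⟩
          det (diag (onLink 1# s)) * dZ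
            ≈⟨ *-congʳ (det-onLink-1 s) ⟩
          s ^ a₀ * dZ ∎
        dZ≈ : dZ ≈ det (characteristic σ (laplacian c′ (suc a) (next v) 𝓐))
        dZ≈ = regular-^ N reg-σ (trans (sylvester σ S T)
          (*-congˡ (det-cong λ i j → +-congˡ (-‿cong (TS≋laplacian i j)))))
        -- Everything by which d gets multiplied: a₂ and a₃ factors σ demanded by the two claims, a₀
        -- each for `split-U` and `split-Z`, and det Θ = σ^a₁ s^a₀ for `split`.
        factor : Carrier
        factor = σ ^ a₂ * σ ^ a₃ * (σ ^ a₀ * σ ^ a₀) * (σ ^ a₁ * s ^ a₀)
        factor-regular : Regular factor
        factor-regular = regular-* (regular-* (regular-* (regular-^ a₂ reg-σ) (regular-^ a₃ reg-σ))
          (regular-* (regular-^ a₀ reg-σ) (regular-^ a₀ reg-σ))) (regular-* (regular-^ a₁ reg-σ) (regular-^ a₀ reg-s))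
        d≈ : d ≈ s ^ a₀ * (σ ^ a₄ * (P₁ * P₂))
        d≈ = factor-regular (begin
          factor * d
            ≈⟨ trans (*-assoc _ _ _) (*-congˡ split) ⟩
          σ ^ a₂ * σ ^ a₃ * (σ ^ a₀ * σ ^ a₀) * (det (Θ ⊖ U) * det (Θ ⊖ Z))
            ≈⟨ solve 5 (λ p q r u z → p :* q :* (r :* r) :* (u :* z) := p :* q :* ((u :* r) :* (r :* z))) refl _ _ _ _ _ ⟩
          σ ^ a₂ * σ ^ a₃ * ((det (Θ ⊖ U) * σ ^ a₀) * (σ ^ a₀ * det (Θ ⊖ Z)))
            ≈⟨ *-congˡ (*-cong split-U (trans split-Z (*-congˡ dZ≈))) ⟩
          σ ^ a₂ * σ ^ a₃ * ((dU * s ^ a₀) * (s ^ a₀ * det (characteristic σ (laplacian c′ (suc a) (next v) 𝓐))))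
            ≈⟨ solve 5 (λ p q u t z → p :* q :* ((u :* t) :* (t :* z)) := (p :* z) :* (q :* u) :* (t :* t)) refl _ _ _ _ _ ⟩
          (σ ^ a₂ * det (characteristic σ (laplacian c′ (suc a) (next v) 𝓐))) * (σ ^ a₃ * dU) * (s ^ a₀ * s ^ a₀)
            ≈⟨ *-congʳ (*-cong claim-𝓐 claim-𝓑) ⟩
          (σ ^ N * P₁) * (σ ^ N * P₂) * (s ^ a₀ * s ^ a₀)
            ≈⟨ *-congʳ (*-cong (*-congʳ (trans (^-N σ) (*-congʳ σ^a₁))) (*-congʳ (^-N σ))) ⟩
          ((σ ^ a₂ * σ ^ a₃ * σ ^ a₄) * σ ^ a₀ * P₁) * ((σ ^ a₁ * σ ^ a₀) * P₂) * (s ^ a₀ * s ^ a₀)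
            ≈⟨ solve 8 (λ x₂ x₃ x₄ x₀ x₁ p q t →
                 ((x₂ :* x₃ :* x₄) :* x₀ :* p) :* ((x₁ :* x₀) :* q) :* (t :* t) :=
                 (x₂ :* x₃ :* (x₀ :* x₀) :* (x₁ :* t)) :* (t :* (x₄ :* (p :* q)))) refl _ _ _ _ _ _ _ _ ⟩
          factor * (s ^ a₀ * (σ ^ a₄ * (P₁ * P₂))) ∎)

    -- `𝒮` is a class of cancellable spectral parameters and `𝒞` a class of constants, closed just
    -- enough for s ↦ s - c y² and c ↦ c w² to stay inside. They are instantiated by polynomials t -
    -- e and by t-free polynomials.
    module Spectrum (𝒮 𝒞 : Carrier → Set) (𝒮-regular : ∀ {s} → 𝒮 s → Regular s)
      (𝒮-shift : ∀ {s e} → 𝒮 s → 𝒞 e → 𝒮 (s - e)) (𝒞-* : ∀ {e f} → 𝒞 e → 𝒞 f → 𝒞 (e * f))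
      (𝒞-x : ∀ a v → 𝒞 (x a v)) (𝒞-x⁻¹ : ∀ a v → 𝒞 (x⁻¹ a v)) where

      -- Stated for all s and c, since both branches of the recursion evaluate at σ and the link
      -- also changes c. The power of s on the left avoids the subtraction `pow2 n` minus `rank 𝓕`.
      det-laplacian : ∀ {n} a v (𝓕 : Family n) {c s} → Compressed 𝓕 → 𝒞 c → 𝒮 s →
        s ^ rank 𝓕 * det (characteristic s (laplacian c a v 𝓕)) ≈ s ^ pow2 n * eigenProduct s c a v 𝓕
      det-laplacian {zero} a v 𝓕 {c} {s} sh 𝒞c 𝒮s = begin
        1# * det (characteristic s (laplacian c a v 𝓕))
          ≈⟨ *-identityˡ _ ⟩
        det (characteristic s (laplacian c a v 𝓕))
          ≈⟨ det-cong {M = characteristic s (laplacian c a v 𝓕)} {scalar s}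
               (λ i j → trans (+-congˡ (trans (-‿cong (∑≈0 λ k → zeroˡ _)) -0#≈0#)) (+-identityʳ _)) ⟩
        det (scalar {1} s)
          ≈⟨ det-scalar 1 s ⟩
        s ^ 1
          ≈⟨ *-identityʳ _ ⟨
        s ^ 1 * 1# ∎
      det-laplacian {suc n} a v 𝓕 {c} {s} sh 𝒞c 𝒮s = det-step (rank 𝓐) (rank 𝓑) (baseMoves 𝓐 𝓑)
        (𝒮-regular 𝒮s) (𝒮-regular 𝒮σ) (card-link {𝓕 = 𝓕} sh)
        (det-laplacian (suc a) (next v) 𝓐 (compressed-∷ {𝓕 = 𝓕} true sh) (𝒞-* 𝒞c (𝒞-* 𝒞w 𝒞w)) 𝒮σ)
        (det-laplacian a (next v) 𝓑 (compressed-∷ {𝓕 = 𝓕} false sh) 𝒞c 𝒮σ)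
        where
        open Step a v 𝓕 sh c s
        𝒮σ : 𝒮 σ
        𝒮σ = 𝒮-shift 𝒮s (𝒞-* 𝒞c (𝒞-* (𝒞-x _ _) (𝒞-x _ _)))
        𝒞w : 𝒞 w
        𝒞w = 𝒞-* (𝒞-x⁻¹ _ _) (𝒞-x _ _)

-- Laurent polynomials as a commutative ring, and cancellation of t - e.

module LaurentPolynomials where
  open import Defs
  open import Algebra.Bundles using (CommutativeRing)
  import Algebra.Properties.Ring
  import Algebra.Properties.CommutativeSemigroup
  open import Data.Bool using (Bool; true; false; if_then_else_)
  open import Data.Bool.ListAction using (all)
  open import Data.Nat as ℕ using (ℕ; zero; suc)
  open import Data.Integer as ℤ using (ℤ; +_; 0ℤ; 1ℤ)
  import Data.Integer.Properties as ℤ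
  open import Data.List using (List; []; _∷_; _++_; map)
  open import Data.List.Properties using (map-id; map-++; map-cong; map-∘; ++-assoc; ++-identityʳ; concatMap-++)
  open import Data.List.Membership.Propositional using (_∈_)
  open import Data.List.Membership.Propositional.Properties using (∈-++⁺ˡ; ∈-++⁺ʳ)
  open import Data.List.Relation.Unary.Any using (here; there)
  open import Data.List.Relation.Unary.All as All using (All; []; _∷_)
  import Data.List.Relation.Unary.All.Properties as All
  open import Data.Product using (_×_; _,_; proj₁; proj₂; ∃-syntax)
  open import Data.Sum using (_⊎_; inj₁; inj₂)
  open import Level using (0ℓ)
  open import Relation.Binary.PropositionalEquality as ≡
    using (_≡_; refl; sym; trans; cong; cong₂; subst; module ≡-Reasoning)
  open import Relation.Nullary using (yes; no; contradiction)
  open import Relation.Nullary.Decidable using (⌊_⌋)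

  open Algebra.Properties.CommutativeSemigroup ℤ.+-commutativeSemigroup
    using () renaming (interchange to ℤ-+-interchange; x∙yz≈y∙xz to ℤ-+-left-comm)

  ==V-sound : ∀ v w → (v ==V w) ≡ true → v ≡ w
  ==V-sound tv tv _ = refl
  ==V-sound (xv a j) (xv b k) p with a ℕ.≟ b | j ℤ.≟ k | p
  ... | yes refl | yes refl | _ = refl

  expOf-++ : ∀ v m m′ → expOf v (m ++ m′) ≡ expOf v m ℤ.+ expOf v m′
  expOf-++ v [] m′ = sym (ℤ.+-identityˡ _)
  expOf-++ v ((w , e) ∷ m) m′ with w ==V v
  ... | true = trans (cong (ℤ._+_ (e)) (expOf-++ v m m′)) (sym (ℤ.+-assoc e _ _))
  ... | false = expOf-++ v m m′

  expOf-powMono : ∀ v k m → expOf v (powMono k m) ≡ k ℤ.* expOf v m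
  expOf-powMono v k [] = sym (ℤ.*-zeroʳ k)
  expOf-powMono v k ((w , e) ∷ m) with w ==V v
  ... | true = trans (cong (ℤ._+_ (k ℤ.* e)) (expOf-powMono v k m)) (sym (ℤ.*-distribˡ-+ k e _))
  ... | false = expOf-powMono v k m

  -- `sameMono` compares exponents only at the listed variables; this covers all the others, so that
  -- the test decides equality at every variable.
  occurs? : ∀ v m → v ∈ map proj₁ m ⊎ expOf v m ≡ 0ℤ
  occurs? v [] = inj₂ refl
  occurs? v ((w , e) ∷ m) with w ==V v in eq
  ... | true = inj₁ (here (sym (==V-sound w v eq)))
  ... | false with occurs? v m
  ...   | inj₁ v∈ = inj₁ (there v∈)
  ...   | inj₂ p = inj₂ p

  infix 4 _~_
  _~_ : Mono → Mono → Set
  m ~ m′ = ∀ v → expOf v m ≡ expOf v m′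

  module _ {A : Set} (p : A → Bool) where
    all-sound : ∀ xs → all p xs ≡ true → ∀ {x} → x ∈ xs → p x ≡ true
    all-sound (x ∷ xs) eq (here refl) with p x | eq
    ... | true | _ = refl
    all-sound (x ∷ xs) eq (there x∈) with p x | eq
    ... | true | eq′ = all-sound xs eq′ x∈

    all-complete : ∀ xs → (∀ x → p x ≡ true) → all p xs ≡ true
    all-complete [] h = refl
    all-complete (x ∷ xs) h rewrite h x = all-complete xs h

  ⌊≟⌋-sound : ∀ {a b : ℤ} → ⌊ a ℤ.≟ b ⌋ ≡ true → a ≡ b
  ⌊≟⌋-sound {a} {b} eq with a ℤ.≟ b | eq
  ... | yes p | _ = p

  ⌊≟⌋-complete : ∀ {a b : ℤ} → a ≡ b → ⌊ a ℤ.≟ b ⌋ ≡ true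
  ⌊≟⌋-complete {a} {b} a≡b with a ℤ.≟ b
  ... | yes _ = refl
  ... | no a≢b = contradiction a≡b a≢b

  sameMono-sound : ∀ m m′ → sameMono m m′ ≡ true → m ~ m′
  sameMono-sound m m′ eq v with occurs? v m | occurs? v m′
  ... | inj₂ p | inj₂ q = trans p (sym q)
  ... | inj₁ v∈ | _ = ⌊≟⌋-sound (all-sound _ (map proj₁ (m ++ m′)) eq
          (subst (v ∈_) (sym (map-++ proj₁ m m′)) (∈-++⁺ˡ v∈)))
  ... | inj₂ _ | inj₁ v∈ = ⌊≟⌋-sound (all-sound _ (map proj₁ (m ++ m′)) eq
          (subst (v ∈_) (sym (map-++ proj₁ m m′)) (∈-++⁺ʳ (map proj₁ m) v∈)))

  sameMono-complete : ∀ m m′ → m ~ m′ → sameMono m m′ ≡ true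
  sameMono-complete m m′ m~m′ = all-complete _ (map proj₁ (m ++ m′)) λ v → ⌊≟⌋-complete (m~m′ v)

  sameMono-⇔ : ∀ {m₁ m₂ m₃ m₄} → (m₁ ~ m₂ → m₃ ~ m₄) → (m₃ ~ m₄ → m₁ ~ m₂) →
    sameMono m₁ m₂ ≡ sameMono m₃ m₄
  sameMono-⇔ {m₁} {m₂} {m₃} {m₄} f g with sameMono m₁ m₂ in eq | sameMono m₃ m₄ in eq′
  ... | true  | true  = refl
  ... | false | false = refl
  ... | true  | false = trans (sym (sameMono-complete m₃ m₄ (f (sameMono-sound m₁ m₂ eq)))) eq′
  ... | false | true  = trans (sym eq) (sameMono-complete m₁ m₂ (g (sameMono-sound m₃ m₄ eq′)))

  ~-sym : ∀ {m m′} → m ~ m′ → m′ ~ m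
  ~-sym p v = sym (p v)

  ~-trans : ∀ {m m′ m″} → m ~ m′ → m′ ~ m″ → m ~ m″
  ~-trans p q v = trans (p v) (q v)

  ++-comm-~ : ∀ m m′ → m ++ m′ ~ m′ ++ m
  ++-comm-~ m m′ v = trans (expOf-++ v m m′) (trans (ℤ.+-comm (expOf v m) _) (sym (expOf-++ v m′ m)))

  ++-cong-~ : ∀ {m m′ p p′} → m ~ m′ → p ~ p′ → m ++ p ~ m′ ++ p′
  ++-cong-~ {m} {m′} {p} {p′} r s v =
    trans (expOf-++ v m p) (trans (cong₂ ℤ._+_ (r v) (s v)) (sym (expOf-++ v m′ p′)))

  infixl 6 _÷_
  _÷_ : Mono → Mono → Mono
  m ÷ m′ = m ++ powMono ℤ.-1ℤ m′

  expOf-÷ : ∀ v m m′ → expOf v (m ÷ m′) ≡ expOf v m ℤ.- expOf v m′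
  expOf-÷ v m m′ = trans (expOf-++ v m _) (cong (ℤ._+_ (expOf v m))
    (trans (expOf-powMono v ℤ.-1ℤ m′) (ℤ.-1*i≡-i _)))

  indicatorℤ : Bool → ℤ → ℤ
  indicatorℤ b c = if b then c else 0ℤ

  coeff-∷ : ∀ c m′ P m → coeff ((c , m′) ∷ P) m ≡ indicatorℤ (sameMono m′ m) c ℤ.+ coeff P m
  coeff-∷ c m′ P m with sameMono m′ m
  ... | true = refl
  ... | false = sym (ℤ.+-identityˡ _)

  coeff-cong : ∀ P {m m′} → m ~ m′ → coeff P m ≡ coeff P m′
  coeff-cong [] m~m′ = refl
  coeff-cong ((c , m₁) ∷ P) {m} {m′} m~m′ = trans (coeff-∷ c m₁ P m) (trans
    (cong₂ (λ b e → indicatorℤ b c ℤ.+ e)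
      (sameMono-⇔ {m₁} {m} {m₁} {m′} (λ p → ~-trans {m₁} {m} {m′} p m~m′) (λ p → ~-trans {m₁} {m′} {m} p (~-sym {m} {m′} m~m′)))
      (coeff-cong P m~m′))
    (sym (coeff-∷ c m₁ P m′)))

  coeff-++ : ∀ P Q m → coeff (P ++ Q) m ≡ coeff P m ℤ.+ coeff Q m
  coeff-++ [] Q m = sym (ℤ.+-identityˡ _)
  coeff-++ ((c , m′) ∷ P) Q m = begin
    coeff ((c , m′) ∷ P ++ Q) m                                     ≡⟨ coeff-∷ c m′ (P ++ Q) m ⟩
    indicatorℤ (sameMono m′ m) c ℤ.+ coeff (P ++ Q) m               ≡⟨ cong (ℤ._+_ (indicatorℤ (sameMono m′ m) c)) (coeff-++ P Q m) ⟩
    indicatorℤ (sameMono m′ m) c ℤ.+ (coeff P m ℤ.+ coeff Q m)      ≡⟨ sym (ℤ.+-assoc (indicatorℤ (sameMono m′ m) c) _ _) ⟩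
    indicatorℤ (sameMono m′ m) c ℤ.+ coeff P m ℤ.+ coeff Q m        ≡⟨ cong (ℤ._+ coeff Q m) (sym (coeff-∷ c m′ P m)) ⟩
    coeff ((c , m′) ∷ P) m ℤ.+ coeff Q m ∎
    where open ≡-Reasoning

  coeff-neg : ∀ P m → coeff (negL P) m ≡ ℤ.- coeff P m
  coeff-neg [] m = refl
  coeff-neg ((c , m′) ∷ P) m with sameMono m′ m
  ... | true = trans (cong (ℤ._+_ (ℤ.- c)) (coeff-neg P m)) (sym (ℤ.neg-distrib-+ c _))
  ... | false = coeff-neg P m

  infixr 7 _·_
  _·_ : ℤ × Mono → LP → LP
  (c , m) · Q = map (λ { (c′ , m′) → (c ℤ.* c′ , m ++ m′) }) Q

  *L-∷ : ∀ t P Q → (t ∷ P) *L Q ≡ t · Q ++ P *L Q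
  *L-∷ (c , m) P Q = cong (_++ P *L Q) (map-cong (λ _ → refl) Q)

  -- `m₁ ++ m′` matches `m` exactly when `m′` matches `m ÷ m₁`. Exponents are integers, so the
  -- quotient always exists and no divisibility condition appears.
  coeff-· : ∀ c m₁ Q m → coeff ((c , m₁) · Q) m ≡ c ℤ.* coeff Q (m ÷ m₁)
  coeff-· c m₁ [] m = sym (ℤ.*-zeroʳ c)
  coeff-· c m₁ ((c′ , m′) ∷ Q) m = begin
    coeff ((c ℤ.* c′ , m₁ ++ m′) ∷ (c , m₁) · Q) m
      ≡⟨ coeff-∷ (c ℤ.* c′) (m₁ ++ m′) ((c , m₁) · Q) m ⟩
    indicatorℤ (sameMono (m₁ ++ m′) m) (c ℤ.* c′) ℤ.+ coeff ((c , m₁) · Q) m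
      ≡⟨ cong₂ ℤ._+_ (trans (cong (λ b → indicatorℤ b (c ℤ.* c′)) shift) (pull (sameMono m′ (m ÷ m₁)))) (coeff-· c m₁ Q m) ⟩
    c ℤ.* indicatorℤ (sameMono m′ (m ÷ m₁)) c′ ℤ.+ c ℤ.* coeff Q (m ÷ m₁)
      ≡⟨ sym (ℤ.*-distribˡ-+ c _ _) ⟩
    c ℤ.* (indicatorℤ (sameMono m′ (m ÷ m₁)) c′ ℤ.+ coeff Q (m ÷ m₁))
      ≡⟨ cong (c ℤ.*_) (sym (coeff-∷ c′ m′ Q (m ÷ m₁))) ⟩
    c ℤ.* coeff ((c′ , m′) ∷ Q) (m ÷ m₁) ∎
    where
    open ≡-Reasoning
    pull : ∀ b → indicatorℤ b (c ℤ.* c′) ≡ c ℤ.* indicatorℤ b c′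
    pull true = refl
    pull false = sym (ℤ.*-zeroʳ c)
    move : ∀ a b d → a ℤ.+ b ≡ d → b ≡ d ℤ.- a
    move a b d refl = trans (sym (ℤ.+-identityʳ b)) (trans (cong (ℤ._+_ (b)) (sym (ℤ.+-inverseʳ a)))
      (trans (sym (ℤ.+-assoc b a _)) (cong (ℤ._- a) (ℤ.+-comm b a))))
    unmove : ∀ a b d → b ≡ d ℤ.- a → a ℤ.+ b ≡ d
    unmove a b d refl = trans (ℤ-+-left-comm a d _) (trans (cong (λ e → d ℤ.+ e) (ℤ.+-inverseʳ a)) (ℤ.+-identityʳ d))
    shift : sameMono (m₁ ++ m′) m ≡ sameMono m′ (m ÷ m₁)
    shift = sameMono-⇔ {m₁ ++ m′} {m} {m′} {m ÷ m₁}
      (λ p v → trans (move _ _ _ (trans (sym (expOf-++ v m₁ m′)) (p v))) (sym (expOf-÷ v m m₁)))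
      (λ p v → trans (expOf-++ v m₁ m′) (unmove _ _ _ (trans (p v) (expOf-÷ v m m₁))))

  coeff-*∷ : ∀ c m₁ P Q m → coeff (((c , m₁) ∷ P) *L Q) m ≡ c ℤ.* coeff Q (m ÷ m₁) ℤ.+ coeff (P *L Q) m
  coeff-*∷ c m₁ P Q m = trans (cong (λ R → coeff R m) (*L-∷ (c , m₁) P Q))
    (trans (coeff-++ ((c , m₁) · Q) _ m) (cong (ℤ._+ coeff (P *L Q) m) (coeff-· c m₁ Q m)))

  *L-congʳ : ∀ P {Q Q′} → Q ≈ Q′ → P *L Q ≈ P *L Q′
  *L-congʳ [] Q≈Q′ m = refl
  *L-congʳ ((c , m₁) ∷ P) {Q} {Q′} Q≈Q′ m = trans (coeff-*∷ c m₁ P Q m)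
    (trans (cong₂ (λ a b → c ℤ.* a ℤ.+ b) (Q≈Q′ (m ÷ m₁)) (*L-congʳ P {Q} {Q′} Q≈Q′ m)) (sym (coeff-*∷ c m₁ P Q′ m)))

  *L-distribˡ : ∀ P Q R → P *L (Q +L R) ≈ P *L Q +L P *L R
  *L-distribˡ [] Q R m = refl
  *L-distribˡ ((c , m₁) ∷ P) Q R m = begin
    coeff (((c , m₁) ∷ P) *L (Q +L R)) m
      ≡⟨ coeff-*∷ c m₁ P (Q +L R) m ⟩
    c ℤ.* coeff (Q +L R) (m ÷ m₁) ℤ.+ coeff (P *L (Q +L R)) m
      ≡⟨ cong₂ ℤ._+_ (trans (cong (c ℤ.*_) (coeff-++ Q R _)) (ℤ.*-distribˡ-+ c _ _))
           (trans (*L-distribˡ P Q R m) (coeff-++ (P *L Q) _ m)) ⟩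
    (c ℤ.* coeff Q (m ÷ m₁) ℤ.+ c ℤ.* coeff R (m ÷ m₁)) ℤ.+ (coeff (P *L Q) m ℤ.+ coeff (P *L R) m)
      ≡⟨ ℤ-+-interchange (c ℤ.* coeff Q (m ÷ m₁)) _ _ _ ⟩
    (c ℤ.* coeff Q (m ÷ m₁) ℤ.+ coeff (P *L Q) m) ℤ.+ (c ℤ.* coeff R (m ÷ m₁) ℤ.+ coeff (P *L R) m)
      ≡⟨ sym (cong₂ ℤ._+_ (coeff-*∷ c m₁ P Q m) (coeff-*∷ c m₁ P R m)) ⟩
    coeff (((c , m₁) ∷ P) *L Q) m ℤ.+ coeff (((c , m₁) ∷ P) *L R) m
      ≡⟨ sym (coeff-++ (((c , m₁) ∷ P) *L Q) _ m) ⟩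
    coeff (((c , m₁) ∷ P) *L Q +L ((c , m₁) ∷ P) *L R) m ∎
    where open ≡-Reasoning

  *L-zeroʳ : ∀ P → P *L 0L ≡ 0L
  *L-zeroʳ [] = refl
  *L-zeroʳ (t ∷ P) = *L-zeroʳ P

  singleton-comm : ∀ P t → P *L (t ∷ []) ≈ t · P
  singleton-comm [] t m = refl
  singleton-comm ((c , m₁) ∷ P) (c′ , m′) m = trans (coeff-∷ (c ℤ.* c′) (m₁ ++ m′) (P *L ((c′ , m′) ∷ [])) m) (trans
    (cong₂ ℤ._+_
      (cong₂ indicatorℤ
        (sameMono-⇔ {m₁ ++ m′} {m} {m′ ++ m₁} {m}
          (λ p v → trans (++-comm-~ m′ m₁ v) (p v)) (λ p v → trans (++-comm-~ m₁ m′ v) (p v)))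
        (ℤ.*-comm c c′))
      (singleton-comm P (c′ , m′) m))
    (sym (coeff-∷ (c′ ℤ.* c) (m′ ++ m₁) ((c′ , m′) · P) m)))

  *L-comm : ∀ P Q → P *L Q ≈ Q *L P
  *L-comm P [] m = cong (λ R → coeff R m) (*L-zeroʳ P)
  *L-comm P (t ∷ Q) m = begin
    coeff (P *L ((t ∷ []) +L Q)) m
      ≡⟨ *L-distribˡ P (t ∷ []) Q m ⟩
    coeff (P *L (t ∷ []) +L P *L Q) m
      ≡⟨ coeff-++ (P *L (t ∷ [])) _ m ⟩
    coeff (P *L (t ∷ [])) m ℤ.+ coeff (P *L Q) m
      ≡⟨ cong₂ ℤ._+_ (singleton-comm P t m) (*L-comm P Q m) ⟩
    coeff (t · P) m ℤ.+ coeff (Q *L P) m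
      ≡⟨ sym (coeff-++ (t · P) _ m) ⟩
    coeff (t · P +L Q *L P) m
      ≡⟨ cong (λ R → coeff R m) (sym (*L-∷ t Q P)) ⟩
    coeff ((t ∷ Q) *L P) m ∎
    where open ≡-Reasoning

  ·-*L : ∀ t Q R → (t · Q) *L R ≡ t · (Q *L R)
  ·-*L t [] R = refl
  ·-*L t@(c , m) (q@(c′ , m′) ∷ Q) R = begin
    (t · (q ∷ Q)) *L R
      ≡⟨ *L-∷ (c ℤ.* c′ , m ++ m′) (t · Q) R ⟩
    (c ℤ.* c′ , m ++ m′) · R ++ (t · Q) *L R
      ≡⟨ cong₂ _++_ (trans (map-cong (λ { (c″ , m″) → cong₂ _,_ (ℤ.*-assoc c c′ c″) (++-assoc m m′ m″) }) R) (map-∘ R))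
           (·-*L t Q R) ⟩
    t · (q · R) ++ t · (Q *L R)
      ≡⟨ sym (map-++ _ (q · R) _) ⟩
    t · (q · R ++ Q *L R)
      ≡⟨ cong (t ·_) (sym (*L-∷ q Q R)) ⟩
    t · ((q ∷ Q) *L R) ∎
    where open ≡-Reasoning

  *L-assoc : ∀ P Q R → (P *L Q) *L R ≡ P *L (Q *L R)
  *L-assoc [] Q R = refl
  *L-assoc (t ∷ P) Q R = begin
    ((t ∷ P) *L Q) *L R            ≡⟨ cong (_*L R) (*L-∷ t P Q) ⟩
    (t · Q ++ P *L Q) *L R         ≡⟨ concatMap-++ _ (t · Q) (P *L Q) ⟩
    (t · Q) *L R ++ (P *L Q) *L R  ≡⟨ cong₂ _++_ (·-*L t Q R) (*L-assoc P Q R) ⟩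
    t · (Q *L R) ++ P *L (Q *L R)  ≡⟨ sym (*L-∷ t P (Q *L R)) ⟩
    (t ∷ P) *L (Q *L R) ∎
    where open ≡-Reasoning

  *L-identityˡ : ∀ P → 1L *L P ≡ P
  *L-identityˡ P = trans (*L-∷ (1ℤ , []) [] P) (trans (++-identityʳ _)
    (trans (map-cong (λ { (c , m) → cong (_, m) (ℤ.*-identityˡ c) }) P) (map-id P)))

  -- The equality _≈_ of Defs as a record: unlike the function type it unfolds to, this determines
  -- its two sides.
  infix 4 _≃_
  record _≃_ (P Q : LP) : Set where
    constructor mk≃
    field coeffs : P ≈ Q
  open _≃_ public

  ≡⇒≃ : ∀ {P Q} → P ≡ Q → P ≃ Q
  ≡⇒≃ refl = mk≃ λ m → refl

  LP-commutativeRing : CommutativeRing 0ℓ 0ℓ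
  LP-commutativeRing = record
    { Carrier = LP ; _≈_ = _≃_ ; _+_ = _+L_ ; _*_ = _*L_ ; -_ = negL ; 0# = 0L ; 1# = 1L
    ; isCommutativeRing = record
      { isRing = record
        { +-isAbelianGroup = record
          { isGroup = record
            { isMonoid = record
              { isSemigroup = record
                { isMagma = record
                  { isEquivalence = record
                    { refl = ≡⇒≃ refl
                    ; sym = λ (mk≃ p) → mk≃ λ m → sym (p m)
                    ; trans = λ (mk≃ p) (mk≃ q) → mk≃ λ m → trans (p m) (q m) }
                  ; ∙-cong = λ {P} {P′} {Q} {Q′} (mk≃ p) (mk≃ q) → mk≃ λ m → trans (coeff-++ P Q m)
                      (trans (cong₂ ℤ._+_ (p m) (q m)) (sym (coeff-++ P′ Q′ m))) }
                ; assoc = λ P Q R → ≡⇒≃ (++-assoc P Q R) }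
              ; identity = (λ P → ≡⇒≃ refl) , λ P → ≡⇒≃ (++-identityʳ P) }
            ; inverse = (λ P → mk≃ λ m → trans (coeff-++ (negL P) P m)
                          (trans (cong (ℤ._+ coeff P m) (coeff-neg P m)) (ℤ.+-inverseˡ (coeff P m))))
                      , (λ P → mk≃ λ m → trans (coeff-++ P (negL P) m)
                          (trans (cong (ℤ._+_ (coeff P m)) (coeff-neg P m)) (ℤ.+-inverseʳ (coeff P m))))
            ; ⁻¹-cong = λ {P} {Q} (mk≃ p) → mk≃ λ m →
                trans (coeff-neg P m) (trans (cong ℤ.-_ (p m)) (sym (coeff-neg Q m))) }
          ; comm = λ P Q → mk≃ λ m →
              trans (coeff-++ P Q m) (trans (ℤ.+-comm (coeff P m) _) (sym (coeff-++ Q P m))) }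
        ; *-cong = λ {P} {P′} {Q} {Q′} (mk≃ p) (mk≃ q) → mk≃ λ m → trans (*L-congʳ P {Q} {Q′} q m)
            (trans (*L-comm P Q′ m) (trans (*L-congʳ Q′ {P} {P′} p m) (*L-comm Q′ P′ m)))
        ; *-assoc = λ P Q R → ≡⇒≃ (*L-assoc P Q R)
        ; *-identity = (λ P → ≡⇒≃ (*L-identityˡ P))
                     , λ P → mk≃ λ m → trans (*L-comm P 1L m) (cong (λ S → coeff S m) (*L-identityˡ P))
        ; distrib = (λ P Q R → mk≃ (*L-distribˡ P Q R)) , λ R P Q → ≡⇒≃ (concatMap-++ _ P Q) }
      ; *-comm = λ P Q → mk≃ (*L-comm P Q) } }

  open CommutativeRing LP-commutativeRing using ()
    renaming (setoid to LP-setoid; ring to LP-ring)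
  open Algebra.Properties.Ring LP-ring using (x[y-z]≈xy-xz; [y-z]x≈yx-zx; x∙y⁻¹≈ε⇒x≈y)

  -- A condition on the listed terms and so not invariant under `_≃_`: two cancelling terms with t
  -- violate it. `TLinear` makes up for this by fixing s only up to `_≃_`.
  TFree : LP → Set
  TFree = All λ { (c , m) → expOf tv m ≡ 0ℤ }

  tFree-* : ∀ {P Q} → TFree P → TFree Q → TFree (P *L Q)
  tFree-* [] Q-free = []
  tFree-* {(c , m) ∷ P} {Q} (m-free ∷ P-free) Q-free = subst TFree (sym (*L-∷ (c , m) P Q))
    (All.++⁺ (All.map⁺ (All.map (λ {t} p → trans (expOf-++ tv m (proj₂ t)) (cong₂ ℤ._+_ m-free p)) Q-free))
             (tFree-* P-free Q-free))

  tFree-monoL : ∀ {m} → expOf tv m ≡ 0ℤ → TFree (monoL m)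
  tFree-monoL p = p ∷ []

  TLinear : LP → Set
  TLinear s = ∃[ e ] (TFree e × s ≃ tL -L e)

  tLinear-shift : ∀ {s e} → TLinear s → TFree e → TLinear (s -L e)
  tLinear-shift {s} {e} (f , f-free , mk≃ s≈) e-free = f +L e , All.++⁺ f-free e-free , mk≃ λ m → begin
    coeff (s -L e) m
      ≡⟨ coeff-++ s (negL e) m ⟩
    coeff s m ℤ.+ coeff (negL e) m
      ≡⟨ cong (ℤ._+ coeff (negL e) m) (s≈ m) ⟩
    coeff (tL -L f) m ℤ.+ coeff (negL e) m
      ≡⟨ sym (coeff-++ (tL -L f) (negL e) m) ⟩
    coeff ((tL -L f) -L e) m
      ≡⟨ cong (λ P → coeff P m) (trans (++-assoc tL (negL f) (negL e)) (cong (tL ++_) (sym (map-++ _ f e)))) ⟩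
    coeff (tL -L (f +L e)) m ∎
    where open ≡-Reasoning

  degree-bound : ∀ P → ∃[ B ] (∀ m → B ℤ.≤ expOf tv m → coeff P m ≡ 0ℤ)
  degree-bound [] = 0ℤ , λ _ _ → refl
  degree-bound ((c , m′) ∷ P) with degree-bound P
  ... | B , bound = ℤ.suc (expOf tv m′) ℤ.⊔ B , vanish
    where
    vanish : ∀ m → ℤ.suc (expOf tv m′) ℤ.⊔ B ℤ.≤ expOf tv m → coeff ((c , m′) ∷ P) m ≡ 0ℤ
    vanish m B′≤m with sameMono m′ m in eq
    ... | false = bound m (ℤ.≤-trans (ℤ.i≤j⊔i (ℤ.suc (expOf tv m′)) B) B′≤m)
    ... | true = contradiction
      (ℤ.suc[i]≤j⇒i<j (ℤ.≤-trans (ℤ.i≤i⊔j (ℤ.suc (expOf tv m′)) B) B′≤m))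
      (ℤ.<-irrefl (sameMono-sound m′ m eq tv))

  tFree-*-vanishes : ∀ {e d} m → TFree e →
    (∀ m₁ → expOf tv m₁ ≡ 0ℤ → coeff d (m ÷ m₁) ≡ 0ℤ) → coeff (e *L d) m ≡ 0ℤ
  tFree-*-vanishes m [] h = refl
  tFree-*-vanishes {(c , m₁) ∷ e} {d} m (p ∷ e-free) h = trans (coeff-*∷ c m₁ e d m)
    (cong₂ ℤ._+_ (trans (cong (c ℤ.*_) (h m₁ p)) (ℤ.*-zeroʳ c)) (tFree-*-vanishes {e} {d} m e-free h))

  i≤∣i∣ : ∀ i → i ℤ.≤ + ℤ.∣ i ∣
  i≤∣i∣ (+ n) = ℤ.≤-refl
  i≤∣i∣ ℤ.-[1+ n ] = ℤ.-≤+

  -- Coefficients of d are carried by t to higher t-degree, where eventually everything vanishes.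
  t*d≃e*d⇒d≃0 : ∀ {e d} → TFree e → tL *L d ≃ e *L d → d ≃ 0L
  t*d≃e*d⇒d≃0 {e} {d} e-free (mk≃ td≈ed) with degree-bound d
  ... | B , bound = mk≃ λ m → vanish ℤ.∣ B ℤ.- expOf tv m ∣ m
          (subst (ℤ._≤ expOf tv m ℤ.+ + ℤ.∣ B ℤ.- expOf tv m ∣) (cancel B (expOf tv m))
            (ℤ.+-monoʳ-≤ (expOf tv m) (i≤∣i∣ (B ℤ.- expOf tv m))))
    where
    cancel : ∀ a b → b ℤ.+ (a ℤ.- b) ≡ a
    cancel a b = trans (ℤ-+-left-comm b a _) (trans (cong (ℤ._+_ a) (ℤ.+-inverseʳ b)) (ℤ.+-identityʳ a))
    t : Mono
    t = (tv , 1ℤ) ∷ []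
    -- `n` bounds how far the t-degree of `m` lies below the bound `B`. Multiplying by t raises the
    -- degree by one, and multiplying by the t-free e leaves it unchanged, so each step reduces to
    -- coefficients one degree closer to `B`.
    vanish : ∀ n m → B ℤ.≤ expOf tv m ℤ.+ + n → coeff d m ≡ 0ℤ
    vanish zero m B≤m = bound m (subst (B ℤ.≤_) (ℤ.+-identityʳ _) B≤m)
    vanish (suc n) m B≤m = begin
      coeff d m
        ≡⟨ coeff-cong d (λ v → sym (m+t-t v)) ⟩
      coeff d ((m ++ t) ÷ t)
        ≡⟨ sym (trans (ℤ.+-identityʳ _) (ℤ.*-identityˡ _)) ⟩
      1ℤ ℤ.* coeff d ((m ++ t) ÷ t) ℤ.+ 0ℤ
        ≡⟨ sym (coeff-*∷ 1ℤ t [] d (m ++ t)) ⟩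
      coeff (tL *L d) (m ++ t)
        ≡⟨ td≈ed (m ++ t) ⟩
      coeff (e *L d) (m ++ t)
        ≡⟨ tFree-*-vanishes {e} {d} (m ++ t) e-free (λ m₁ m₁-free → vanish n _ (subst (B ℤ.≤_) (raise m₁ m₁-free) B≤m)) ⟩
      0ℤ ∎
      where
      open ≡-Reasoning
      m+t-t : ∀ v → expOf v ((m ++ t) ÷ t) ≡ expOf v m
      m+t-t v = trans (expOf-÷ v (m ++ t) t) (trans (cong (ℤ._- expOf v t) (expOf-++ v m t))
        (trans (ℤ.+-assoc (expOf v m) _ _) (trans (cong (ℤ._+_ (expOf v m)) (ℤ.+-inverseʳ (expOf v t))) (ℤ.+-identityʳ _))))
      raise : ∀ m₁ → expOf tv m₁ ≡ 0ℤ → expOf tv m ℤ.+ + suc n ≡ expOf tv ((m ++ t) ÷ m₁) ℤ.+ + n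
      raise m₁ p = sym (trans (cong (ℤ._+ + n) (trans (expOf-÷ tv (m ++ t) m₁)
        (trans (cong₂ ℤ._-_ (expOf-++ tv m t) p) (ℤ.+-identityʳ (expOf tv m ℤ.+ 1ℤ))))) (ℤ.+-assoc (expOf tv m) 1ℤ (+ n)))

  tLinear-regular : ∀ {s} → TLinear s → ∀ {P Q} → s *L P ≃ s *L Q → P ≃ Q
  tLinear-regular {s} (e , e-free , s≈) {P} {Q} sP≈sQ = x∙y⁻¹≈ε⇒x≈y P Q (t*d≃e*d⇒d≃0 {e} {d} e-free
    (x∙y⁻¹≈ε⇒x≈y (tL *L d) (e *L d) (begin
      tL *L d -L e *L d  ≈⟨ [y-z]x≈yx-zx d tL e ⟨
      (tL -L e) *L d     ≈⟨ *-congʳ {d} {s} {tL -L e} s≈ ⟨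
      s *L d             ≈⟨ x[y-z]≈xy-xz s P Q ⟩
      s *L P -L s *L Q   ≈⟨ +-congʳ {negL (s *L Q)} {s *L P} {s *L Q} sP≈sQ ⟩
      s *L Q -L s *L Q   ≈⟨ -‿inverseʳ (s *L Q) ⟩
      0L                 ∎)))
    where
    open CommutativeRing LP-commutativeRing using (*-congʳ; +-congʳ; -‿inverseʳ)
    open import Relation.Binary.Reasoning.Setoid LP-setoid
    d = P -L Q

-- Faces in an interval of integers as points of the Boolean cube.

module Embeddings where
  open import Defs
  open Laplacians
  open import Algebra.Bundles using (CommutativeMonoid)
  import Algebra.Properties.CommutativeSemigroup
  open import Data.Bool using (Bool; true; false; _∨_; if_then_else_)
  import Data.Bool.Properties as Bool
  open import Data.Bool.ListAction using (any)
  open import Data.Nat as ℕ using (ℕ; zero; suc)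
  open import Data.Integer as ℤ using (ℤ; +_; 1ℤ)
  import Data.Integer.Properties as ℤ
  open import Data.Fin as Fin using (Fin; zero; suc; toℕ; _↑ˡ_; _↑ʳ_)
  open import Data.List as List using (List; []; _∷_; _++_; length)
  open import Data.List.Properties using (∷-injectiveʳ)
  open import Data.List.Membership.Propositional using (_∈_; _∉_)
  open import Data.List.Relation.Unary.Any using (here; there)
  open import Data.List.Relation.Unary.All as All using (All; []; _∷_)
  open import Data.List.Relation.Unary.AllPairs using ([]; _∷_)
  open import Data.List.Relation.Unary.Unique.Propositional using (Unique)
  open import Data.List.Relation.Unary.Linked using ([]; [-]; _∷_)
  open import Data.Product using (_×_; _,_; ∃-syntax)
  open import Data.Vec as Vec using (Vec; []; _∷_; lookup; _[_]≔_)
  open import Function using (_∘_)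
  open import Level using (0ℓ)
  open import Relation.Binary.PropositionalEquality as ≡
    using (_≡_; _≢_; refl; sym; trans; cong; subst)
  open import Relation.Nullary using (yes; no; contradiction)

  v<next : ∀ v → v ℤ.< next v
  v<next v = subst (v ℤ.<_) (ℤ.+-comm 1ℤ v) (ℤ.suc[i]≤j⇒i<j ℤ.≤-refl)

  next≤⇒< : ∀ {v u} → next v ℤ.≤ u → v ℤ.< u
  next≤⇒< {v} = ℤ.<-≤-trans (v<next v)

  <⇒next≤ : ∀ {v u} → v ℤ.< u → next v ℤ.≤ u
  <⇒next≤ {v} v<u = subst (ℤ._≤ _) (ℤ.+-comm 1ℤ v) (ℤ.i<j⇒suc[i]≤j v<u)

  embed : ∀ {n} → ℤ → Vec Bool n → Face
  embed v [] = []
  embed v (true ∷ F) = v ∷ embed (next v) F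
  embed v (false ∷ F) = embed (next v) F

  embed-≥ : ∀ {n} v (F : Vec Bool n) → All (v ℤ.≤_) (embed v F)
  embed-> : ∀ {n} v (F : Vec Bool n) → All (v ℤ.<_) (embed (next v) F)
  embed-≥ v [] = []
  embed-≥ v (true ∷ F) = ℤ.≤-refl ∷ All.map ℤ.<⇒≤ (embed-> v F)
  embed-≥ v (false ∷ F) = All.map ℤ.<⇒≤ (embed-> v F)
  embed-> v F = All.map next≤⇒< (embed-≥ (next v) F)

  ∷-strict : ∀ {v A} → All (v ℤ.<_) A → StrictInc A → StrictInc (v ∷ A)
  ∷-strict [] _ = [-]
  ∷-strict (v<a ∷ _) A-strict = v<a ∷ A-strict

  embed-strict : ∀ {n} v (F : Vec Bool n) → StrictInc (embed v F)
  embed-strict v [] = []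
  embed-strict v (true ∷ F) = ∷-strict (embed-> v F) (embed-strict (next v) F)
  embed-strict v (false ∷ F) = embed-strict (next v) F

  eqFace-refl : ∀ A → eqFace A A ≡ true
  eqFace-refl [] = refl
  eqFace-refl (a ∷ A) with a ℤ.≟ a
  ... | yes _ = eqFace-refl A
  ... | no a≢a = contradiction refl a≢a

  eqFace-sound : ∀ A B → eqFace A B ≡ true → A ≡ B
  eqFace-sound [] [] _ = refl
  eqFace-sound (a ∷ A) (b ∷ B) p with a ℤ.≟ b | p
  ... | yes refl | q = cong (a ∷_) (eqFace-sound A B q)

  eqFace-≢ : ∀ {A B} → A ≢ B → eqFace A B ≡ false
  eqFace-≢ {A} {B} A≢B with eqFace A B in eq
  ... | true = contradiction (eqFace-sound A B eq) A≢B
  ... | false = refl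

  any-sound : ∀ A 𝓛 → any (eqFace A) 𝓛 ≡ true → A ∈ 𝓛
  any-sound A (B ∷ 𝓛) p with eqFace A B in eq | p
  ... | true | _ = here (eqFace-sound A B eq)
  ... | false | q = there (any-sound A 𝓛 q)

  any-complete : ∀ {A 𝓛} → A ∈ 𝓛 → any (eqFace A) 𝓛 ≡ true
  any-complete {A} (here refl) rewrite eqFace-refl A = refl
  any-complete {A} {B ∷ 𝓛} (there A∈) rewrite any-complete A∈ = Bool.∨-zeroʳ (eqFace A B)

  any-∉ : ∀ {A 𝓛} → A ∉ 𝓛 → any (eqFace A) 𝓛 ≡ false
  any-∉ {A} {𝓛} A∉ with any (eqFace A) 𝓛 in eq
  ... | true = contradiction (any-sound A 𝓛 eq) A∉
  ... | false = refl

  embed-≢-∷ : ∀ {n} v (F : Vec Bool n) {A} → embed (next v) F ≢ v ∷ A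
  embed-≢-∷ v F eq with embed (next v) F | embed-> v F
  embed-≢-∷ v F refl | _ | v<v ∷ _ = ℤ.<-irrefl refl v<v

  embed-injective : ∀ {n} v (F G : Vec Bool n) → embed v F ≡ embed v G → F ≡ G
  embed-injective v [] [] _ = refl
  embed-injective v (true ∷ F) (true ∷ G) eq = cong (true ∷_) (embed-injective (next v) F G (∷-injectiveʳ eq))
  embed-injective v (true ∷ F) (false ∷ G) eq = contradiction (sym eq) (embed-≢-∷ v G)
  embed-injective v (false ∷ F) (true ∷ G) eq = contradiction eq (embed-≢-∷ v F)
  embed-injective v (false ∷ F) (false ∷ G) eq = cong (false ∷_) (embed-injective (next v) F G eq)

  -- The first integer beyond n vertices starting at v. The recursion follows `next`, so dropping
  -- the base vertex leaves `top` unchanged definitionally.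
  top : ℕ → ℤ → ℤ
  top zero v = v
  top (suc n) v = top n (next v)

  top≡ : ∀ n v → top n v ≡ v ℤ.+ + n
  top≡ zero v = sym (ℤ.+-identityʳ v)
  top≡ (suc n) v = trans (top≡ n (next v)) (ℤ.+-assoc v 1ℤ (+ n))

  v≤top : ∀ n v → v ℤ.≤ top n v
  v≤top n v = subst (v ℤ.≤_) (sym (top≡ n v)) (ℤ.i≤i+j v (+ n))

  embed-surjective : ∀ n v A → StrictInc A → All (v ℤ.≤_) A → All (ℤ._< top n v) A →
    ∃[ F ] embed {n} v F ≡ A
  embed-surjective zero v [] _ _ _ = [] , refl
  embed-surjective zero v (a ∷ A) _ (v≤a ∷ _) (a<v ∷ _) = contradiction (ℤ.≤-<-trans v≤a a<v) (ℤ.<-irrefl refl)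
  embed-surjective (suc n) v [] _ _ _ with embed-surjective n (next v) [] [] [] []
  ... | F , eq = false ∷ F , eq
  embed-surjective (suc n) v (a ∷ A) A-strict (v≤a ∷ v≤A) a∷A< with a ℤ.≟ v
  ... | yes refl with embed-surjective n (next v) A (tail-strict A-strict) (All.map <⇒next≤ (head-< A-strict)) (All.tail a∷A<)
    where
    tail-strict : ∀ {a A} → StrictInc (a ∷ A) → StrictInc A
    tail-strict [-] = []
    tail-strict (_ ∷ s) = s
    head-< : ∀ {a A} → StrictInc (a ∷ A) → All (a ℤ.<_) A
    head-< [-] = []
    head-< (a<b ∷ s) = a<b ∷ All.map (ℤ.<-trans a<b) (head-< s)
  ...   | F , eq = true ∷ F , cong (v ∷_) eq
  embed-surjective (suc n) v (a ∷ A) A-strict (v≤a ∷ v≤A) a∷A< | no a≢v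
    with embed-surjective n (next v) (a ∷ A) A-strict (All.map <⇒next≤ (above A-strict (ℤ.≤∧≢⇒< v≤a (a≢v ∘ sym)))) a∷A<
    where
    above : ∀ {a A} → StrictInc (a ∷ A) → v ℤ.< a → All (v ℤ.<_) (a ∷ A)
    above [-] v<a = v<a ∷ []
    above (a<b ∷ s) v<a = v<a ∷ above s (ℤ.<-trans v<a a<b)
  ...   | F , eq = false ∷ F , eq

  ∈-embed⁺ : ∀ {n} v (F : Vec Bool n) t → lookup F t ≡ true → v ℤ.+ + toℕ t ∈ embed v F
  ∈-embed⁺ v (true ∷ F) zero _ = here (ℤ.+-identityʳ v)
  ∈-embed⁺ v (b ∷ F) (suc t) p with subst (_∈ embed (next v) F) (ℤ.+-assoc v 1ℤ (+ toℕ t)) (∈-embed⁺ (next v) F t p)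
  ∈-embed⁺ v (true ∷ F) (suc t) p | q = there q
  ∈-embed⁺ v (false ∷ F) (suc t) p | q = q

  ∈-embed⁻ : ∀ {n} v (F : Vec Bool n) {u} → u ∈ embed v F → ∃[ t ] (lookup F t ≡ true × u ≡ v ℤ.+ + toℕ t)
  ∈-embed⁻ v (true ∷ F) (here refl) = zero , refl , sym (ℤ.+-identityʳ v)
  ∈-embed⁻ v (true ∷ F) (there u∈) with ∈-embed⁻ (next v) F u∈
  ... | t , p , q = suc t , p , trans q (ℤ.+-assoc v 1ℤ (+ toℕ t))
  ∈-embed⁻ v (false ∷ F) u∈ with ∈-embed⁻ (next v) F u∈
  ... | t , p , q = suc t , p , trans q (ℤ.+-assoc v 1ℤ (+ toℕ t))

  length-insert : ∀ {n} v (F : Vec Bool n) t → lookup F t ≡ false →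
    length (embed v (F [ t ]≔ true)) ≡ suc (length (embed v F))
  length-insert v (false ∷ F) zero _ = refl
  length-insert v (true ∷ F) (suc t) p = cong suc (length-insert (next v) F t p)
  length-insert v (false ∷ F) (suc t) p = length-insert (next v) F t p

  length-delete : ∀ {n} v (F : Vec Bool n) t → lookup F t ≡ true →
    suc (length (embed v (F [ t ]≔ false))) ≡ length (embed v F)
  length-delete v (true ∷ F) zero _ = refl
  length-delete v (true ∷ F) (suc t) p = cong suc (length-delete (next v) F t p)
  length-delete v (false ∷ F) (suc t) p = length-delete (next v) F t p

  encode : ∀ {n} → Vec Bool n → Fin (pow2 n)
  encode [] = zero
  encode {suc n} (true ∷ F) = encode F ↑ˡ pow2 n
  encode {suc n} (false ∷ F) = pow2 n ↑ʳ encode F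

  -- Over a general monoid because it is needed twice: additively for the entries of the Laplacian,
  -- and multiplicatively for the product over critical pairs.
  module Fold (M : CommutativeMonoid 0ℓ 0ℓ) where
    open CommutativeMonoid M renaming (_≈_ to _≐_; refl to ≈-refl; sym to ≈-sym; trans to ≈-trans)
    open Algebra.Properties.CommutativeSemigroup commutativeSemigroup using (interchange)

    listFold : ∀ {A : Set} → (A → Carrier) → List A → Carrier
    listFold f xs = List.foldr _∙_ ε (List.map f xs)

    cubeFold : ∀ {n} → (Vec Bool n → Carrier) → Carrier
    cubeFold {zero} f = f []
    cubeFold {suc n} f = cubeFold (λ F → f (true ∷ F)) ∙ cubeFold (λ F → f (false ∷ F))

    listFold-++ : ∀ {A : Set} (f : A → Carrier) xs ys → listFold f (xs ++ ys) ≐ listFold f xs ∙ listFold f ys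
    listFold-++ f [] ys = ≈-sym (identityˡ _)
    listFold-++ f (x ∷ xs) ys = ≈-trans (∙-congˡ (listFold-++ f xs ys)) (≈-sym (assoc _ _ _))

    listFold-concatMap : ∀ {A B : Set} (f : B → Carrier) (g : A → List B) xs →
      listFold f (List.concatMap g xs) ≐ listFold (λ x → listFold f (g x)) xs
    listFold-concatMap f g [] = ≈-refl
    listFold-concatMap f g (x ∷ xs) = ≈-trans (listFold-++ f (g x) _) (∙-congˡ (listFold-concatMap f g xs))

    listFold-cong : ∀ {A : Set} {f g : A → Carrier} → (∀ x → f x ≐ g x) → ∀ xs → listFold f xs ≐ listFold g xs
    listFold-cong f≈g [] = ≈-refl
    listFold-cong f≈g (x ∷ xs) = ∙-cong (f≈g x) (listFold-cong f≈g xs)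

    listFold-map : ∀ {A B : Set} (f : B → Carrier) (g : A → B) xs → listFold f (List.map g xs) ≐ listFold (f ∘ g) xs
    listFold-map f g [] = ≈-refl
    listFold-map f g (x ∷ xs) = ∙-congˡ (listFold-map f g xs)

    cubeFold-cong : ∀ {n} {f g : Vec Bool n → Carrier} → (∀ F → f F ≐ g F) → cubeFold f ≐ cubeFold g
    cubeFold-cong {zero} f≈g = f≈g []
    cubeFold-cong {suc n} f≈g = ∙-cong (cubeFold-cong (f≈g ∘ (true ∷_))) (cubeFold-cong (f≈g ∘ (false ∷_)))

    cubeFold-∙ : ∀ {n} (f g : Vec Bool n → Carrier) → cubeFold f ∙ cubeFold g ≐ cubeFold (λ F → f F ∙ g F)
    cubeFold-∙ {zero} f g = ≈-refl
    cubeFold-∙ {suc n} f g = ≈-trans (interchange _ _ _ _) (∙-cong (cubeFold-∙ {n} _ _) (cubeFold-∙ {n} _ _))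

    cubeFold-ε : ∀ {n} {f : Vec Bool n → Carrier} → (∀ F → f F ≐ ε) → cubeFold f ≐ ε
    cubeFold-ε {zero} f≈ε = f≈ε []
    cubeFold-ε {suc n} f≈ε = ≈-trans (∙-cong (cubeFold-ε (f≈ε ∘ (true ∷_))) (cubeFold-ε (f≈ε ∘ (false ∷_)))) (identityˡ ε)

    cubeFold-single : ∀ {n} v (f : Vec Bool n → Carrier) (G : Vec Bool n) →
      cubeFold (λ F → if eqFace (embed v F) (embed v G) then f F else ε) ≐ f G
    cubeFold-single v f [] = ≈-refl
    cubeFold-single {suc n} v f (true ∷ G) with v ℤ.≟ v
    ... | no v≢v = contradiction refl v≢v
    ... | yes _ = ≈-trans (∙-cong (cubeFold-single (next v) (f ∘ (true ∷_)) G)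
      (cubeFold-ε λ F → reflexive (cong (λ b → if b then f (false ∷ F) else ε) (eqFace-≢ (embed-≢-∷ v F)))))
      (identityʳ _)
    cubeFold-single {suc n} v f (false ∷ G) = ≈-trans (∙-cong
      (cubeFold-ε λ F → reflexive (cong (λ b → if b then f (true ∷ F) else ε) (eqFace-≢ (embed-≢-∷ v G ∘ sym))))
      (cubeFold-single (next v) (f ∘ (false ∷_)) G)) (identityˡ _)

    -- The head of the list becomes a fold supported at one point of the cube. Uniqueness keeps that
    -- point out of the support of the tail, so the two folds merge pointwise.
    listFold-cubeFold : ∀ n v (f : Face → Carrier) 𝓛 → Unique 𝓛 → All (λ A → ∃[ F ] embed {n} v F ≡ A) 𝓛 →
      listFold f 𝓛 ≐ cubeFold {n} (λ F → if any (eqFace (embed v F)) 𝓛 then f (embed v F) else ε)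
    listFold-cubeFold n v f [] _ _ = ≈-sym (cubeFold-ε {n} λ F → ≈-refl)
    listFold-cubeFold n v f (A ∷ 𝓛) (A∉ ∷ unique) ((G , refl) ∷ image) = ≈-trans
      (∙-cong (≈-sym (cubeFold-single v (f ∘ embed v) G)) (listFold-cubeFold n v f 𝓛 unique image))
      (≈-trans (cubeFold-∙ {n} _ _) (cubeFold-cong {n} merge))
      where
      merge : ∀ F →
        (if eqFace (embed v F) A then f (embed v F) else ε) ∙ (if any (eqFace (embed v F)) 𝓛 then f (embed v F) else ε)
          ≐ (if eqFace (embed v F) A ∨ any (eqFace (embed v F)) 𝓛 then f (embed v F) else ε)
      merge F with eqFace (embed v F) A in eq | any (eqFace (embed v F)) 𝓛 in eq′
      ... | true | false = identityʳ _
      ... | false | _ = identityˡ _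
      ... | true | true with eqFace-sound (embed v F) A eq
      ...   | embed≡A = contradiction refl (All.lookup A∉ (subst (_∈ 𝓛) embed≡A (any-sound (embed v F) 𝓛 eq′)))

-- The weighted boundary entries of the statement as entries of the recursive boundary.

module Weights where
  open import Defs hiding (Mat; det)
  open Determinants
  open Laplacians
  open LaurentPolynomials
  open Embeddings
  open import Algebra.Bundles using (CommutativeRing)
  import Algebra.Properties.Ring
  import Algebra.Properties.CommutativeSemigroup
  open import Data.Bool using (Bool; true; false; if_then_else_)
  open import Data.Nat as ℕ using (ℕ; zero; suc; _∸_)
  import Data.Nat.Properties as ℕ
  open import Data.Integer as ℤ using (ℤ; +_; 0ℤ; 1ℤ; -1ℤ)
  import Data.Integer.Properties as ℤ
  open import Data.Fin as Fin using (Fin; zero; suc; toℕ; _↑ˡ_; _↑ʳ_)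
  open import Data.List as List using (List; []; _∷_; _++_; map; allFin; tabulate)
  open import Data.List.Properties using (map-++; map-tabulate; concatMap-++; ++-assoc; ++-identityʳ)
  open import Data.List.Relation.Unary.All as All using (All; []; _∷_)
  open import Data.Product using (_,_)
  open import Data.Vec as Vec using (Vec; []; _∷_)
  open import Function using (_∘_)
  open import Relation.Binary.PropositionalEquality as ≡ using (_≡_; _≢_; cong; cong₂)
  open import Relation.Nullary using (yes; no; contradiction)
  open import Relation.Nullary.Decidable using (⌊_⌋)

  open CommutativeRing LP-commutativeRing using
    ( refl; sym; trans; reflexive; setoid; ring; +-congʳ; *-cong; *-congˡ; *-congʳ
    ; -‿cong; *-identityˡ; zeroˡ
    ; *-commutativeSemigroup)
  open Algebra.Properties.Ring ring using (-‿distribˡ-*)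
  open Algebra.Properties.CommutativeSemigroup *-commutativeSemigroup using (x∙yz≈y∙xz)
  open Determinant LP-commutativeRing

  signL≡sgn : ∀ k → signL k ≡ sgn k
  signL≡sgn zero = ≡.refl
  signL≡sgn (suc k) = cong negL (signL≡sgn k)

  sumL-allFin : ∀ {n} (f : Fin n → LP) → sumL (map f (allFin n)) ≡ ∑ f
  sumL-allFin f = ≡.trans (cong sumL (map-tabulate (λ i → i) f)) (≡.trans (go f) (≡.sym (∑≡sum f)))
    where
    go : ∀ {n} (f : Fin n → LP) → sumL (tabulate f) ≡ Sum.sum f
    go {zero} f = ≡.refl
    go {suc n} f = cong (f zero +L_) (go (f ∘ suc))

  det≃ : ∀ n (M : Mat n n) → Defs.det n M ≃ det M
  det≃ zero M = refl
  det≃ (suc n) M = trans (reflexive (sumL-allFin _)) (trans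
    (∑-cong λ k → *-cong (*-congʳ {M zero k} (reflexive (signL≡sgn (toℕ k)))) (det≃ n (minor M k)))
    (sym (det-laplace M)))

  charPoly-characteristic : ∀ n (M : Mat n n) → charPoly n M ≃ det (characteristic tL M)
  charPoly-characteristic n M = trans (det≃ n _) (det-cong {n} λ r c → +-congʳ {negL (M r c)} (diagonal r c))
    where
    diagonal : ∀ {n} (r c : Fin n) → (if ⌊ r Fin.≟ c ⌋ then tL else 0L) ≃ δ r c *L tL
    diagonal r c with r Fin.≟ c
    ... | yes ≡.refl = sym (trans (*-congʳ (reflexive (δ-refl r))) (*-identityˡ tL))
    ... | no r≢c = sym (trans (*-congʳ (reflexive (δ-≢ r≢c))) (zeroˡ tL))

  monoL-cong : ∀ {m m′} → m ~ m′ → monoL m ≃ monoL m′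
  monoL-cong {m} {m′} m~m′ = mk≃ λ p → ≡.trans (coeff-∷ 1ℤ m [] p) (≡.trans
    (cong (λ b → indicatorℤ b 1ℤ ℤ.+ 0ℤ) (sameMono-⇔ {m} {p} {m′} {p}
      (λ q → ~-trans {m′} {m} {p} (~-sym {m} {m′} m~m′) q) (λ q → ~-trans {m} {m′} {p} m~m′ q)))
    (≡.sym (coeff-∷ 1ℤ m′ [] p)))

  x x⁻¹ : ℕ → ℤ → LP
  x a v = monoL ((xv a v , 1ℤ) ∷ [])
  x⁻¹ a v = monoL ((xv a v , -1ℤ) ∷ [])

  x*x⁻¹ : ∀ a v → x a v *L x⁻¹ a v ≃ 1L
  x*x⁻¹ a v = monoL-cong {(xv a v , 1ℤ) ∷ (xv a v , -1ℤ) ∷ []} {[]} cancel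
    where
    cancel : (xv a v , 1ℤ) ∷ (xv a v , -1ℤ) ∷ [] ~ []
    cancel w with xv a v ==V w
    ... | true = ≡.refl
    ... | false = ≡.refl

  weighting : Weighting LP-commutativeRing
  weighting = record { x = x ; x⁻¹ = x⁻¹ ; x*x⁻¹ = x*x⁻¹ }

  open Laplacian LP-commutativeRing weighting public

  -- The signed incidence number, without weights: in `bdEntry` the monomial depends on the two
  -- faces only, not on the deleted position, and therefore factors out. `q` is the position at
  -- which the signs start.
  incidence : ℕ → Face → List Face → LP
  incidence q G Hs = sumL (map (λ { (r , H) → if eqFace H G then signL r else 0L }) (indexed q Hs))

  incidence-∷ : ∀ q f G Hs → incidence q (f ∷ G) (map (f ∷_) Hs) ≡ incidence q G Hs
  incidence-∷ q f G [] = ≡.refl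
  incidence-∷ q f G (H ∷ Hs) with f ℤ.≟ f
  ... | yes _ = cong ((if eqFace H G then signL q else 0L) +L_) (incidence-∷ (suc q) f G Hs)
  ... | no f≢f = contradiction ≡.refl f≢f

  incidence-≢ : ∀ q f G Hs → (∀ A → G ≢ f ∷ A) → incidence q G (map (f ∷_) Hs) ≡ 0L
  incidence-≢ q f G [] G≢ = ≡.refl
  incidence-≢ q f G (H ∷ Hs) G≢ rewrite eqFace-≢ {f ∷ H} {G} (λ eq → G≢ H (≡.sym eq)) =
    incidence-≢ (suc q) f G Hs G≢

  -- The origin of the minus sign in the upper left block: a smaller vertex in front shifts every
  -- deleted position by one.
  incidence-suc : ∀ q G Hs → incidence (suc q) G Hs ≡ negL (incidence q G Hs)
  incidence-suc q G [] = ≡.refl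
  incidence-suc q G (H ∷ Hs) with eqFace H G
  ... | true = ≡.trans (cong (negL (signL q) ++_) (incidence-suc (suc q) G Hs)) (≡.sym (map-++ _ (signL q) _))
  ... | false = incidence-suc (suc q) G Hs

  >⇒≢-∷ : ∀ {v F G} → All (v ℤ.<_) F → F ≢ v ∷ G
  >⇒≢-∷ (v<v ∷ _) ≡.refl = ℤ.<-irrefl ≡.refl v<v

  incidence-absent : ∀ q {v} G F → All (v ℤ.<_) F → incidence q (v ∷ G) (deletions F) ≡ 0L
  incidence-absent q G [] _ = ≡.refl
  incidence-absent q {v} G (f ∷ F) (v<f ∷ v<F) rewrite eqFace-≢ {F} {v ∷ G} (>⇒≢-∷ {G = G} v<F) =
    incidence-≢ (suc q) f (v ∷ G) (deletions F) λ { A ≡.refl → ℤ.<-irrefl ≡.refl v<f }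
  -- The exponents of ↑ᵃ(x_A) / ↑ᵃ⁺¹(x_B).
  ratio : ℕ → Face → Face → Mono
  ratio a A B = xMonoFrom (suc a) A ++ powMono -1ℤ (xMonoFrom (2 ℕ.+ a) B)

  raiseMonoN-xMonoFrom : ∀ k a F → raiseMonoN k (xMonoFrom a F) ≡ xMonoFrom (k ℕ.+ a) F
  raiseMonoN-xMonoFrom zero a F = ≡.refl
  raiseMonoN-xMonoFrom (suc k) a F = ≡.trans (cong raiseMono (raiseMonoN-xMonoFrom k a F)) (raise (k ℕ.+ a) F)
    where
    raise : ∀ a F → raiseMono (xMonoFrom a F) ≡ xMonoFrom (suc a) F
    raise a [] = ≡.refl
    raise a (f ∷ F) = cong ((xv (suc a) f , 1ℤ) ∷_) (raise (suc a) F)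

  bdEntry≡ : ∀ e i G F →
    bdEntry e i G F ≡ incidence 0 G (deletions F) *L monoL (ratio (e ∸ i) F G)
  bdEntry≡ e i G F = ≡.trans (go 0 (deletions F)) (cong (λ m → incidence 0 G (deletions F) *L monoL m)
    (cong₂ (λ m m′ → m ++ powMono -1ℤ m′)
      (≡.trans (raiseMonoN-xMonoFrom (e ∸ i) 1 F) (cong (λ k → xMonoFrom k F) (ℕ.+-comm (e ∸ i) 1)))
      (≡.trans (raiseMonoN-xMonoFrom (e ∸ i ℕ.+ 1) 1 G)
        (cong (λ k → xMonoFrom k G) (≡.trans (ℕ.+-assoc (e ∸ i) 1 1) (ℕ.+-comm (e ∸ i) 2))))))
    where
    ρ = raiseMonoN (e ∸ i) (xMono F) ++ powMono (ℤ.- (+ 1)) (raiseMonoN (e ∸ i ℕ.+ 1) (xMono G))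
    go : ∀ q Hs → sumL (map (λ { (r , H) → if eqFace H G then signL r *L monoL ρ else 0L }) (indexed q Hs))
                  ≡ incidence q G Hs *L monoL ρ
    go q [] = ≡.refl
    go q (H ∷ Hs) with eqFace H G
    ... | true = ≡.trans (cong (signL q *L monoL ρ ++_) (go (suc q) Hs)) (≡.sym (concatMap-++ _ (signL q) _))
    ... | false = go (suc q) Hs

  cancel-mono : ∀ m → m ++ powMono -1ℤ m ~ []
  cancel-mono m w = ≡.trans (expOf-÷ w m m) (ℤ.+-inverseʳ (expOf w m))

  decode-encode : ∀ {n} (F : Vec Bool n) → decode n (encode F) ≡ F
  decode-encode [] = ≡.refl
  decode-encode {suc n} (true ∷ F) = ≡.trans (decode-left n (encode F)) (cong (true ∷_) (decode-encode F))
  decode-encode {suc n} (false ∷ F) = ≡.trans (decode-right n (encode F)) (cong (false ∷_) (decode-encode F))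

  encode-decode : ∀ n (k : Fin (pow2 n)) → encode (decode n k) ≡ k
  encode-decode zero zero = ≡.refl
  encode-decode (suc n) = join-elim (pow2 n)
    (λ k → ≡.trans (cong encode (decode-left n k)) (cong (_↑ˡ pow2 n) (encode-decode n k)))
    (λ k → ≡.trans (cong encode (decode-right n k)) (cong (pow2 n ↑ʳ_) (encode-decode n k)))

  encode-injective : ∀ {n} {F G : Vec Bool n} → encode F ≡ encode G → F ≡ G
  encode-injective {n} {F} {G} eq =
    ≡.trans (≡.sym (decode-encode F)) (≡.trans (cong (decode n) eq) (decode-encode G))

  δ-encode : ∀ {n} v (G F : Vec Bool n) →
    δ (encode G) (encode F) ≡ (if eqFace (embed v F) (embed v G) then 1L else 0L)
  δ-encode v G F with eqFace (embed v F) (embed v G) in eq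
  ... | false = δ-≢ λ G≡F → contradiction
    (≡.trans (≡.sym (eqFace-refl (embed v F))) (≡.trans (cong (λ H → eqFace (embed v F) (embed v H)) (≡.sym (encode-injective {F = G} {F} G≡F))) eq)) λ ()
  ... | true rewrite embed-injective v F G (eqFace-sound (embed v F) (embed v G) eq) = δ-refl (encode G)

  -- The four cases are the four blocks. If both faces contain v, their first variables give w and
  -- the others move up one place, hence the index a + 1. If only F does, just the deletion of v can
  -- reach G, and the remaining variables cancel to leave x_{a+1,v}. If only G does, no deletion of
  -- F contains v. If neither does, nothing changes.
  ∂-encode : ∀ {n} a v (G F : Vec Bool n) → ∂ a v n (encode G) (encode F) ≃
    incidence 0 (embed v G) (deletions (embed v F)) *L monoL (ratio a (embed v F) (embed v G))
  ∂-encode a v [] [] = refl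
  ∂-encode {suc n} a v (true ∷ G) (true ∷ F) = begin
    ∂ a v (suc n) (encode G ↑ˡ N) (encode F ↑ˡ N)
      ≡⟨ blk₁₁ M₁₁ O M₂₁ M₂₂ (encode G) (encode F) ⟩
    negL (w *L ∂ (suc a) (next v) n (encode G) (encode F))
      ≈⟨ -‿cong (*-congˡ {w} (∂-encode (suc a) (next v) G F)) ⟩
    negL (w *L (I *L monoL (ratio (suc a) A B)))
      ≈⟨ -‿cong (x∙yz≈y∙xz w I (monoL (ratio (suc a) A B))) ⟩
    negL (I *L (w *L monoL (ratio (suc a) A B)))
      ≈⟨ -‿cong (*-congˡ {I} (monoL-cong reorder)) ⟩
    negL (I *L monoL (ratio a (v ∷ A) (v ∷ B)))
      ≈⟨ -‿distribˡ-* I _ ⟩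
    negL I *L monoL (ratio a (v ∷ A) (v ∷ B))
      ≡⟨ cong (_*L monoL (ratio a (v ∷ A) (v ∷ B))) (≡.sym incidence-v∷) ⟩
    incidence 0 (v ∷ B) (deletions (v ∷ A)) *L monoL (ratio a (v ∷ A) (v ∷ B)) ∎
    where
    open import Relation.Binary.Reasoning.Setoid setoid
    N = pow2 n
    A = embed (next v) F
    B = embed (next v) G
    I = incidence 0 B (deletions A)
    w = x⁻¹ (2 ℕ.+ a) v *L x (suc a) v
    M₁₁ M₂₁ M₂₂ : Mat N N
    M₁₁ i j = negL (w *L ∂ (suc a) (next v) n i j)
    M₂₁ = scalar (x (suc a) v)
    M₂₂ = ∂ a (next v) n
    incidence-v∷ : incidence 0 (v ∷ B) (deletions (v ∷ A)) ≡ negL I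
    incidence-v∷ rewrite eqFace-≢ {A} {v ∷ B} (embed-≢-∷ v F) =
      ≡.trans (incidence-∷ 1 v B (deletions A)) (incidence-suc 0 B (deletions A))
    reorder : (xv (2 ℕ.+ a) v , -1ℤ) ∷ (xv (suc a) v , 1ℤ) ∷ ratio (suc a) A B ~ ratio a (v ∷ A) (v ∷ B)
    reorder = ~-trans {(u⁻¹ ++ u) ++ (X ++ Y)} {u ++ (u⁻¹ ++ (X ++ Y))} {(u ++ X) ++ (u⁻¹ ++ Y)}
      (++-cong-~ {u⁻¹ ++ u} {u ++ u⁻¹} {X ++ Y} {X ++ Y} (++-comm-~ u⁻¹ u) λ _ → ≡.refl)
      (++-cong-~ {u} {u} {u⁻¹ ++ (X ++ Y)} {X ++ (u⁻¹ ++ Y)} (λ _ → ≡.refl)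
        λ w → ≡.trans (++-cong-~ {u⁻¹ ++ X} {X ++ u⁻¹} {Y} {Y} (++-comm-~ u⁻¹ X) (λ _ → ≡.refl) w)
                       (cong (expOf w) (++-assoc X u⁻¹ Y)))
      where
      u = (xv (suc a) v , 1ℤ) ∷ []
      u⁻¹ = (xv (2 ℕ.+ a) v , -1ℤ) ∷ []
      X = xMonoFrom (2 ℕ.+ a) A
      Y = powMono -1ℤ (xMonoFrom (3 ℕ.+ a) B)
  ∂-encode {suc n} a v (true ∷ G) (false ∷ F) = begin
    ∂ a v (suc n) (encode G ↑ˡ pow2 n) (pow2 n ↑ʳ encode F)
      ≡⟨ blk₁₂ (λ i j → negL (x⁻¹ (2 ℕ.+ a) v *L x (suc a) v *L ∂ (suc a) (next v) n i j)) O
           (scalar (x (suc a) v)) (∂ a (next v) n) (encode G) (encode F) ⟩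
    0L
      ≡⟨ cong (_*L monoL (ratio a A (v ∷ B))) (≡.sym (incidence-absent 0 B A (embed-> v F))) ⟩
    incidence 0 (v ∷ B) (deletions A) *L monoL (ratio a A (v ∷ B)) ∎
    where
    open import Relation.Binary.Reasoning.Setoid setoid
    A = embed (next v) F
    B = embed (next v) G
  ∂-encode {suc n} a v (false ∷ G) (true ∷ F) = begin
    ∂ a v (suc n) (pow2 n ↑ʳ encode G) (encode F ↑ˡ pow2 n)
      ≡⟨ blk₂₁ (λ i j → negL (x⁻¹ (2 ℕ.+ a) v *L x (suc a) v *L ∂ (suc a) (next v) n i j)) O
           (scalar (x (suc a) v)) (∂ a (next v) n) (encode G) (encode F) ⟩
    δ (encode G) (encode F) *L x (suc a) v
      ≡⟨ cong (_*L x (suc a) v) (δ-encode (next v) G F) ⟩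
    (if eqFace A B then 1L else 0L) *L x (suc a) v
      ≈⟨ weight ⟩
    (if eqFace A B then 1L else 0L) *L monoL (ratio a (v ∷ A) B)
      ≡⟨ cong (_*L monoL (ratio a (v ∷ A) B)) (≡.sym incidence-v∷) ⟩
    incidence 0 B (deletions (v ∷ A)) *L monoL (ratio a (v ∷ A) B) ∎
    where
    open import Relation.Binary.Reasoning.Setoid setoid
    A = embed (next v) F
    B = embed (next v) G
    incidence-v∷ : incidence 0 B (deletions (v ∷ A)) ≡ (if eqFace A B then 1L else 0L)
    incidence-v∷ = ≡.trans (cong ((if eqFace A B then 1L else 0L) ++_)
      (incidence-≢ 1 v B (deletions A) λ _ → embed-≢-∷ v G)) (++-identityʳ _)
    weight : (if eqFace A B then 1L else 0L) *L x (suc a) v ≃ (if eqFace A B then 1L else 0L) *L monoL (ratio a (v ∷ A) B)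
    weight with eqFace A B in eq
    ... | false = refl
    ... | true rewrite eqFace-sound A B eq = *-congˡ {1L} (monoL-cong
      (++-cong-~ {(xv (suc a) v , 1ℤ) ∷ []} {(xv (suc a) v , 1ℤ) ∷ []} {[]} {X ++ powMono -1ℤ X}
        (λ _ → ≡.refl) (~-sym {X ++ powMono -1ℤ X} {[]} (cancel-mono X))))
      where X = xMonoFrom (2 ℕ.+ a) B
  ∂-encode {suc n} a v (false ∷ G) (false ∷ F) = begin
    ∂ a v (suc n) (pow2 n ↑ʳ encode G) (pow2 n ↑ʳ encode F)
      ≡⟨ blk₂₂ (λ i j → negL (x⁻¹ (2 ℕ.+ a) v *L x (suc a) v *L ∂ (suc a) (next v) n i j)) O
           (scalar (x (suc a) v)) (∂ a (next v) n) (encode G) (encode F) ⟩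
    ∂ a (next v) n (encode G) (encode F)
      ≈⟨ ∂-encode a (next v) G F ⟩
    incidence 0 B (deletions A) *L monoL (ratio a A B) ∎
    where
    open import Relation.Binary.Reasoning.Setoid setoid
    A = embed (next v) F
    B = embed (next v) G

-- The z-polynomials and their recursion on the smallest vertex.

module ZPolynomials where
  open import Defs hiding (Mat; det; _≈_)
  open Laplacians
  open LaurentPolynomials
  open Embeddings
  open Weights
  open import Algebra.Bundles using (CommutativeRing)
  import Algebra.Solver.Ring.NaturalCoefficients.Default
  open import Data.Bool using (true; false)
  open import Data.Nat as ℕ using (ℕ; zero; suc)
  import Data.Nat.Properties as ℕ
  open import Data.Integer as ℤ using (ℤ; +_; 0ℤ; 1ℤ; -1ℤ)
  import Data.Integer.Properties as ℤ
  open import Data.List as List using (List; []; _∷_; _++_; map; applyUpTo)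
  open import Data.List.Properties using (map-++; map-∘; map-applyUpTo)
  open import Data.List.Relation.Unary.All as All using (All; []; _∷_)
  import Data.List.Relation.Unary.All.Properties as All
  open import Data.Product using (_,_; ∃-syntax)
  open import Function using (_∘_)
  open import Level using (0ℓ)
  open import Relation.Binary.PropositionalEquality as ≡ using (_≡_; cong; cong₂; module ≡-Reasoning)
  open import Relation.Nullary using (yes; no; contradiction)

  open CommutativeRing LP-commutativeRing using
    (refl; sym; trans; setoid; +-cong; +-congʳ; *-cong; *-congʳ; distribˡ; zeroʳ)

  module Rearrange (R : CommutativeRing 0ℓ 0ℓ) where
    open CommutativeRing R
    open Algebra.Solver.Ring.NaturalCoefficients.Default commutativeSemiring
    squares : ∀ y r p q → (y * y * p) * (r * r * q) ≈ (r * y) * (r * y) * (p * q)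
    squares = solve 4 (λ y r p q → (y :* y :* p) :* (r :* r :* q) := (r :* y) :* (r :* y) :* (p :* q)) (CommutativeRing.refl R)

  intRange-split : ∀ {v u} → v ℤ.< u → ∃[ k ] (u ≡ next v ℤ.+ + k)
  intRange-split {v} {u} v<u = ℤ.∣ u ℤ.- next v ∣ , ≡.sym (begin
    next v ℤ.+ + ℤ.∣ u ℤ.- next v ∣  ≡⟨ cong (ℤ._+_ (next v)) (ℤ.0≤i⇒+∣i∣≡i (ℤ.i≤j⇒0≤j-i (<⇒next≤ v<u))) ⟩
    next v ℤ.+ (u ℤ.- next v)        ≡⟨ ℤ.+-comm (next v) _ ⟩
    u ℤ.- next v ℤ.+ next v          ≡⟨ ℤ.+-assoc u _ _ ⟩
    u ℤ.+ (ℤ.- next v ℤ.+ next v)    ≡⟨ cong (ℤ._+_ u) (ℤ.+-inverseˡ (next v)) ⟩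
    u ℤ.+ 0ℤ                         ≡⟨ ℤ.+-identityʳ u ⟩
    u ∎)
    where open ≡-Reasoning

  intRange-+ : ∀ v k → intRange v (v ℤ.+ + k) ≡ applyUpTo (λ n → v ℤ.+ + n) (suc k)
  intRange-+ v k with v ℤ.≤? (v ℤ.+ + k)
  ... | no v≰ = contradiction (ℤ.i≤i+j v (+ k)) v≰
  ... | yes _ = ≡.trans (map-applyUpTo (λ n → n) (λ n → v ℤ.+ + n) _)
    (cong (λ m → applyUpTo (λ n → v ℤ.+ + n) (suc m)) (cong ℤ.∣_∣ difference))
    where
    difference : (v ℤ.+ + k) ℤ.- v ≡ + k
    difference = ≡.trans (cong (ℤ._- v) (ℤ.+-comm v (+ k)))
      (≡.trans (ℤ.+-assoc (+ k) v _) (≡.trans (cong (ℤ._+_ (+ k)) (ℤ.+-inverseʳ v)) (ℤ.+-identityʳ (+ k))))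

  applyUpTo-cong : ∀ {A : Set} {f g : ℕ → A} → (∀ n → f n ≡ g n) → ∀ k → applyUpTo f k ≡ applyUpTo g k
  applyUpTo-cong f≡g zero = ≡.refl
  applyUpTo-cong f≡g (suc k) = cong₂ _∷_ (f≡g 0) (applyUpTo-cong (f≡g ∘ suc) k)

  intRange-self : ∀ v → intRange v v ≡ v ∷ []
  intRange-self v = ≡.trans (cong (intRange v) (≡.sym (ℤ.+-identityʳ v)))
    (≡.trans (intRange-+ v 0) (cong (_∷ []) (ℤ.+-identityʳ v)))

  intRange-< : ∀ {v u} → v ℤ.< u → intRange v u ≡ v ∷ intRange (next v) u
  intRange-< {v} v<u with intRange-split v<u
  ... | k , ≡.refl = begin
    intRange v (next v ℤ.+ + k)
      ≡⟨ cong (intRange v) (ℤ.+-assoc v 1ℤ (+ k)) ⟩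
    intRange v (v ℤ.+ + suc k)
      ≡⟨ intRange-+ v (suc k) ⟩
    (v ℤ.+ 0ℤ) ∷ applyUpTo (λ n → v ℤ.+ + suc n) (suc k)
      ≡⟨ cong₂ _∷_ (ℤ.+-identityʳ v) (applyUpTo-cong (λ n → ≡.sym (ℤ.+-assoc v 1ℤ (+ n))) (suc k)) ⟩
    v ∷ applyUpTo (λ n → next v ℤ.+ + n) (suc k)
      ≡⟨ cong (v ∷_) (≡.sym (intRange-+ (next v) k)) ⟩
    v ∷ intRange (next v) (next v ℤ.+ + k) ∎
    where open ≡-Reasoning

  intRange-≥ : ∀ a b → All (a ℤ.≤_) (intRange a b)
  intRange-≥ a b with a ℤ.≤? b
  ... | yes _ = All.map⁺ (All.universal (λ n → ℤ.i≤i+j a (+ n)) _)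
  ... | no _ = []

  -- The summand of ↑ᵃ z(S, T) indexed by j.
  zTerm : ℕ → List ℤ → ℤ → LP
  zTerm a S j = monoL (powMono (+ 2) (xMonoFrom (suc a) (insertZ j S)) ++ powMono (ℤ.- (+ 2)) (xMonoFrom (2 ℕ.+ a) S))

  raiseN-zPoly : ∀ a S T → raiseN a (zPoly S T) ≡ sumL (map (zTerm a S) T)
  raiseN-zPoly a S [] = ≡.refl
  raiseN-zPoly a S (j ∷ T) = cong₂ _∷_ (cong (+ 1 ,_) mono) (raiseN-zPoly a S T)
    where
    raiseMonoN-++ : ∀ k m m′ → raiseMonoN k (m ++ m′) ≡ raiseMonoN k m ++ raiseMonoN k m′
    raiseMonoN-++ zero m m′ = ≡.refl
    raiseMonoN-++ (suc k) m m′ = ≡.trans (cong raiseMono (raiseMonoN-++ k m m′)) (map-++ _ (raiseMonoN k m) _)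
    raiseMonoN-powMono : ∀ k e m → raiseMonoN k (powMono e m) ≡ powMono e (raiseMonoN k m)
    raiseMonoN-powMono zero e m = ≡.refl
    raiseMonoN-powMono (suc k) e m = ≡.trans (cong raiseMono (raiseMonoN-powMono k e m))
      (≡.trans (≡.sym (map-∘ (raiseMonoN k m))) (map-∘ (raiseMonoN k m)))
    mono : raiseMonoN a (powMono (+ 2) (xMono (insertZ j S)) ++ powMono (ℤ.- (+ 2)) (raiseMono (xMono S)))
      ≡ powMono (+ 2) (xMonoFrom (suc a) (insertZ j S)) ++ powMono (ℤ.- (+ 2)) (xMonoFrom (2 ℕ.+ a) S)
    mono = ≡.trans (raiseMonoN-++ a (powMono (+ 2) (xMono (insertZ j S))) _) (cong₂ _++_
      (≡.trans (raiseMonoN-powMono a (+ 2) (xMono (insertZ j S)))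
        (cong (powMono (+ 2)) (≡.trans (raiseMonoN-xMonoFrom a 1 (insertZ j S))
          (cong (λ k → xMonoFrom k (insertZ j S)) (ℕ.+-comm a 1)))))
      (≡.trans (raiseMonoN-powMono a (ℤ.- (+ 2)) (raiseMono (xMono S)))
        (cong (powMono (ℤ.- (+ 2))) (≡.trans (cong (raiseMonoN a) (raiseMonoN-xMonoFrom 1 1 S))
          (≡.trans (raiseMonoN-xMonoFrom a 2 S) (cong (λ k → xMonoFrom k S) (ℕ.+-comm a 2)))))))

  ζ : ℕ → ℤ → List ℤ → ℤ → LP
  ζ a v S u = sumL (map (zTerm a S) (intRange v u))

  insertZ-≤ : ∀ {v} S → All (v ℤ.≤_) S → insertZ v S ≡ v ∷ S
  insertZ-≤ [] _ = ≡.refl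
  insertZ-≤ {v} (s ∷ S) (v≤s ∷ _) with v ℤ.≤? s
  ... | yes _ = ≡.refl
  ... | no v≰s = contradiction v≤s v≰s

  insertZ-> : ∀ {v j} S → v ℤ.< j → insertZ j (v ∷ S) ≡ v ∷ insertZ j S
  insertZ-> {v} {j} S v<j with j ℤ.≤? v
  ... | yes j≤v = contradiction j≤v (ℤ.<⇒≱ v<j)
  ... | no _ = ≡.refl

  square-~ : ∀ v → (v , + 2) ∷ [] ~ (v , + 1) ∷ (v , + 1) ∷ []
  square-~ v w with v ==V w
  ... | true = ≡.refl
  ... | false = ≡.refl

  square⁻¹-~ : ∀ v → (v , ℤ.- (+ 2)) ∷ [] ~ (v , -1ℤ) ∷ (v , -1ℤ) ∷ []
  square⁻¹-~ v w with v ==V w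
  ... | true = ≡.refl
  ... | false = ≡.refl

  cancel-squares : ∀ m → powMono (+ 2) m ++ powMono (ℤ.- (+ 2)) m ~ []
  cancel-squares m w = begin
    expOf w (powMono (+ 2) m ++ powMono (ℤ.- (+ 2)) m)
      ≡⟨ expOf-++ w (powMono (+ 2) m) _ ⟩
    expOf w (powMono (+ 2) m) ℤ.+ expOf w (powMono (ℤ.- (+ 2)) m)
      ≡⟨ cong₂ ℤ._+_ (expOf-powMono w (+ 2) m) (expOf-powMono w (ℤ.- (+ 2)) m) ⟩
    + 2 ℤ.* expOf w m ℤ.+ ℤ.- (+ 2) ℤ.* expOf w m
      ≡⟨ ≡.sym (ℤ.*-distribʳ-+ (expOf w m) (+ 2) (ℤ.- (+ 2))) ⟩
    0ℤ ℤ.* expOf w m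
      ≡⟨ ℤ.*-zeroˡ (expOf w m) ⟩
    0ℤ ∎
    where open ≡-Reasoning

  -- Putting v in front pushes S up by one place, which is exactly the raising in the denominator of
  -- z; only the square of the new first variable survives.
  zTerm-min : ∀ a v m → monoL (powMono (+ 2) ((xv (suc a) v , 1ℤ) ∷ m) ++ powMono (ℤ.- (+ 2)) m) ≃ x (suc a) v *L x (suc a) v
  zTerm-min a v m = monoL-cong {(u , + 2) ∷ (powMono (+ 2) m ++ powMono (ℤ.- (+ 2)) m)} {(u , 1ℤ) ∷ (u , 1ℤ) ∷ []}
    (~-trans {((u , + 2) ∷ []) ++ (powMono (+ 2) m ++ powMono (ℤ.- (+ 2)) m)} {((u , + 2) ∷ []) ++ []} {(u , 1ℤ) ∷ (u , 1ℤ) ∷ []}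
      (++-cong-~ {(u , + 2) ∷ []} {(u , + 2) ∷ []} {powMono (+ 2) m ++ powMono (ℤ.- (+ 2)) m} {[]} (λ _ → ≡.refl) (cancel-squares m))
      (square-~ u))
    where u = xv (suc a) v

  zTerm-< : ∀ a v S → All (v ℤ.≤_) S → zTerm a S v ≃ x (suc a) v *L x (suc a) v
  zTerm-< a v S v≤S rewrite insertZ-≤ {v} S v≤S = zTerm-min a v (xMonoFrom (2 ℕ.+ a) S)

  -- S ∪ j is a multiset union: v is inserted a second time, in front of the v already present, and
  -- the term is again of the shape of `zTerm-min`.
  zTerm-link-base : ∀ a v S → zTerm a (v ∷ S) v ≃ x (suc a) v *L x (suc a) v
  zTerm-link-base a v S with v ℤ.≤? v
  ... | yes _ = zTerm-min a v (xMonoFrom (2 ℕ.+ a) (v ∷ S))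
  ... | no v≰v = contradiction ℤ.≤-refl v≰v

  -- v stays first in numerator and denominator, contributing x_{a+1,v}² / x_{a+2,v}² = w²;
  -- everything behind it has moved up one place.
  zTerm-link : ∀ a {v j} S → v ℤ.< j → let w = x⁻¹ (2 ℕ.+ a) v *L x (suc a) v in
    zTerm a (v ∷ S) j ≃ w *L w *L zTerm (suc a) S j
  zTerm-link a {v} {j} S v<j rewrite insertZ-> {v} {j} S v<j = begin
    monoL ((u , + 2) ∷ []) *L monoL P *L (monoL ((u⁻¹ , ℤ.- (+ 2)) ∷ []) *L monoL Q)
      ≈⟨ *-cong (*-congʳ {monoL P} (monoL-cong (square-~ u))) (*-congʳ {monoL Q} (monoL-cong (square⁻¹-~ u⁻¹))) ⟩
    (y *L y *L monoL P) *L (r *L r *L monoL Q)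
      ≈⟨ squares y r (monoL P) (monoL Q) ⟩
    (r *L y) *L (r *L y) *L (monoL P *L monoL Q) ∎
    where
    open import Relation.Binary.Reasoning.Setoid setoid
    open Rearrange LP-commutativeRing
    u = xv (suc a) v
    u⁻¹ = xv (2 ℕ.+ a) v
    y = x (suc a) v
    r = x⁻¹ (2 ℕ.+ a) v
    P = powMono (+ 2) (xMonoFrom (2 ℕ.+ a) (insertZ j S))
    Q = powMono (ℤ.- (+ 2)) (xMonoFrom (3 ℕ.+ a) S)

  ζ-base : ∀ a v → ζ a v [] v ≃ x (suc a) v *L x (suc a) v
  ζ-base a v rewrite intRange-self v = zTerm-< a v [] []

  ζ-deletion : ∀ a v S u → All (v ℤ.<_) S → v ℤ.< u →
    ζ a v S u ≃ x (suc a) v *L x (suc a) v +L ζ a (next v) S u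
  ζ-deletion a v S u v<S v<u rewrite intRange-< v<u =
    +-congʳ {ζ a (next v) S u} {zTerm a S v} (zTerm-< a v S (All.map ℤ.<⇒≤ v<S))

  ζ-link : ∀ a v S u → All (v ℤ.<_) S → v ℤ.< u →
    let y = x (suc a) v ; w = x⁻¹ (2 ℕ.+ a) v *L y in
    ζ a v (v ∷ S) u ≃ y *L y +L w *L w *L ζ (suc a) (next v) S u
  ζ-link a v S u v<S v<u rewrite intRange-< v<u =
    +-cong {zTerm a (v ∷ S) v} (zTerm-link-base a v S) (scale (intRange (next v) u) (All.map next≤⇒< (intRange-≥ (next v) u)))
    where
    w = x⁻¹ (2 ℕ.+ a) v *L x (suc a) v
    scale : ∀ T → All (v ℤ.<_) T → sumL (map (zTerm a (v ∷ S)) T) ≃ w *L w *L sumL (map (zTerm (suc a) S) T)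
    scale [] [] = sym (zeroʳ (w *L w))
    scale (j ∷ T) (v<j ∷ v<T) = trans
      (+-cong {zTerm a (v ∷ S) j} (zTerm-link a S v<j) (scale T v<T))
      (sym (distribˡ (w *L w) (zTerm (suc a) S j) _))

-- The product over critical pairs obeys the eigenvalue recursion.

module CriticalPairs where
  open import Defs using (Face; bumps)
  open Laplacians
  open Embeddings
  open import Algebra.Bundles using (CommutativeRing)
  import Algebra.Properties.Ring
  import Algebra.Properties.Semiring.Exp
  open import Data.Bool using (Bool; true; false; not; _∧_; if_then_else_)
  open import Data.Nat as ℕ using (ℕ; zero; suc)
  open import Data.Integer as ℤ using (ℤ; +_)
  import Data.Integer.Properties as ℤ
  open import Data.List as List using (List; []; _∷_; _++_)
  open import Data.List.Relation.Unary.All as All using (All; []; _∷_)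
  open import Data.Product using (_×_; _,_)
  open import Data.Vec as Vec using (Vec; []; _∷_)
  open import Function using (_∘_)
  open import Level using (0ℓ)
  open import Relation.Binary.PropositionalEquality as ≡ using (_≡_; cong)
  import Relation.Binary.Reasoning.Setoid

  -- ok decides which bumped faces B make (A , B) critical; the last two fields concern the
  -- bumped faces that are not embedded subsets of [v , top n v).
  record CriticalTest {n} (v : ℤ) (𝓕 : Family n) (ok : Face → Bool) : Set where
    field
      in-range : ∀ F → ok (embed v F) ≡ not (𝓕 F)
      repeated : ∀ A u B → ok (A ++ u ∷ u ∷ B) ≡ false
      overflow : ∀ (G : Vec Bool n) → ok (embed v G ++ top n v ∷ []) ≡ true

  -- ζ a v S u stands for ↑ᵃ z(S, [v , u]).
  record ZRecursion (R : CommutativeRing 0ℓ 0ℓ) (W : Weighting R) : Set where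
    open CommutativeRing R
    open Weighting W
    field
      ζ : ℕ → ℤ → List ℤ → ℤ → Carrier
      ζ-base : ∀ a v → ζ a v [] v ≈ x (suc a) v * x (suc a) v
      ζ-link : ∀ a v S u → All (v ℤ.<_) S → v ℤ.< u →
        let y = x (suc a) v ; w = x⁻¹ (2 ℕ.+ a) v * y in
        ζ a v (v ∷ S) u ≈ y * y + w * w * ζ (suc a) (next v) S u
      ζ-deletion : ∀ a v S u → All (v ℤ.<_) S → v ℤ.< u →
        ζ a v S u ≈ x (suc a) v * x (suc a) v + ζ a (next v) S u

  module CriticalProduct (R : CommutativeRing 0ℓ 0ℓ) (W : Weighting R) (Z : ZRecursion R W) where
    open CommutativeRing R hiding (zero)
    open Weighting W
    open ZRecursion Z
    open Algebra.Properties.Ring ring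
    open Algebra.Properties.Semiring.Exp semiring
    open Laplacian R W using (eigenProduct)
    open Fold *-commutativeMonoid
    open Relation.Binary.Reasoning.Setoid setoid

    bumpFactor : (Face → Bool) → (List ℤ → ℤ → Carrier) → List ℤ × ℤ × Face → Carrier
    bumpFactor ok h (S , u , B) = if ok B then h S u else 1#

    -- `h S u` is the factor belonging to the long signature with first part S whose second part
    -- ends at u. Both `ok` and `h` are arbitrary functions, so that entering the link of v amounts
    -- to composing them with `v ∷_`.
    bumpProduct : (Face → Bool) → (List ℤ → ℤ → Carrier) → Face → Carrier
    bumpProduct ok h A = listFold (bumpFactor ok h) (bumps A)

    bumpProduct-∷ : ∀ ok h v A → bumpProduct ok h (v ∷ A) ≈
      (if ok (next v ∷ A) then h [] v else 1#) * bumpProduct (ok ∘ (v ∷_)) (h ∘ (v ∷_)) A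
    bumpProduct-∷ ok h v A = *-congˡ (trans (listFold-map (bumpFactor ok h) _ (bumps A))
      (listFold-cong (λ _ → refl) (bumps A)))

    cubeFold-power : ∀ {n} (𝓖 : Family n) σ → cubeFold {n} (λ F → if 𝓖 F then σ else 1#) ≈ σ ^ card 𝓖
    cubeFold-power {zero} 𝓖 σ with 𝓖 []
    ... | true = sym (*-identityʳ σ)
    ... | false = refl
    cubeFold-power {suc n} 𝓖 σ = trans
      (*-cong (cubeFold-power (𝓖 ∘ (true ∷_)) σ) (cubeFold-power (𝓖 ∘ (false ∷_)) σ))
      (sym (^-homo-* σ (card (𝓖 ∘ (true ∷_))) _))

    if-cong : ∀ b {p q r : Carrier} → p ≈ q → (if b then p else r) ≈ (if b then q else r)
    if-cong true p≈q = p≈q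
    if-cong false p≈q = refl

    if-const : ∀ b {p : Carrier} → p ≈ 1# → (if b then p else 1#) ≈ 1#
    if-const true p≈1 = p≈1
    if-const false p≈1 = refl

    if-∧ : ∀ b b′ {p q : Carrier} → (if b then (if b′ then p else q) else q) ≡ (if b ∧ b′ then p else q)
    if-∧ true b′ = ≡.refl
    if-∧ false b′ = ≡.refl

    if-* : ∀ b {p q : Carrier} → (if b then p * q else 1#) ≈ (if b then p else 1#) * (if b then q else 1#)
    if-* true = refl
    if-* false = sym (*-identityˡ 1#)

    -- A member containing both v and v + 1 is bumped to a list with a repeated entry, which the
    -- test rejects. A member without v + 1 is bumped to an embedded set, and the pair is critical
    -- when that set lies outside the family.
    baseMoves-product : ∀ n v (𝓕 : Family (suc n)) ok σ → CriticalTest v 𝓕 ok →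
      cubeFold {n} (λ F → if 𝓕 (true ∷ F) then (if ok (next v ∷ embed (next v) F) then σ else 1#) else 1#)
        ≈ σ ^ baseMoves (𝓕 ∘ (true ∷_)) (𝓕 ∘ (false ∷_))
    -- With v the only vertex, v + 1 is already `top`. The vector `false ∷ []` embeds as the empty
    -- face, so `overflow` accepts precisely the one-element list of v + 1.
    baseMoves-product zero v 𝓕 ok σ test rewrite CriticalTest.overflow test (false ∷ []) =
      cubeFold-power (𝓕 ∘ (true ∷_)) σ
    baseMoves-product (suc n) v 𝓕 ok σ test = begin
      cubeFold {n} (λ F → if 𝓕 (true ∷ true ∷ F) then (if ok (next v ∷ next v ∷ embed (next (next v)) F) then σ else 1#) else 1#) *
      cubeFold {n} (λ F → if 𝓕 (true ∷ false ∷ F) then (if ok (next v ∷ embed (next (next v)) F) then σ else 1#) else 1#)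
        ≈⟨ *-cong
             (cubeFold-ε {n} λ F → if-const (𝓕 (true ∷ true ∷ F)) (reflexive
               (cong (λ b → if b then σ else 1#) (repeated [] (next v) _))))
             (cubeFold-cong {n} λ F → reflexive (≡.trans
               (cong (λ b → if 𝓕 (true ∷ false ∷ F) then (if b then σ else 1#) else 1#) (in-range (false ∷ true ∷ F)))
               (if-∧ (𝓕 (true ∷ false ∷ F)) _))) ⟩
      1# * cubeFold {n} (λ F → if 𝓕 (true ∷ false ∷ F) ∧ not (𝓕 (false ∷ true ∷ F)) then σ else 1#)
        ≈⟨ trans (*-identityˡ _) (cubeFold-power {n} _ σ) ⟩
      σ ^ baseMoves (𝓕 ∘ (true ∷_)) (𝓕 ∘ (false ∷_)) ∎
      where open CriticalTest test

    minus-nested : ∀ s c p q → s - c * (p + q) ≈ (s - c * p) - c * q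
    minus-nested s c p q = begin
      s - c * (p + q)             ≈⟨ +-congˡ (-‿cong (distribˡ c p q)) ⟩
      s - (c * p + c * q)         ≈⟨ +-congˡ (sym (-‿+-comm _ _)) ⟩
      s + (- (c * p) + - (c * q)) ≈⟨ sym (+-assoc _ _ _) ⟩
      (s - c * p) - c * q         ∎

    -- For a member containing v, the bump of v itself is split off as a base move and the later
    -- bumps are those of the link; the other members are those of the deletion. The assumption on
    -- `h` is limited to S and u at or above v, the range in which the recursion for ζ may be
    -- unrolled.
    critical-product : ∀ {n} a v (𝓕 : Family n) ok h {s c} → CriticalTest v 𝓕 ok →
      (∀ S u → All (v ℤ.≤_) S → v ℤ.≤ u → h S u ≈ s - c * ζ a v S u) →
      cubeFold {n} (λ F → if 𝓕 F then bumpProduct ok h (embed v F) else 1#) ≈ eigenProduct s c a v 𝓕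
    critical-product {zero} a v 𝓕 ok h test h≈ = if-const (𝓕 []) refl
    critical-product {suc n} a v 𝓕 ok h {s} {c} test h≈ = begin
      cubeFold {n} (λ F → if 𝓐 F then bumpProduct ok h (v ∷ embed (next v) F) else 1#) *
      cubeFold {n} (λ F → if 𝓑 F then bumpProduct ok h (embed (next v) F) else 1#)
        ≈⟨ *-cong
             (trans (cubeFold-cong {n} λ F → trans
                 (if-cong (𝓐 F) (bumpProduct-∷ ok h v (embed (next v) F))) (if-* (𝓐 F)))
               (sym (cubeFold-∙ {n} _ _)))
             (critical-product a (next v) 𝓑 ok h deletion-test deletion-h) ⟩
      (cubeFold {n} (λ F → if 𝓐 F then (if ok (next v ∷ embed (next v) F) then h [] v else 1#) else 1#) *
       cubeFold {n} (λ F → if 𝓐 F then bumpProduct (ok ∘ (v ∷_)) (h ∘ (v ∷_)) (embed (next v) F) else 1#)) *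
      eigenProduct σ c a (next v) 𝓑
        ≈⟨ *-congʳ (*-cong
             (trans (cubeFold-cong {n} λ F → if-cong (𝓐 F) (if-cong (ok (next v ∷ embed (next v) F)) base-h))
               (baseMoves-product n v 𝓕 ok σ test))
             (critical-product (suc a) (next v) 𝓐 (ok ∘ (v ∷_)) (h ∘ (v ∷_)) link-test link-h)) ⟩
      (σ ^ baseMoves 𝓐 𝓑 * eigenProduct σ (c * (w * w)) (suc a) (next v) 𝓐) * eigenProduct σ c a (next v) 𝓑
        ≈⟨ *-assoc _ _ _ ⟩
      eigenProduct s c a v 𝓕 ∎
      where
      open CriticalTest test
      𝓐 = 𝓕 ∘ (true ∷_)
      𝓑 = 𝓕 ∘ (false ∷_)
      y = x (suc a) v
      w = x⁻¹ (2 ℕ.+ a) v * y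
      σ = s - c * (y * y)
      base-h : h [] v ≈ σ
      base-h = trans (h≈ [] v [] ℤ.≤-refl) (+-congˡ (-‿cong (*-congˡ (ζ-base a v))))
      link-test : CriticalTest (next v) 𝓐 (ok ∘ (v ∷_))
      link-test = record
        { in-range = in-range ∘ (true ∷_)
        ; repeated = repeated ∘ (v ∷_)
        ; overflow = overflow ∘ (true ∷_) }
      deletion-test : CriticalTest (next v) 𝓑 ok
      deletion-test = record
        { in-range = in-range ∘ (false ∷_)
        ; repeated = repeated
        ; overflow = overflow ∘ (false ∷_) }
      link-h : ∀ S u → All (next v ℤ.≤_) S → next v ℤ.≤ u →
        h (v ∷ S) u ≈ σ - c * (w * w) * ζ (suc a) (next v) S u
      link-h S u v<S v<u = begin
        h (v ∷ S) u
          ≈⟨ h≈ (v ∷ S) u (ℤ.≤-refl ∷ All.map (ℤ.<⇒≤ ∘ next≤⇒<) v<S) (ℤ.<⇒≤ (next≤⇒< v<u)) ⟩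
        s - c * ζ a v (v ∷ S) u
          ≈⟨ +-congˡ (-‿cong (*-congˡ (ζ-link a v S u (All.map next≤⇒< v<S) (next≤⇒< v<u)))) ⟩
        s - c * (y * y + w * w * ζ (suc a) (next v) S u)
          ≈⟨ trans (minus-nested s c _ _) (+-congˡ (-‿cong (sym (*-assoc _ _ _)))) ⟩
        σ - c * (w * w) * ζ (suc a) (next v) S u ∎
      deletion-h : ∀ S u → All (next v ℤ.≤_) S → next v ℤ.≤ u → h S u ≈ σ - c * ζ a (next v) S u
      deletion-h S u v<S v<u = begin
        h S u
          ≈⟨ h≈ S u (All.map (ℤ.<⇒≤ ∘ next≤⇒<) v<S) (ℤ.<⇒≤ (next≤⇒< v<u)) ⟩
        s - c * ζ a v S u
          ≈⟨ +-congˡ (-‿cong (*-congˡ (ζ-deletion a v S u (All.map next≤⇒< v<S) (next≤⇒< v<u)))) ⟩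
        s - c * (y * y + ζ a (next v) S u)
          ≈⟨ minus-nested s c _ _ ⟩
        σ - c * ζ a (next v) S u ∎

-- Assembly: the Laplacian of a shifted complex and its long signatures.

module ShiftedSpectrum where
  open import Defs hiding (Mat; det; _≈_)
  open Determinants
  open Laplacians
  open LaurentPolynomials
  open Embeddings
  open Weights
  open ZPolynomials
  open CriticalPairs
  open import Algebra.Bundles using (CommutativeRing)
  import Algebra.Properties.Semiring.Exp
  import Algebra.Properties.CommutativeSemigroup
  import Algebra.Properties.AbelianGroup
  open import Data.Bool using (Bool; true; false; not; _∧_; if_then_else_)
  import Data.Bool.Properties as Bool
  open import Data.Bool.ListAction using (any)
  open import Data.Nat as ℕ using (ℕ; zero; suc; _∸_)
  import Data.Nat.Properties as ℕ
  open import Data.Integer as ℤ using (ℤ; +_)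
  import Data.Integer.Properties as ℤ
  open import Data.Fin as Fin using (Fin; zero; suc; toℕ; _↑ˡ_; _↑ʳ_)
  import Data.Fin.Properties as Fin
  open import Data.List as List using (List; []; _∷_; _++_; map; length; concat)
  open import Data.List.Membership.Propositional using (_∈_; _∉_)
  open import Data.List.Membership.Propositional.Properties using (∈-filter⁺; ∈-filter⁻; ∈-concat⁺′; ∈-concat⁻′; ∈-lookup)
  open import Data.List.Relation.Unary.Any as Any using (here; there)
  open import Data.List.Relation.Unary.Any.Properties using (lookup-index)
  open import Data.List.Relation.Unary.All as All using (All; []; _∷_)
  open import Data.List.Relation.Unary.AllPairs using ([]; _∷_)
  open import Data.List.Relation.Unary.Unique.Propositional using (Unique)
  import Data.List.Relation.Unary.Unique.Propositional.Properties as Unique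
  open import Data.List.Relation.Unary.Linked using ([]; [-]; _∷_)
  open import Data.Product using (_×_; _,_; proj₁; proj₂; ∃-syntax)
  open import Data.Sum using (_⊎_; inj₁; inj₂)
  open import Data.Vec as Vec using (Vec; []; _∷_; lookup; _[_]≔_)
  open import Data.Vec.Properties using (lookup∘update; lookup∘update′)
  open import Function using (_∘_)
  open import Function.Bundles using (mk⇔)
  open import Relation.Binary.PropositionalEquality as ≡ using (_≡_; _≢_; cong; cong₂; subst)
  open import Relation.Nullary using (yes; no; contradiction)
  open import Relation.Nullary.Decidable using (⌊_⌋)

  open CommutativeRing LP-commutativeRing using
    ( refl; sym; trans; reflexive; setoid; semiring; +-cong; +-congˡ; *-cong; *-congˡ; *-congʳ
    ; -‿cong; +-identityʳ; *-identityˡ; *-identityʳ; zeroˡ; zeroʳ; *-assoc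
    ; *-commutativeSemigroup; +-commutativeMonoid; *-commutativeMonoid)
  open Algebra.Properties.Semiring.Exp semiring using (_^_; ^-homo-*)
  open Algebra.Properties.CommutativeSemigroup *-commutativeSemigroup using (x∙yz≈y∙xz)
  open Determinant LP-commutativeRing

  module +-Fold = Fold +-commutativeMonoid
  module *-Fold = Fold *-commutativeMonoid

  lookup-injective : ∀ {A : Set} {xs : List A} → Unique xs → ∀ r c → List.lookup xs r ≡ List.lookup xs c → r ≡ c
  lookup-injective (x∉ ∷ _) zero zero _ = ≡.refl
  lookup-injective (x∉ ∷ _) zero (suc c) eq = contradiction eq (All.lookup x∉ (∈-lookup c))
  lookup-injective (x∉ ∷ _) (suc r) zero eq = contradiction (≡.sym eq) (All.lookup x∉ (∈-lookup r))
  lookup-injective (_ ∷ u) (suc r) (suc c) eq = cong suc (lookup-injective u r c eq)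

  ∑-cubeFold : ∀ n (f : Row (pow2 n)) → ∑ f ≃ +-Fold.cubeFold {n} (f ∘ encode)
  ∑-cubeFold zero f = trans (∑-suc f) (trans (+-congˡ {f zero} (∑-empty (f ∘ suc))) (+-identityʳ (f zero)))
  ∑-cubeFold (suc n) f = trans (∑-join (pow2 n) f)
    (+-cong (∑-cubeFold n (λ i → f (i ↑ˡ pow2 n))) (∑-cubeFold n (λ i → f (pow2 n ↑ʳ i))))

  open Algebra.Properties.AbelianGroup ℤ.+-0-abelianGroup using (∙-cancelˡ)

  position-injective : ∀ {n} v {s t : Fin n} → v ℤ.+ + toℕ s ≡ v ℤ.+ + toℕ t → s ≡ t
  position-injective v eq = Fin.toℕ-injective (ℤ.+-injective (∙-cancelˡ v _ _ eq))

  isStrictInc-complete : ∀ {A} → StrictInc A → isStrictInc A ≡ true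
  isStrictInc-complete [] = ≡.refl
  isStrictInc-complete [-] = ≡.refl
  isStrictInc-complete {a ∷ b ∷ A} (a<b ∷ s) with a ℤ.<? b
  ... | yes _ = isStrictInc-complete s
  ... | no a≮b = contradiction a<b a≮b

  isStrictInc-repeated : ∀ A u B → isStrictInc (A ++ u ∷ u ∷ B) ≡ false
  isStrictInc-repeated [] u B with u ℤ.<? u
  ... | yes u<u = contradiction u<u (ℤ.<-irrefl ≡.refl)
  ... | no _ = ≡.refl
  isStrictInc-repeated (a ∷ []) u B = ≡.trans (cong (⌊ a ℤ.<? u ⌋ ∧_) (isStrictInc-repeated [] u B)) (Bool.∧-zeroʳ _)
  isStrictInc-repeated (a ∷ b ∷ A) u B = ≡.trans (cong (⌊ a ℤ.<? b ⌋ ∧_) (isStrictInc-repeated (b ∷ A) u B)) (Bool.∧-zeroʳ _)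

  snoc-strict : ∀ {A t} → StrictInc A → All (ℤ._< t) A → StrictInc (A ++ t ∷ [])
  snoc-strict [] [] = [-]
  snoc-strict [-] (a<t ∷ []) = a<t ∷ [-]
  snoc-strict (a<b ∷ s) (_ ∷ A<t) = a<b ∷ snoc-strict s A<t

  embed-<-top : ∀ {n} v (F : Vec Bool n) → All (ℤ._< top n v) (embed v F)
  embed-<-top v [] = []
  embed-<-top {suc n} v (true ∷ F) = ℤ.<-≤-trans (v<next v) (v≤top n (next v)) ∷ embed-<-top (next v) F
  embed-<-top v (false ∷ F) = embed-<-top (next v) F

  foldr-⊓-≤ : ∀ y ys {z} → z ∈ y ∷ ys → List.foldr ℤ._⊓_ y ys ℤ.≤ z
  foldr-⊓-≤ y [] (here ≡.refl) = ℤ.≤-refl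
  foldr-⊓-≤ y (y′ ∷ ys) (here ≡.refl) = ℤ.≤-trans (ℤ.i⊓j≤j y′ _) (foldr-⊓-≤ y ys (here ≡.refl))
  foldr-⊓-≤ y (y′ ∷ ys) (there (here ≡.refl)) = ℤ.i⊓j≤i y′ _
  foldr-⊓-≤ y (y′ ∷ ys) (there (there z∈)) = ℤ.≤-trans (ℤ.i⊓j≤j y′ _) (foldr-⊓-≤ y ys (there z∈))

  ≤-foldr-⊓ : ∀ p y ys → All (p ℤ.≤_) (y ∷ ys) → p ℤ.≤ List.foldr ℤ._⊓_ y ys
  ≤-foldr-⊓ p y [] (p≤y ∷ []) = p≤y
  ≤-foldr-⊓ p y (y′ ∷ ys) (p≤y ∷ p≤y′ ∷ p≤ys) = ℤ.⊓-glb p≤y′ (≤-foldr-⊓ p y ys (p≤y ∷ p≤ys))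

  minElt-least : ∀ p 𝓛 → (∀ {A} → A ∈ 𝓛 → All (p ℤ.≤_) A) → p ∈ concat 𝓛 → minElt 𝓛 ≡ p
  minElt-least p 𝓛 p≤ p∈ with concat 𝓛 in eq
  minElt-least p 𝓛 p≤ p∈ | y ∷ ys = ℤ.≤-antisym (foldr-⊓-≤ y ys p∈)
    (≤-foldr-⊓ p y ys (All.tabulate λ z∈ → bound (subst (_ ∈_) (≡.sym eq) z∈)))
    where
    bound : ∀ {z} → z ∈ concat 𝓛 → p ℤ.≤ z
    bound z∈ with ∈-concat⁻′ 𝓛 z∈
    ... | A , z∈A , A∈ = All.lookup (p≤ A∈) z∈A

  ι-product : ∀ b {P P′ Q Q′} → P ≃ P′ → Q ≃ Q′ →
    P *L (1L *L (ι b *L Q)) ≃ (if b then P′ *L Q′ else 0L)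
  ι-product true P≃ Q≃ = *-cong P≃ (trans (*-identityˡ _) (trans (*-identityˡ _) Q≃))
  ι-product false {P} P≃ Q≃ = zeroʳ P

  tPow≡^ : ∀ k → tPow k ≡ tL ^ k
  tPow≡^ zero = ≡.refl
  tPow≡^ (suc k) = cong (tL *L_) (tPow≡^ k)

  z-recursion : ZRecursion LP-commutativeRing weighting
  z-recursion = record { ζ = ζ ; ζ-base = ζ-base ; ζ-link = ζ-link ; ζ-deletion = ζ-deletion }

  open CriticalProduct LP-commutativeRing weighting z-recursion

  module ShiftedComplex (p q : ℤ) (K : Cx) (d : ℕ) (shifted : IsShiftedComplex p q K) (i : ℕ) where
    open IsSimplicialComplexOn (proj₁ shifted)

    -- The cube covers the integers from p to p + |q - p|, an interval containing [p, q] even when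
    -- [p, q] is empty; only `q<top` is asked of it.
    n : ℕ
    n = suc ℤ.∣ q ℤ.- p ∣
    N : ℕ
    N = pow2 n
    a : ℕ
    a = d ∸ i
    𝓛 𝓡 : Cx
    𝓛 = faces i K
    𝓡 = facesCard i K
    𝓕 : Family n
    𝓕 F = any (eqFace (embed p F)) 𝓛

    q<top : q ℤ.< top n p
    q<top = subst (q ℤ.<_) (≡.sym (top≡ n p)) (ℤ.≤-<-trans q≤
      (ℤ.+-monoʳ-< p (ℤ.+<+ (ℕ.n<1+n ℤ.∣ q ℤ.- p ∣))))
      where
      q≤ : q ℤ.≤ p ℤ.+ + ℤ.∣ q ℤ.- p ∣
      q≤ = subst (ℤ._≤ p ℤ.+ + ℤ.∣ q ℤ.- p ∣)
        (≡.trans (ℤ.+-comm p _) (≡.trans (ℤ.+-assoc q _ _) (≡.trans (cong (ℤ._+_ q) (ℤ.+-inverseˡ p)) (ℤ.+-identityʳ q))))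
        (ℤ.+-monoʳ-≤ p (i≤∣i∣ (q ℤ.- p)))

    image : ∀ {A} → A ∈ K → ∃[ F ] embed {n} p F ≡ A
    image A∈K = embed-surjective n p _ (All.lookup faces-canonical A∈K)
      (All.map proj₁ (faces-in-range A∈K)) (All.map (λ r → ℤ.≤-<-trans (proj₂ r) q<top) (faces-in-range A∈K))

    𝓛⊆K : ∀ {A} → A ∈ 𝓛 → A ∈ K × length A ≡ suc i
    𝓛⊆K = ∈-filter⁻ (λ A → length A ℕ.≟ suc i) {xs = K}

    𝓕-sound : ∀ F → 𝓕 F ≡ true → embed p F ∈ K × length (embed p F) ≡ suc i
    𝓕-sound F 𝓕F = 𝓛⊆K (any-sound (embed p F) 𝓛 𝓕F)

    𝓕-complete : ∀ F → embed p F ∈ K → length (embed p F) ≡ suc i → 𝓕 F ≡ true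
    𝓕-complete F F∈K len = any-complete (∈-filter⁺ (λ A → length A ℕ.≟ suc i) F∈K len)

    -- Shiftedness puts the exchanged set into K, and one deletion followed by one insertion
    -- preserves the cardinality, so the set stays among the i-dimensional faces.
    𝓕-compressed : Compressed 𝓕
    𝓕-compressed F s t s<t Fs Ft 𝓕F with 𝓕-sound F 𝓕F
    ... | F∈K , len = 𝓕-complete G
      (proj₂ shifted F∈K (pos s) (pos t) (ℤ.i≤i+j p (+ toℕ s)) (ℤ.+-monoʳ-< p (ℤ.+<+ s<t))
        (proj₂ (All.lookup (faces-in-range F∈K) t∈F)) s∉F t∈F (embed p G) (embed-strict p G)
        (λ v → mk⇔ to from))
      (≡.trans (length-insert p (F [ t ]≔ false) s F′s) (≡.trans (length-delete p F t Ft) len))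
      where
      pos : Fin n → ℤ
      pos u = p ℤ.+ + toℕ u
      G = (F [ t ]≔ false) [ s ]≔ true
      s≢t : s ≢ t
      s≢t s≡t = ℕ.<-irrefl (cong toℕ s≡t) s<t
      F′s : lookup (F [ t ]≔ false) s ≡ false
      F′s = ≡.trans (lookup∘update′ s≢t F false) Fs
      t∈F : pos t ∈ embed p F
      t∈F = ∈-embed⁺ p F t Ft
      s∉F : pos s ∉ embed p F
      s∉F s∈ with ∈-embed⁻ p F s∈
      ... | u , Fu , eq rewrite position-injective p {s} {u} eq = contradiction (≡.trans (≡.sym Fu) Fs) λ ()
      to : ∀ {v} → v ∈ embed p G → (v ∈ embed p F × v ≢ pos t) ⊎ v ≡ pos s
      to v∈ with ∈-embed⁻ p G v∈
      ... | u , Gu , ≡.refl with u Fin.≟ s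
      ...   | yes ≡.refl = inj₂ ≡.refl
      ...   | no u≢s with u Fin.≟ t
      ...     | yes ≡.refl = contradiction (≡.trans (≡.sym Gu) (≡.trans (lookup∘update′ u≢s (F [ t ]≔ false) true) (lookup∘update t F false))) λ ()
      ...     | no u≢t = inj₁ (∈-embed⁺ p F u (≡.trans (≡.sym (≡.trans (lookup∘update′ u≢s (F [ t ]≔ false) true) (lookup∘update′ u≢t F false))) Gu)
                              , λ eq → u≢t (position-injective p eq))
      from : ∀ {v} → (v ∈ embed p F × v ≢ pos t) ⊎ v ≡ pos s → v ∈ embed p G
      from (inj₂ ≡.refl) = ∈-embed⁺ p G s (lookup∘update s (F [ t ]≔ false) true)
      from (inj₁ (v∈ , v≢)) with ∈-embed⁻ p F v∈
      ... | u , Fu , ≡.refl = ∈-embed⁺ p G u (≡.trans (lookup∘update′ u≢s (F [ t ]≔ false) true) (≡.trans (lookup∘update′ u≢t F false) Fu))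
        where
        u≢s : u ≢ s
        u≢s ≡.refl = contradiction (≡.trans (≡.sym Fu) Fs) λ ()
        u≢t : u ≢ t
        u≢t ≡.refl = v≢ ≡.refl

    shadow⊆𝓡 : ∀ F t → 𝓕 F ≡ true → lookup F t ≡ true → embed p (F [ t ]≔ false) ∈ 𝓡
    shadow⊆𝓡 F t 𝓕F Ft with 𝓕-sound F 𝓕F
    ... | F∈K , len = ∈-filter⁺ (λ A → length A ℕ.≟ i)
      (down-closed F∈K (embed p (F [ t ]≔ false)) (embed-strict p (F [ t ]≔ false)) subset)
      (ℕ.suc-injective (≡.trans (length-delete p F t Ft) len))
      where
      subset : ∀ v → v ∈ embed p (F [ t ]≔ false) → v ∈ embed p F
      subset v v∈ with ∈-embed⁻ p (F [ t ]≔ false) v∈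
      ... | u , F′u , ≡.refl with u Fin.≟ t
      ...   | yes ≡.refl = contradiction (≡.trans (≡.sym F′u) (lookup∘update t F false)) λ ()
      ...   | no u≢t = ∈-embed⁺ p F u (≡.trans (≡.sym (lookup∘update′ u≢t F false)) F′u)

    L : Mat N N
    L = laplacian 1L a p 𝓕

    face : Fin (length 𝓡) → Vec Bool n
    face r = proj₁ (image (proj₁ (∈-filter⁻ (λ A → length A ℕ.≟ i) {xs = K} (∈-lookup r))))

    embed-face : ∀ r → embed p (face r) ≡ List.lookup 𝓡 r
    embed-face r = proj₂ (image (proj₁ (∈-filter⁻ (λ A → length A ℕ.≟ i) {xs = K} (∈-lookup r))))

    -- The sum over the whole cube reduces to the i-dimensional faces, because the indicator in the
    -- Laplacian kills every other subset.
    Lud-L : ∀ r c → Lud d i K r c ≃ L (encode (face r)) (encode (face c))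
    Lud-L r c = sym (begin
      L (encode (face r)) (encode (face c))
        ≈⟨ ∑-cubeFold n _ ⟩
      +-Fold.cubeFold {n} (λ F → ∂ a p n (encode (face r)) (encode F) *L
        (1L *L (indicator 𝓕 (encode F) *L ∂ a p n (encode (face c)) (encode F))))
        ≈⟨ +-Fold.cubeFold-cong {n} term ⟩
      +-Fold.cubeFold {n} (λ F → if 𝓕 F then product (embed p F) else 0L)
        ≈⟨ +-Fold.listFold-cubeFold n p product 𝓛
             (Unique.filter⁺ (λ A → length A ℕ.≟ suc i) faces-distinct) (All.tabulate (λ A∈ → image (proj₁ (𝓛⊆K A∈)))) ⟨
      Lud d i K r c ∎)
      where
      open import Relation.Binary.Reasoning.Setoid setoid
      product : Face → LP
      product A = bdEntry d i (List.lookup 𝓡 r) A *L bdEntry d i (List.lookup 𝓡 c) A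
      entry : ∀ r F → ∂ a p n (encode (face r)) (encode F) ≃ bdEntry d i (List.lookup 𝓡 r) (embed p F)
      entry r F = trans (∂-encode a p (face r) F) (reflexive (≡.trans
        (≡.sym (bdEntry≡ d i (embed p (face r)) (embed p F))) (cong (λ G → bdEntry d i G (embed p F)) (embed-face r))))
      term : ∀ F → ∂ a p n (encode (face r)) (encode F) *L
        (1L *L (indicator 𝓕 (encode F) *L ∂ a p n (encode (face c)) (encode F)))
        ≃ (if 𝓕 F then product (embed p F) else 0L)
      term F = trans
        (reflexive (cong (λ G → ∂ a p n (encode (face r)) (encode F) *L
          (1L *L (ι (𝓕 G) *L ∂ a p n (encode (face c)) (encode F)))) (decode-encode F)))
        (ι-product (𝓕 F) (entry r F) (entry c F))

    -- K is closed under subsets, so every facet of an i-dimensional face is listed in `𝓡`; an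
    -- unlisted row meets only sets outside the family or zero boundary entries.
    L-row-zero : ∀ k l → embed p (decode n k) ∉ 𝓡 → L k l ≃ 0L
    L-row-zero k l k∉ = ∑≈0 term
      where
      term : ∀ j → ∂ a p n k j *L (1L *L (indicator 𝓕 j *L ∂ a p n l j)) ≃ 0L
      term j = split (∂-support n a p k j)
        where
        split : ∂ a p n k j ≃ 0L ⊎ IsDeletion (decode n k) (decode n j) →
          ∂ a p n k j *L (1L *L (indicator 𝓕 j *L ∂ a p n l j)) ≃ 0L
        split (inj₁ ∂≃0) = *-congʳ {1L *L (indicator 𝓕 j *L ∂ a p n l j)} ∂≃0
        split (inj₂ (t , jt , eq)) = trans
          (ι-product (𝓕 (decode n j)) {∂ a p n k j} {Q = ∂ a p n l j} refl refl)
          (reflexive (cong (λ b → if b then ∂ a p n k j *L ∂ a p n l j else 0L) (Bool.¬-not λ 𝓕j →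
            k∉ (subst (λ F → embed p F ∈ 𝓡) (≡.sym eq) (shadow⊆𝓡 (decode n j) t 𝓕j jt)))))

    -- The matrix of the statement and the cube Laplacian have different sizes. X keeps the rows of
    -- L indexed by `𝓡` and Y is the coordinate inclusion, so XY is the compression of L to `𝓡`,
    -- while YX is L itself because the discarded rows vanish. Sylvester's identity then compares
    -- the two.
    X : Mat (length 𝓡) N
    X r k = L (encode (face r)) k

    Y : Mat N (length 𝓡)
    Y k c = δ k (encode (face c))

    XY≋Lud : X ⊗ Y ≋ Lud d i K
    XY≋Lud r c = trans (∑-δʳ (encode (face c)) (X r)) (sym (Lud-L r c))

    encode-face-injective : ∀ {r c} → encode (face r) ≡ encode (face c) → r ≡ c
    encode-face-injective {r} {c} eq = lookup-injective
      (Unique.filter⁺ (λ A → length A ℕ.≟ i) faces-distinct) r c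
      (≡.trans (≡.sym (embed-face r)) (≡.trans (cong (embed p) (encode-injective {F = face r} {face c} eq)) (embed-face c)))

    YX≋L : Y ⊗ X ≋ L
    YX≋L k l = row (any (eqFace (embed p (decode n k))) 𝓡) ≡.refl
      where
      row : ∀ b → any (eqFace (embed p (decode n k))) 𝓡 ≡ b → (Y ⊗ X) k l ≃ L k l
      row true eq = trans (∑-cong λ r → *-congʳ {X r l} (reflexive (δ-row r)))
        (trans (∑-δˡ r₀ (λ r → X r l)) (reflexive (cong (λ k → L k l) encode-r₀)))
        where
        k∈ : embed p (decode n k) ∈ 𝓡
        k∈ = any-sound (embed p (decode n k)) 𝓡 eq
        r₀ : Fin (length 𝓡)
        r₀ = Any.index k∈
        encode-r₀ : encode (face r₀) ≡ k
        encode-r₀ = ≡.trans (cong encode (embed-injective p (face r₀) (decode n k)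
          (≡.trans (embed-face r₀) (≡.sym (lookup-index k∈))))) (encode-decode n k)
        δ-row : ∀ r → δ k (encode (face r)) ≡ δ r₀ r
        δ-row r = ≡.trans (cong (λ j → δ j (encode (face r))) (≡.sym encode-r₀))
          (δ-injective encode-face-injective r₀ r)
      row false eq = trans (∑≈0 λ r → trans (*-congʳ {X r l} (reflexive (δ-≢ (k≢ r)))) (zeroˡ (X r l)))
        (sym (L-row-zero k l k∉))
        where
        k∉ : embed p (decode n k) ∉ 𝓡
        k∉ k∈ = Bool.not-¬ (any-complete k∈) eq
        k≢ : ∀ r → k ≢ encode (face r)
        k≢ r k≡ = k∉ (subst (_∈ 𝓡) (≡.sym (≡.trans (cong (embed p ∘ decode n) k≡)
          (≡.trans (cong (embed p) (decode-encode (face r))) (embed-face r)))) (∈-lookup r))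

    open Spectrum TLinear TFree tLinear-regular tLinear-shift tFree-*
      (λ a v → tFree-monoL ≡.refl) (λ a v → tFree-monoL ≡.refl)

    eigenvalues : LP
    eigenvalues = eigenProduct tL 1L a p 𝓕

    det-L : tL ^ rank 𝓕 *L det (characteristic tL L) ≃ tL ^ N *L eigenvalues
    det-L = det-laplacian a p 𝓕 𝓕-compressed (tFree-monoL ≡.refl) ([] , [] , refl)

    ok : Face → Bool
    ok B = isStrictInc B ∧ not (any (eqFace B) 𝓛)

    ok-critical : CriticalTest p 𝓕 ok
    ok-critical = record
      { in-range = λ F → cong (_∧ not (𝓕 F)) (isStrictInc-complete (embed-strict p F))
      ; repeated = λ A u B → cong (_∧ not (any (eqFace (A ++ u ∷ u ∷ B)) 𝓛)) (isStrictInc-repeated A u B)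
      ; overflow = λ G → cong₂ (λ b b′ → b ∧ not b′)
          (isStrictInc-complete (snoc-strict (embed-strict p G) (embed-<-top p G)))
          (any-∉ λ B∈ → ℤ.<⇒≱ q<top (proj₂ (All.lookup (faces-in-range (proj₁ (𝓛⊆K B∈))) (top∈ (embed p G)))))
      }
      where
      top∈ : ∀ A → top n p ∈ A ++ top n p ∷ []
      top∈ [] = here ≡.refl
      top∈ (_ ∷ A) = there (top∈ A)

    -- Some i-dimensional face contains p as soon as one exists: if the given face avoids p,
    -- exchanging one of its vertices for p gives another face, by shiftedness.
    minElt-𝓛 : ∀ {A} → A ∈ 𝓛 → minElt 𝓛 ≡ p
    minElt-𝓛 {A} A∈ = minElt-least p 𝓛 (λ B∈ → All.map proj₁ (faces-in-range (proj₁ (𝓛⊆K B∈)))) p∈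
      where
      contains-p : ∀ F → 𝓕 F ≡ true → p ∈ concat 𝓛
      contains-p (true ∷ F) 𝓕F = ∈-concat⁺′ (here ≡.refl) (any-sound (embed p (true ∷ F)) 𝓛 𝓕F)
      -- The length i + 1 in the second scrutinee excludes the empty face, so there is a vertex to
      -- exchange.
      contains-p (false ∷ F) 𝓕F with embed (next p) F in eq | proj₂ (𝓕-sound (false ∷ F) 𝓕F)
      ... | u ∷ _ | _ with ∈-embed⁻ (next p) F (subst (u ∈_) (≡.sym eq) (here ≡.refl))
      ...   | t , Ft , _ = ∈-concat⁺′ (here ≡.refl) (any-sound (embed p (true ∷ (F [ t ]≔ false))) 𝓛
                (compressed-shadow {𝓕 = 𝓕} 𝓕-compressed F t Ft 𝓕F))
      p∈ : p ∈ concat 𝓛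
      p∈ with image (proj₁ (𝓛⊆K A∈))
      ... | F , ≡.refl = contains-p F (any-complete A∈)

    -- Flattening the nested concatenations turns the left side into a product of `bumpProduct` over
    -- the faces, then over the cube, where `critical-product` applies with s = t and c = 1.
    LSG-product : prodL (map (λ l → tL -L l) (map (λ { (S , T) → raiseN (d ∸ i) (zPoly S T) }) (LSG 𝓛))) ≃ eigenvalues
    LSG-product = begin
      *-Fold.listFold (λ l → tL -L l) (map (λ { (S , T) → raiseN (d ∸ i) (zPoly S T) }) (LSG 𝓛))
        ≈⟨ *-Fold.listFold-map (λ l → tL -L l) _ (LSG 𝓛) ⟩
      *-Fold.listFold factor (LSG 𝓛)
        ≈⟨ *-Fold.listFold-concatMap factor _ 𝓛 ⟩
      *-Fold.listFold _ 𝓛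
        ≈⟨ *-Fold.listFold-cong (λ A → trans (*-Fold.listFold-concatMap factor _ (bumps A))
             (*-Fold.listFold-cong bump (bumps A))) 𝓛 ⟩
      *-Fold.listFold (bumpProduct ok h₀) 𝓛
        ≈⟨ base-point ⟩
      *-Fold.listFold (bumpProduct ok h) 𝓛
        ≈⟨ *-Fold.listFold-cubeFold n p (bumpProduct ok h) 𝓛
             (Unique.filter⁺ (λ A → length A ℕ.≟ suc i) faces-distinct) (All.tabulate (λ A∈ → image (proj₁ (𝓛⊆K A∈)))) ⟩
      *-Fold.cubeFold {n} (λ F → if 𝓕 F then bumpProduct ok h (embed p F) else 1L)
        ≈⟨ critical-product a p 𝓕 ok h ok-critical (λ S u _ _ → refl) ⟩
      eigenvalues ∎
      where
      open import Relation.Binary.Reasoning.Setoid setoid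
      factor : List ℤ × List ℤ → LP
      factor (S , T) = tL -L raiseN a (zPoly S T)
      h₀ h : List ℤ → ℤ → LP
      h₀ S u = factor (S , intRange (minElt 𝓛) u)
      h S u = tL -L 1L *L ζ a p S u
      bump : ∀ b → let (S , u , B) = b in
        *-Fold.listFold factor (if ok B then (S , intRange (minElt 𝓛) u) ∷ [] else []) ≃ bumpFactor ok h₀ b
      bump (S , u , B) = singleton (ok B)
        where
        singleton : ∀ b → *-Fold.listFold factor (if b then (S , intRange (minElt 𝓛) u) ∷ [] else [])
          ≃ (if b then h₀ S u else 1L)
        singleton true = *-identityʳ (h₀ S u)
        singleton false = refl
      h₀≃h : minElt 𝓛 ≡ p → ∀ b → bumpFactor ok h₀ b ≃ bumpFactor ok h b
      h₀≃h min≡p (S , u , B) = if-cong (ok B) (+-congˡ {tL} (-‿cong (trans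
        (reflexive (≡.trans (cong (λ m → raiseN a (zPoly S (intRange m u))) min≡p) (raiseN-zPoly a S (intRange p u))))
        (sym (*-identityˡ (ζ a p S u))))))
      -- For an empty family `minElt` is the conventional value 0, which may differ from p. The two
      -- base points are identified only once a member is at hand; with none, both products are
      -- empty.
      base-point : *-Fold.listFold (bumpProduct ok h₀) 𝓛 ≃ *-Fold.listFold (bumpProduct ok h) 𝓛
      base-point = go 𝓛 λ A∈ → minElt-𝓛 A∈
        where
        go : ∀ 𝓜 → (∀ {A} → A ∈ 𝓜 → minElt 𝓛 ≡ p) →
          *-Fold.listFold (bumpProduct ok h₀) 𝓜 ≃ *-Fold.listFold (bumpProduct ok h) 𝓜
        go [] _ = refl
        go 𝓜@(_ ∷ _) min≡p = *-Fold.listFold-cong (λ A → *-Fold.listFold-cong (h₀≃h (min≡p (here ≡.refl))) (bumps A)) 𝓜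

    spectrum : SpecEqUpToZero (length 𝓡) (Lud d i K)
      (map (λ { (S , T) → raiseN (d ∸ i) (zPoly S T) }) (LSG 𝓛))
    -- Sylvester's identity for X and Y costs t^N on the left and t^(length 𝓡) on the right; `det-L`
    -- adds t^(rank 𝓕) on the left and t^N on the right.
    spectrum = rank 𝓕 ℕ.+ N , length 𝓡 ℕ.+ N , coeffs (begin
      tPow (rank 𝓕 ℕ.+ N) *L charPoly (length 𝓡) (Lud d i K)
        ≈⟨ *-cong (trans (reflexive (tPow≡^ (rank 𝓕 ℕ.+ N))) (^-homo-* tL (rank 𝓕) N))
             (trans (charPoly-characteristic (length 𝓡) (Lud d i K))
               (det-cong {length 𝓡} λ r c → +-congˡ {δ r c *L tL} (-‿cong (sym (XY≋Lud r c))))) ⟩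
      tL ^ rank 𝓕 *L tL ^ N *L det (characteristic tL (X ⊗ Y))
        ≈⟨ *-assoc (tL ^ rank 𝓕) (tL ^ N) _ ⟩
      tL ^ rank 𝓕 *L (tL ^ N *L det (characteristic tL (X ⊗ Y)))
        ≈⟨ *-congˡ {tL ^ rank 𝓕} (trans (sylvester tL X Y)
             (*-congˡ {tL ^ length 𝓡} (det-cong {N} λ k l → +-congˡ {δ k l *L tL} (-‿cong (YX≋L k l))))) ⟩
      tL ^ rank 𝓕 *L (tL ^ length 𝓡 *L det (characteristic tL L))
        ≈⟨ x∙yz≈y∙xz (tL ^ rank 𝓕) (tL ^ length 𝓡) _ ⟩
      tL ^ length 𝓡 *L (tL ^ rank 𝓕 *L det (characteristic tL L))
        ≈⟨ *-congˡ {tL ^ length 𝓡} det-L ⟩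
      tL ^ length 𝓡 *L (tL ^ N *L eigenvalues)
        ≈⟨ *-assoc (tL ^ length 𝓡) (tL ^ N) eigenvalues ⟨
      tL ^ length 𝓡 *L tL ^ N *L eigenvalues
        ≈⟨ *-cong (sym (trans (reflexive (tPow≡^ (length 𝓡 ℕ.+ N))) (^-homo-* tL (length 𝓡) N))) (sym LSG-product) ⟩
      tPow (length 𝓡 ℕ.+ N) *L
        prodL (map (λ l → tL -L l) (map (λ { (S , T) → raiseN (d ∸ i) (zPoly S T) }) (LSG 𝓛))) ∎)
      where open import Relation.Binary.Reasoning.Setoid setoid

open import Defs
open import Data.Nat using (ℕ; _≤_; _∸_)
open import Data.Integer using (ℤ)
open import Data.List using (List; map; length)
open import Data.Product using (_,_)

theorem1p5 : (p q : ℤ) (K : Cx) (d : ℕ) → IsShiftedComplex p q K → HasDim d K →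
    (i : ℕ) → i ≤ d →
    SpecEqUpToZero (length (facesCard i K)) (Lud d i K)
    (map (λ { (S , T) → raiseN (d ∸ i) (zPoly S T) }) (LSG (faces i K)))
theorem1p5 p q K d shifted _ i _ =
  ShiftedSpectrum.ShiftedComplex.spectrum p q K d shifted i
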